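{- For the polynomial $1+x+y+z$ in the three variables $x,y,z$, $$c(1+x+y+z)=\frac{1}{4}.$$
   Context: For a polynomial $P(x_1,\ldots,x_k)\in\mathbb{C}[x_1,\ldots,x_k]$ of degree $d_j\ge 1$ in $x_j$, the alternative measure with respect to $x_j$ is $$c_j(P):=\frac{1}{d_j}\int_0^1\cdots\int_0^1\frac{\frac{\partial P}{\partial x_j}(e^{2\pi i t_1},\ldots,e^{2\pi i t_k})\,e^{2\pi i t_j}}{P(e^{2\pi i t_1},\ldots,e^{2\pi i t_k})}\,dt_1\cdots dt_k,$$ where the integral is a Lebesgue integral over $[0,1]^k$ (the integrand need only be defined almost everywhere and integrable). Without a subscript, $c(P)$ means $c_k(P)$, i.e. the measure with respect to the last variable. In particular $c(1+x+y+z)=\int_0^1\int_0^1\int_0^1 \frac{e^{2\pi i t_3}}{1+e^{2\pi i t_1}+e^{2\pi i t_2}+e^{2\pi i t_3}}\,dt_1\,dt_2\,dt_3$. -}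

module Defs where

open import Algebra.Bundles using (CommutativeRing; RawRing)
import Algebra.Definitions.RawSemiring as RawSemiringOps
open import Data.Bool.Base using (if_then_else_)
open import Data.Fin.Base using (Fin; toℕ; fromℕ)
open import Data.Fin.Properties using (all?)
open import Data.List.Base using (List; []; _∷_; [_]; _++_; map; foldr)
open import Data.Nat.Base as ℕ using (ℕ; zero; suc; pred)
import Data.Nat.Properties as ℕ
open import Data.Product.Base using (Σ; ∃; ∃-syntax; _×_; _,_; proj₁; proj₂)
open import Data.Vec.Base as Vec using (Vec)
open import Data.Vec.Properties using (≡-dec)
open import Data.Vec.Functional using (Vector)
open import Level using (0ℓ) renaming (suc to lsuc)
open import Relation.Binary.Core using (Rel)
open import Relation.Binary.Definitions using (Decidable)
open import Relation.Binary.PropositionalEquality.Core using (_≡_)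
open import Relation.Binary.Structures using (IsStrictTotalOrder)
import Relation.Binary.Construct.StrictToNonStrict as NonStrict
open import Relation.Nullary.Decidable using (Dec; does; _×-dec_)
open import Relation.Nullary.Negation using (¬_)

-- The real numbers enter as an arbitrary Dedekind-complete ordered field,
-- i.e. through their characterisation up to unique isomorphism.

record CompleteOrderedField : Set (lsuc 0ℓ) where
  field
    commutativeRing : CommutativeRing 0ℓ 0ℓ

  open CommutativeRing commutativeRing public

  infix 4 _<_ _≤_ _≤?_

  field
    _<_                : Rel Carrier 0ℓ
    isStrictTotalOrder : IsStrictTotalOrder _≈_ _<_
    0<1                : 0# < 1#
    +-monoʳ-<          : ∀ x {y z} → y < z → x + y < x + z
    *-pos              : ∀ {x y} → 0# < x → 0# < y → 0# < x * y
    inverse            : ∀ x → ¬ (x ≈ 0#) → ∃[ y ] x * y ≈ 1#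

  _≤_ : Rel Carrier 0ℓ
  _≤_ = NonStrict._≤_ _≈_ _<_

  UpperBound : (Carrier → Set) → Carrier → Set
  UpperBound S b = ∀ x → S x → x ≤ b

  field
    supremum : (S : Carrier → Set) → ∃ S → ∃ (UpperBound S) →
               ∃[ s ] UpperBound S s × (∀ b → UpperBound S b → s ≤ b)

  module Order = IsStrictTotalOrder isStrictTotalOrder

  _≤?_ : Decidable _≤_
  _≤?_ = NonStrict.decidable′ _≈_ _<_ Order.compare

module Analysis (𝓡 : CompleteOrderedField) where

  open CompleteOrderedField 𝓡 public
    renaming (Carrier to ℝ)
  open RawSemiringOps (RawRing.rawSemiring rawRing) public
    using (sum; product)
    renaming (_×_ to _·_)

  private
    suc-pos : ∀ n → 0# < suc n · 1#
    suc-pos zero    = Order.<-respʳ-≈ (sym (+-identityʳ 1#)) 0<1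
    suc-pos (suc n) = Order.trans (suc-pos n)
      (Order.<-respʳ-≈ (+-comm (suc n · 1#) 1#)
        (Order.<-respˡ-≈ (+-identityʳ (suc n · 1#))
          (+-monoʳ-< (suc n · 1#) 0<1)))

  1/suc : ℕ → ℝ
  1/suc n = proj₁ (inverse (suc n · 1#) λ eq →
    Order.irrefl (sym eq) (suc-pos n))

  ∣_∣ : ℝ → ℝ
  ∣ x ∣ = if does (0# ≤? x) then x else - x

  ConvergesTo : (ℕ → ℝ) → ℝ → Set
  ConvergesTo s l =
    ∀ ε → 0# < ε → ∃[ N ] (∀ n → N ℕ.≤ n → ∣ s n - l ∣ < ε)

  HasSum : (ℕ → ℝ) → ℝ → Set
  HasSum a = ConvergesTo λ n → sum {n} λ i → a (toℕ i)

  AbsolutelySummable : (ℕ → ℝ) → Set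
  AbsolutelySummable a = ∃ (HasSum λ n → ∣ a n ∣)

  UnitCube : ∀ {k} → Vector ℝ k → Set
  UnitCube t = ∀ i → 0# ≤ t i × t i ≤ 1#

  -- Closed, possibly degenerate boxes inside [0,1]ᵏ.
  record Box (k : ℕ) : Set where
    field
      lower upper : Vector ℝ k
      lower≤upper : ∀ i → lower i ≤ upper i
      lower-cube  : UnitCube lower
      upper-cube  : UnitCube upper

    volume : ℝ
    volume = product λ i → upper i - lower i

    _∋_ : Vector ℝ k → Set
    _∋_ t = ∀ i → lower i ≤ t i × t i ≤ upper i

    _∋?_ : ∀ t → Dec (_∋_ t)
    _∋?_ t = all? λ i → (lower i ≤? t i) ×-dec (t i ≤? upper i)

    indicator : Vector ℝ k → ℝ
    indicator t = if does (_∋?_ t) then 1# else 0#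

  open Box public using (volume; indicator)

  -- The Lebesgue integral over [0,1]ᵏ, in the Daniell–Mikusiński
  -- construction: f is integrable iff there are reals aₙ and boxes Bₙ with
  -- Σ |aₙ| vol(Bₙ) < ∞ such that f = Σ aₙ 1_{Bₙ} at every point where that
  -- series converges absolutely; then ∫ f = Σ aₙ vol(Bₙ).
  --
  -- f is a partial function given by its graph.  Requiring f to be defined
  -- at *every* point of absolute convergence still allows f to be undefined
  -- on a null set: cover the null set infinitely often by boxes of small
  -- total volume and insert terms +1_B, −1_B for each of them, so that the
  -- series does not converge absolutely there.
  HasIntegral : ∀ {k} → (Vector ℝ k → ℝ → Set) → ℝ → Set
  HasIntegral {k} f I =
    Σ (ℕ → ℝ) λ a → Σ (ℕ → Box k) λ B →
      AbsolutelySummable (λ n → a n * volume (B n)) ×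
      HasSum (λ n → a n * volume (B n)) I ×
      (∀ t → UnitCube t →
        AbsolutelySummable (λ n → a n * indicator (B n) t) →
        ∃[ v ] f t v × HasSum (λ n → a n * indicator (B n) t) v)

  record ℂ : Set where
    constructor _+i_
    field
      re im : ℝ

  open ℂ public

  ℂ-rawRing : RawRing 0ℓ 0ℓ
  ℂ-rawRing = record
    { Carrier = ℂ
    ; _≈_     = λ z w → re z ≈ re w × im z ≈ im w
    ; _+_     = λ z w → (re z + re w) +i (im z + im w)
    ; _*_     = λ z w → (re z * re w - im z * im w)
                     +i (re z * im w + im z * re w)
    ; -_      = λ z → (- re z) +i (- im z)
    ; 0#      = 0# +i 0#
    ; 1#      = 1# +i 0#
    }

  module ℂ-Ops where
    open RawRing ℂ-rawRing public
    open RawSemiringOps rawSemiring public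
      using (_^_; sum; product)
      renaming (_×_ to _·_)

  fromℝ : ℝ → ℂ
  fromℝ x = x +i 0#

  HasSumℂ : (ℕ → ℂ) → ℂ → Set
  HasSumℂ a s = HasSum (λ n → re (a n)) (re s) × HasSum (λ n → im (a n)) (im s)

  HasIntegralℂ : ∀ {k} → (Vector ℝ k → ℂ → Set) → ℂ → Set
  HasIntegralℂ f I =
    HasIntegral (λ t u → ∃[ w ] f t w × re w ≈ u) (re I) ×
    HasIntegral (λ t u → ∃[ w ] f t w × im w ≈ u) (im I)

  -- zⁿ / n!
  expTerm : ℂ → ℕ → ℂ
  expTerm z zero    = ℂ-Ops.1#
  expTerm z (suc n) = expTerm z n ℂ-Ops.* (z ℂ-Ops.* fromℝ (1/suc n))

  -- w = eᶻ
  IsExp : ℂ → ℂ → Set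
  IsExp z w = HasSumℂ (expTerm z) w

  -- w = e^{iθ}
  IsCis : ℝ → ℂ → Set
  IsCis θ = IsExp (0# +i θ)

  -- π is the least positive zero of sin θ = Im e^{iθ}.
  IsPi : ℝ → Set
  IsPi p =
    0# < p ×
    (∃[ w ] IsCis p w × im w ≈ 0#) ×
    (∀ θ → 0# < θ → θ < p → ∀ w → IsCis θ w → ¬ (im w ≈ 0#))

  -- w = e^{2πit}
  IsUnitCircle : ℝ → ℂ → Set
  IsUnitCircle t w = ∃[ p ] IsPi p × IsCis (2 · p * t) w

  -- w = u / v
  IsQuotient : ℂ → ℂ → ℂ → Set
  IsQuotient u v w = ¬ (v ℂ-Ops.≈ ℂ-Ops.0#) × w ℂ-Ops.* v ℂ-Ops.≈ u

  -- A polynomial in k variables is a formal sum of terms a · x^e; the same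
  -- exponent e may occur repeatedly, `coefficient` collects all occurrences.
  Polynomial : ℕ → Set
  Polynomial k = List (ℂ × Vec ℕ k)

  private variable k : ℕ

  coefficient : Polynomial k → Vec ℕ k → ℂ
  coefficient P e = foldr
    (λ (a , e′) s → if does (≡-dec ℕ._≟_ e e′) then a ℂ-Ops.+ s else s)
    ℂ-Ops.0# P

  eval : Polynomial k → Vector ℂ k → ℂ
  eval P x = foldr
    (λ (a , e) s →
      a ℂ-Ops.* ℂ-Ops.product (λ i → x i ℂ-Ops.^ Vec.lookup e i) ℂ-Ops.+ s)
    ℂ-Ops.0# P

  ∂ : Fin k → Polynomial k → Polynomial k
  ∂ j = map λ (a , e) →
    Vec.lookup e j ℂ-Ops.· a , Vec.updateAt e j pred

  HasDegree : Fin k → Polynomial k → ℕ → Set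
  HasDegree j P d =
    (∃[ e ] Vec.lookup e j ≡ d × ¬ (coefficient P e ℂ-Ops.≈ ℂ-Ops.0#)) ×
    (∀ e → ¬ (coefficient P e ℂ-Ops.≈ ℂ-Ops.0#) → Vec.lookup e j ℕ.≤ d)

  one : Polynomial k
  one = [ ℂ-Ops.1# , Vec.replicate _ 0 ]

  var : Fin k → Polynomial k
  var j = [ ℂ-Ops.1# , Vec.updateAt (Vec.replicate _ 0) j suc ]

  infixl 6 _⊕_
  _⊕_ : Polynomial k → Polynomial k → Polynomial k
  _⊕_ = _++_

  -- Graph of t ↦ ∂ⱼP(x) xⱼ / P(x), where xᵢ = e^{2πi tᵢ}.
  Integrand : Fin k → Polynomial k → Vector ℝ k → ℂ → Set
  Integrand {k} j P t w =
    Σ (Vector ℂ k) λ x →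
      (∀ i → IsUnitCircle (t i) (x i)) ×
      IsQuotient (eval (∂ j P) x ℂ-Ops.* x j) (eval P x) w

  -- cⱼ(P) = c; the degree in xⱼ is suc d, hence at least 1.
  HasMeasureAt : Fin k → Polynomial k → ℂ → Set
  HasMeasureAt j P c =
    ∃[ d ] HasDegree j P (suc d) ×
    (∃[ I ] HasIntegralℂ (Integrand j P) I ×
            c ℂ-Ops.≈ fromℝ (1/suc d) ℂ-Ops.* I)

  -- c(P) = c, with respect to the last variable.
  HasMeasure : Polynomial (suc k) → ℂ → Set
  HasMeasure {k} = HasMeasureAt (fromℕ k)

{-# OPTIONS --safe #-}
-- Divided by 1 + x + y + z, the functions 1, x, y, z have the same integral over the torus, by
-- permuting coordinates and by the automorphism (x, y, z) ↦ (1/x, y/x, z/x); these quotients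
-- add up to 1, so each integral is ¼.  On a grid of 2ⁿ-th roots of unity both symmetries hold
-- exactly, also after the quotients are replaced by ¼ wherever |1 + x + y + z| < δ.  So the step
-- functions taking these truncated values on finer and finer grids all have integral exactly ¼,
-- and it remains to see that their increments are absolutely summable.  On most cells this is a
-- Lipschitz estimate.  The others are few: |1 + x + y + z| < δ confines z to a disc of radius δ
-- and, since (1 + x)(1 + y)(x + y) = x y (|1 + x + y|² - 1), makes one of 1 + x, 1 + y, x + y as
-- small as O(δ^⅓).  The zeros of 1 + x + y + z have a coordinate -1, so they lie on faces of the
-- grids, where the series is made to diverge by terms on degenerate boxes.
module Submission where

open import Defs
open import Axiom.ExcludedMiddle using (ExcludedMiddle)
open import Data.Fin.Patterns using (0F; 1F; 2F)
open import Level using (0ℓ)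
open import Algebra.Bundles using (CommutativeRing; RawRing)
import Algebra.Definitions.RawSemiring as RawSemiringOps
import Algebra.Properties.AbelianGroup as AbelianGroupProperties
import Algebra.Properties.Ring as RingProperties
import Algebra.Properties.Semiring.Mult.TCOptimised as Mult′
import Algebra.Properties.Semiring.Sum as SemiringSum
import Algebra.Solver.Ring
import Algebra.Solver.Ring.AlmostCommutativeRing as ACR
open import Data.Bool.Base using (if_then_else_)
open import Data.Empty using (⊥; ⊥-elim)
open import Data.Fin.Base as Fin using (Fin; toℕ)
import Data.Fin.Properties as Fin
open import Data.Integer.Base as ℤ using (ℤ; +_; -[1+_])
import Data.Integer.Properties as ℤ
open import Data.List.Base using (List; []; _∷_; _++_; length)
open import Data.List.Relation.Unary.All using (All; []; _∷_)
open import Data.Maybe.Base using (Maybe; just; nothing)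
open import Data.Nat.Base as ℕ using (ℕ; zero; suc)
import Data.Nat.Properties as ℕ
open import Data.Product.Base using (∃; ∃-syntax; _×_; _,_; proj₁; proj₂)
open import Data.Sum.Base using (_⊎_; inj₁; inj₂; [_,_]′)
open import Data.Vec.Base as Vec using ([]; _∷_)
open import Data.Vec.Properties using (≡-dec)
open import Function.Base using (_∘_)
open import Relation.Binary.Bundles using (StrictPartialOrder)
import Relation.Binary.Construct.StrictToNonStrict as NonStrict
open import Relation.Binary.Definitions using (tri<; tri≈; tri>)
open import Relation.Binary.PropositionalEquality.Core using (_≡_)
import Relation.Binary.PropositionalEquality as ≡
import Relation.Binary.Reasoning.Setoid as SetoidReasoning
import Relation.Binary.Reasoning.StrictPartialOrder as StrictReasoning
open import Relation.Nullary.Decidable using (Dec; yes; no; does; decidable-stable)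
open import Relation.Nullary.Negation using (¬_)

-- Where |1 + x + y + z| is about δ, the quotient can be as large as 1/δ. Confining `z` to an arc of
-- relative length O(δ) only balances this height: every level would contribute O(1), which is not
-- summable. The gain comes from the factorisation. With τ = ½^ m and δ = τ³/8, a bad cell also has
-- one of three factors below τ, a condition on `x` and `y` of relative size O(τ), so level `m`
-- contributes O(½^ m). On the good cells the quotient rule costs a factor of order 1/δ², so the
-- mesh is taken of order τ δ². This fixes the growth rates: 3 binary digits per level for δ, and 1
-- + 2 · 3 = 7 for the mesh. `HasIntegral` asks for a single series of boxes with the right sum at
-- every point of absolute convergence. Exactness of the grid means is what evaluates it: the first
-- block integrates to ¼, every later block to 0, and the value never has to be found as a limit.

-- Ring solver with integer coefficients.

module IntegerSolver (R : CommutativeRing 0ℓ 0ℓ) where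
  open CommutativeRing R
  open Mult′ semiring using (×-homo-+; ×1-homo-*; 1+×) renaming (_×_ to _×′_)
  open RingProperties ring using (-‿distribˡ-*; -‿distribʳ-*; -‿involutive; -0#≈0#)
  open AbelianGroupProperties +-abelianGroup using (⁻¹-∙-comm)
  open SetoidReasoning setoid

  -- With the optimised multiples, `+ 0` and `+ 1` go to `0#` and `1#` by definition, so solver
  -- constants match the constants of goals.
  fromℤ : ℤ → Carrier
  fromℤ (+ n)    = n ×′ 1#
  fromℤ -[1+ n ] = - (suc n ×′ 1#)

  private
    cancel-1 : ∀ x y → (1# + x) - (1# + y) ≈ x - y
    cancel-1 x y = begin
      (1# + x) - (1# + y)  ≈⟨ +-cong (+-comm 1# x) (sym (⁻¹-∙-comm 1# y)) ⟩
      (x + 1#) + (- 1# + - y)  ≈⟨ +-assoc x 1# _ ⟩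
      x + (1# + (- 1# + - y))  ≈⟨ +-congˡ (+-assoc 1# _ _) ⟨
      x + ((1# + - 1#) + - y)  ≈⟨ +-congˡ (+-congʳ (-‿inverseʳ 1#)) ⟩
      x + (0# + - y)  ≈⟨ +-congˡ (+-identityˡ _) ⟩
      x - y  ∎

    fromℤ-⊖ : ∀ m n → fromℤ (m ℤ.⊖ n) ≈ m ×′ 1# - n ×′ 1#
    fromℤ-⊖ zero    zero    = sym (-‿inverseʳ 0#)
    fromℤ-⊖ zero    (suc n) = sym (+-identityˡ _)
    fromℤ-⊖ (suc m) zero    = sym (trans (+-congˡ -0#≈0#) (+-identityʳ _))
    fromℤ-⊖ (suc m) (suc n) = begin
      fromℤ (suc m ℤ.⊖ suc n)  ≡⟨ ≡.cong fromℤ (ℤ.[1+m]⊖[1+n]≡m⊖n m n) ⟩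
      fromℤ (m ℤ.⊖ n)  ≈⟨ fromℤ-⊖ m n ⟩
      m ×′ 1# - n ×′ 1#  ≈⟨ cancel-1 _ _ ⟨
      (1# + m ×′ 1#) - (1# + n ×′ 1#)  ≈⟨ +-cong (1+× m 1#) (-‿cong (1+× n 1#)) ⟨
      suc m ×′ 1# - suc n ×′ 1#  ∎

    fromℤ-neg : ∀ i → fromℤ (ℤ.- i) ≈ - fromℤ i
    fromℤ-neg (+ zero)   = sym -0#≈0#
    fromℤ-neg (+ suc n)  = refl
    fromℤ-neg -[1+ n ]   = sym (-‿involutive _)

    fromℤ-+ : ∀ i j → fromℤ (i ℤ.+ j) ≈ fromℤ i + fromℤ j
    fromℤ-+ (+ m)    (+ n)    = ×-homo-+ 1# m n
    fromℤ-+ (+ m)    -[1+ n ] = fromℤ-⊖ m (suc n)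
    fromℤ-+ -[1+ m ] (+ n)    = trans (fromℤ-⊖ n (suc m)) (+-comm _ _)
    fromℤ-+ -[1+ m ] -[1+ n ] = begin
      fromℤ (-[1+ m ] ℤ.+ -[1+ n ])  ≡⟨ ≡.cong (λ k → fromℤ -[1+ k ]) (ℕ.+-suc m n) ⟨
      fromℤ (ℤ.- (+ suc m ℤ.+ + suc n))  ≈⟨ fromℤ-neg (+ suc m ℤ.+ + suc n) ⟩
      - fromℤ (+ suc m ℤ.+ + suc n)  ≈⟨ -‿cong (×-homo-+ 1# (suc m) (suc n)) ⟩
      - (suc m ×′ 1# + suc n ×′ 1#)  ≈⟨ ⁻¹-∙-comm _ _ ⟨
      - (suc m ×′ 1#) - suc n ×′ 1#  ∎

    fromℤ-*-pos : ∀ m j → fromℤ (+ m ℤ.* j) ≈ fromℤ (+ m) * fromℤ j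
    fromℤ-*-pos m (+ n) = trans (reflexive (≡.cong fromℤ (≡.sym (ℤ.pos-* m n)))) (×1-homo-* m n)
    fromℤ-*-pos m -[1+ n ] = begin
      fromℤ (+ m ℤ.* -[1+ n ])  ≡⟨ ≡.cong fromℤ (ℤ.neg-distribʳ-* (+ m) (+ suc n)) ⟨
      fromℤ (ℤ.- (+ m ℤ.* + suc n))  ≈⟨ fromℤ-neg (+ m ℤ.* + suc n) ⟩
      - fromℤ (+ m ℤ.* + suc n)  ≈⟨ -‿cong (fromℤ-*-pos m (+ suc n)) ⟩
      - (m ×′ 1# * suc n ×′ 1#)  ≈⟨ -‿distribʳ-* _ _ ⟩
      m ×′ 1# * - (suc n ×′ 1#)  ∎

    fromℤ-* : ∀ i j → fromℤ (i ℤ.* j) ≈ fromℤ i * fromℤ j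
    fromℤ-* (+ m)    j = fromℤ-*-pos m j
    fromℤ-* -[1+ m ] j = begin
      fromℤ (-[1+ m ] ℤ.* j)  ≡⟨ ≡.cong fromℤ (ℤ.neg-distribˡ-* (+ suc m) j) ⟨
      fromℤ (ℤ.- (+ suc m ℤ.* j))  ≈⟨ fromℤ-neg (+ suc m ℤ.* j) ⟩
      - fromℤ (+ suc m ℤ.* j)  ≈⟨ -‿cong (fromℤ-*-pos (suc m) j) ⟩
      - (suc m ×′ 1# * fromℤ j)  ≈⟨ -‿distribˡ-* _ _ ⟩
      - (suc m ×′ 1#) * fromℤ j  ∎

    morphism : ℤ.+-*-rawRing ACR.-Raw-AlmostCommutative⟶ ACR.fromCommutativeRing R
    morphism = record
      { ⟦_⟧    = fromℤ
      ; +-homo = fromℤ-+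
      ; *-homo = fromℤ-*
      ; -‿homo = fromℤ-neg
      ; 0-homo = refl
      ; 1-homo = refl
      }

    fromℤ-≟ : ∀ i j → Maybe (fromℤ i ≈ fromℤ j)
    fromℤ-≟ i j with i ℤ.≟ j
    ... | yes i≡j = just (reflexive (≡.cong fromℤ i≡j))
    ... | no  _   = nothing

  open Algebra.Solver.Ring ℤ.+-*-rawRing (ACR.fromCommutativeRing R) morphism fromℤ-≟ public
    using (Polynomial; solve; _:+_; _:*_; _:-_; :-_; _:=_; con)

  :0 :1 :2 : ∀ {n} → Polynomial n
  :0 = con (+ 0)
  :1 = con (+ 1)
  :2 = con (+ 2)

-- Order, absolute value and powers of ½ in a complete ordered field.

module OrderedField (em : ExcludedMiddle 0ℓ) (𝓡 : CompleteOrderedField) where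
  open Analysis 𝓡
  open IntegerSolver commutativeRing public hiding (Polynomial; fromℤ)
  open RingProperties ring public using (-0#≈0#)

  strictPartialOrder : StrictPartialOrder 0ℓ 0ℓ 0ℓ
  strictPartialOrder = record { isStrictPartialOrder = Order.isStrictPartialOrder }

  module ≈-Reasoning = SetoidReasoning setoid
  module ≤-Reasoning = StrictReasoning strictPartialOrder

  private module NS = NonStrict _≈_ _<_

  <⇒≤ : ∀ {x y} → x < y → x ≤ y
  <⇒≤ = inj₁

  ≤-reflexive : ∀ {x y} → x ≈ y → x ≤ y
  ≤-reflexive = inj₂

  ≤-refl : ∀ {x} → x ≤ x
  ≤-refl = inj₂ refl

  ≤-trans : ∀ {x y z} → x ≤ y → y ≤ z → x ≤ z
  ≤-trans = NS.trans isEquivalence Order.<-resp-≈ Order.trans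

  ≤-antisym : ∀ {x y} → x ≤ y → y ≤ x → x ≈ y
  ≤-antisym = NS.antisym isEquivalence Order.trans Order.irrefl

  ≤-total : ∀ x y → x ≤ y ⊎ y ≤ x
  ≤-total = NS.total Order.compare

  <-≤-trans : ∀ {x y z} → x < y → y ≤ z → x < z
  <-≤-trans = NS.<-≤-trans Order.trans Order.<-respʳ-≈

  ≤-<-trans : ∀ {x y z} → x ≤ y → y < z → x < z
  ≤-<-trans = NS.≤-<-trans sym Order.trans Order.<-respˡ-≈

  ≤-resp : ∀ {x x′ y y′} → x ≈ x′ → y ≈ y′ → x ≤ y → x′ ≤ y′
  ≤-resp p q x≤y = ≤-trans (≤-reflexive (sym p)) (≤-trans x≤y (≤-reflexive q))

  <-resp : ∀ {x x′ y y′} → x ≈ x′ → y ≈ y′ → x < y → x′ < y′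
  <-resp p q x<y = Order.<-respˡ-≈ p (Order.<-respʳ-≈ q x<y)

  <⇒≱ : ∀ {x y} → x < y → ¬ (y ≤ x)
  <⇒≱ x<y y≤x = Order.irrefl refl (<-≤-trans x<y y≤x)

  <⇒≉ : ∀ {x y} → x < y → ¬ (x ≈ y)
  <⇒≉ x<y x≈y = Order.irrefl x≈y x<y

  <-or-≥ : ∀ x y → x < y ⊎ y ≤ x
  <-or-≥ x y with Order.compare x y
  ... | tri< p _ _ = inj₁ p
  ... | tri≈ _ p _ = inj₂ (inj₂ (sym p))
  ... | tri> _ _ p = inj₂ (inj₁ p)

  ≮⇒≥ : ∀ {x y} → ¬ (x < y) → y ≤ x
  ≮⇒≥ {x} {y} x≮y = [ (λ x<y → ⊥-elim (x≮y x<y)) , (λ y≤x → y≤x) ]′ (<-or-≥ x y)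

  ≰⇒> : ∀ {x y} → ¬ (x ≤ y) → y < x
  ≰⇒> {x} {y} x≰y = [ (λ y<x → y<x) , (λ x≤y → ⊥-elim (x≰y x≤y)) ]′ (<-or-≥ y x)

  +-monoʳ-≤ : ∀ x {y z} → y ≤ z → x + y ≤ x + z
  +-monoʳ-≤ x (inj₁ y<z) = inj₁ (+-monoʳ-< x y<z)
  +-monoʳ-≤ x (inj₂ y≈z) = inj₂ (+-congˡ y≈z)

  +-monoˡ-≤ : ∀ x {y z} → y ≤ z → y + x ≤ z + x
  +-monoˡ-≤ x y≤z = ≤-resp (+-comm x _) (+-comm x _) (+-monoʳ-≤ x y≤z)

  +-mono-≤ : ∀ {x y u v} → x ≤ y → u ≤ v → x + u ≤ y + v
  +-mono-≤ {y = y} {u} x≤y u≤v = ≤-trans (+-monoˡ-≤ u x≤y) (+-monoʳ-≤ y u≤v)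

  +-mono-≤-< : ∀ {x y u v} → x ≤ y → u < v → x + u < y + v
  +-mono-≤-< {y = y} {u} x≤y u<v = ≤-<-trans (+-monoˡ-≤ u x≤y) (+-monoʳ-< y u<v)

  +-mono-<-≤ : ∀ {x y u v} → x < y → u ≤ v → x + u < y + v
  +-mono-<-≤ x<y u≤v = <-resp (+-comm _ _) (+-comm _ _) (+-mono-≤-< u≤v x<y)

  +-mono-< : ∀ {x y u v} → x < y → u < v → x + u < y + v
  +-mono-< x<y u<v = +-mono-<-≤ x<y (<⇒≤ u<v)

  gap-nonneg : ∀ {x y} → x ≤ y → 0# ≤ y - x
  gap-nonneg {x} {y} x≤y = ≤-resp (-‿inverseʳ x) refl (+-monoˡ-≤ (- x) x≤y)

  gap-pos : ∀ {x y} → x < y → 0# < y - x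
  gap-pos {x} {y} x<y = <-resp (-‿inverseʳ x) refl (+-mono-<-≤ x<y ≤-refl)

  -- The standard way to prove an inequality below: exhibit the difference `e` as visibly
  -- nonnegative and leave the identity to the ring solver.
  by-nonneg : ∀ {x y e} → 0# ≤ e → y ≈ x + e → x ≤ y
  by-nonneg {x} 0≤e eq = ≤-resp (+-identityʳ x) (sym eq) (+-monoʳ-≤ x 0≤e)

  by-pos : ∀ {x y e} → 0# < e → y ≈ x + e → x < y
  by-pos {x} 0<e eq = <-resp (+-identityʳ x) (sym eq) (+-monoʳ-< x 0<e)

  neg-mono-≤ : ∀ {x y} → x ≤ y → - y ≤ - x
  neg-mono-≤ {x} {y} x≤y =
    by-nonneg (gap-nonneg x≤y) (solve 2 (λ x y → :- x := :- y :+ (y :- x)) refl x y)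

  neg-nonneg : ∀ {x} → x ≤ 0# → 0# ≤ - x
  neg-nonneg x≤0 = ≤-resp -0#≈0# refl (neg-mono-≤ x≤0)

  +-nonneg : ∀ {x y} → 0# ≤ x → 0# ≤ y → 0# ≤ x + y
  +-nonneg 0≤x 0≤y = ≤-resp (+-identityʳ 0#) refl (+-mono-≤ 0≤x 0≤y)

  +-pos : ∀ {x y} → 0# < x → 0# < y → 0# < x + y
  +-pos 0<x 0<y = <-resp (+-identityʳ 0#) refl (+-mono-< 0<x 0<y)

  *-nonneg : ∀ {x y} → 0# ≤ x → 0# ≤ y → 0# ≤ x * y
  *-nonneg (inj₁ 0<x) (inj₁ 0<y) = inj₁ (*-pos 0<x 0<y)
  *-nonneg {x} _ (inj₂ 0≈y) = inj₂ (trans (sym (zeroʳ x)) (*-congˡ 0≈y))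
  *-nonneg {y = y} (inj₂ 0≈x) _ = inj₂ (trans (sym (zeroˡ y)) (*-congʳ 0≈x))

  *-monoˡ-≤ : ∀ {x y z} → 0# ≤ z → x ≤ y → z * x ≤ z * y
  *-monoˡ-≤ {x} {y} {z} 0≤z x≤y = by-nonneg (*-nonneg 0≤z (gap-nonneg x≤y))
    (solve 3 (λ x y z → z :* y := z :* x :+ z :* (y :- x)) refl x y z)

  *-monoʳ-≤ : ∀ {x y z} → 0# ≤ z → x ≤ y → x * z ≤ y * z
  *-monoʳ-≤ 0≤z x≤y = ≤-resp (*-comm _ _) (*-comm _ _) (*-monoˡ-≤ 0≤z x≤y)

  *-monoˡ-< : ∀ {x y z} → 0# < z → x < y → z * x < z * y
  *-monoˡ-< {x} {y} {z} 0<z x<y = by-pos (*-pos 0<z (gap-pos x<y))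
    (solve 3 (λ x y z → z :* y := z :* x :+ z :* (y :- x)) refl x y z)

  *-mono-≤ : ∀ {x y u v} → 0# ≤ x → 0# ≤ u → x ≤ y → u ≤ v → x * u ≤ y * v
  *-mono-≤ 0≤x 0≤u x≤y u≤v = ≤-trans (*-monoʳ-≤ 0≤u x≤y) (*-monoˡ-≤ (≤-trans 0≤x x≤y) u≤v)

  *-cancelˡ-≤ : ∀ {x y z} → 0# < z → z * x ≤ z * y → x ≤ y
  *-cancelˡ-≤ {x} {y} 0<z zx≤zy with <-or-≥ y x
  ... | inj₁ y<x = ⊥-elim (<⇒≱ (*-monoˡ-< 0<z y<x) zx≤zy)
  ... | inj₂ x≤y = x≤y

  *-cancelˡ-< : ∀ {x y z} → 0# ≤ z → z * x < z * y → x < y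
  *-cancelˡ-< {x} {y} 0≤z zx<zy with <-or-≥ x y
  ... | inj₁ x<y = x<y
  ... | inj₂ y≤x = ⊥-elim (<⇒≱ zx<zy (*-monoˡ-≤ 0≤z y≤x))

  square-nonneg : ∀ x → 0# ≤ x * x
  square-nonneg x with ≤-total 0# x
  ... | inj₁ 0≤x = *-nonneg 0≤x 0≤x
  ... | inj₂ x≤0 = ≤-resp refl (solve 1 (λ x → (:- x) :* (:- x) := x :* x) refl x)
    (*-nonneg (neg-nonneg x≤0) (neg-nonneg x≤0))

  square-mono-≤ : ∀ {x y} → 0# ≤ x → x ≤ y → x * x ≤ y * y
  square-mono-≤ 0≤x x≤y = *-mono-≤ 0≤x 0≤x x≤y x≤y

  square-mono-< : ∀ {x y} → 0# ≤ x → x < y → x * x < y * y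
  square-mono-< 0≤x x<y =
    ≤-<-trans (*-monoˡ-≤ 0≤x (<⇒≤ x<y)) (<-resp (*-comm _ _) refl (*-monoˡ-< (≤-<-trans 0≤x x<y) x<y))

  square-cancel-≤ : ∀ {x y} → 0# ≤ y → x * x ≤ y * y → x ≤ y
  square-cancel-≤ {x} {y} 0≤y xx≤yy with <-or-≥ y x
  ... | inj₁ y<x = ⊥-elim (<⇒≱ (square-mono-< 0≤y y<x) xx≤yy)
  ... | inj₂ x≤y = x≤y

  square-zero : ∀ {x} → x * x ≈ 0# → x ≈ 0#
  square-zero {x} xx≈0 with Order.compare 0# x
  ... | tri< 0<x _ _ = ⊥-elim (<⇒≉ (*-pos 0<x 0<x) (sym xx≈0))
  ... | tri≈ _ 0≈x _ = sym 0≈x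
  ... | tri> _ _ x<0 = ⊥-elim (<⇒≉ (*-pos 0<-x 0<-x)
    (sym (trans (solve 1 (λ x → (:- x) :* (:- x) := x :* x) refl x) xx≈0)))
    where
    0<-x : 0# < - x
    0<-x = <-resp refl (+-identityˡ _) (gap-pos x<0)

  open Mult′ semiring using () renaming (_×_ to _×′_)

  -- Definitionally what `con (+ n)` denotes in the solver.
  num : ℕ → ℝ
  num n = n ×′ 1#

  num-suc : ∀ n → num (suc n) ≈ 1# + num n
  num-suc n = Mult′.1+× semiring n 1#

  num-+ : ∀ m n → num (m ℕ.+ n) ≈ num m + num n
  num-+ = Mult′.×-homo-+ semiring 1#

  num-* : ∀ m n → num (m ℕ.* n) ≈ num m * num n
  num-* = Mult′.×1-homo-* semiring

  ·1≈num : ∀ n → n · 1# ≈ num n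
  ·1≈num n = Mult′.×ᵤ≈× semiring n 1#

  num-nonneg : ∀ n → 0# ≤ num n
  num-nonneg zero    = ≤-refl
  num-nonneg (suc n) = ≤-resp refl (sym (num-suc n)) (+-nonneg (<⇒≤ 0<1) (num-nonneg n))

  num-pos : ∀ n → 0# < num (suc n)
  num-pos n = <-resp refl (trans (+-comm _ _) (sym (num-suc n)))
    (≤-<-trans (num-nonneg n) (<-resp (+-identityʳ _) refl (+-monoʳ-< (num n) 0<1)))

  num-mono-≤ : ∀ {m n} → m ℕ.≤ n → num m ≤ num n
  num-mono-≤ {m} {n} m≤n = by-nonneg (num-nonneg (n ℕ.∸ m))
    (trans (reflexive (≡.cong num (≡.sym (ℕ.m+[n∸m]≡n m≤n)))) (num-+ m (n ℕ.∸ m)))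

  0≤1 : 0# ≤ 1#
  0≤1 = <⇒≤ 0<1

  -- Junk value: inv x ≈ 0# when x ≈ 0#.
  inv : ℝ → ℝ
  inv x with Order._≟_ x 0#
  ... | yes _  = 0#
  ... | no x≉0 = proj₁ (inverse x x≉0)

  inv-inverseʳ : ∀ {x} → ¬ (x ≈ 0#) → x * inv x ≈ 1#
  inv-inverseʳ {x} x≉0 with Order._≟_ x 0#
  ... | yes x≈0 = ⊥-elim (x≉0 x≈0)
  ... | no x≉0′ = proj₂ (inverse x x≉0′)

  inv-unique : ∀ {x y} → x * y ≈ 1# → y ≈ inv x
  inv-unique {x} {y} xy≈1 = begin
    y  ≈⟨ solve 1 (λ y → y := :1 :* y) refl y ⟩
    1# * y  ≈⟨ *-congʳ (inv-inverseʳ x≉0) ⟨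
    x * inv x * y  ≈⟨ solve 3 (λ x i y → x :* i :* y := x :* y :* i) refl x (inv x) y ⟩
    x * y * inv x  ≈⟨ *-congʳ xy≈1 ⟩
    1# * inv x  ≈⟨ *-identityˡ _ ⟩
    inv x  ∎
    where
    open ≈-Reasoning
    x≉0 : ¬ (x ≈ 0#)
    x≉0 x≈0 = <⇒≉ 0<1 (trans (sym (zeroˡ y)) (trans (*-congʳ (sym x≈0)) xy≈1))

  >0⇒≉0 : ∀ {x} → 0# < x → ¬ (x ≈ 0#)
  >0⇒≉0 0<x x≈0 = <⇒≉ 0<x (sym x≈0)

  inv-pos : ∀ {x} → 0# < x → 0# < inv x
  inv-pos {x} 0<x = *-cancelˡ-< (<⇒≤ 0<x)
    (<-resp (sym (zeroʳ x)) (sym (inv-inverseʳ (>0⇒≉0 0<x))) 0<1)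

  *-zero-product : ∀ {x y} → x * y ≈ 0# → x ≈ 0# ⊎ y ≈ 0#
  *-zero-product {x} {y} xy≈0 with Order._≟_ x 0#
  ... | yes x≈0 = inj₁ x≈0
  ... | no  x≉0 = inj₂ (begin
    y  ≈⟨ *-identityˡ y ⟨
    1# * y  ≈⟨ *-congʳ (inv-inverseʳ x≉0) ⟨
    x * inv x * y  ≈⟨ solve 3 (λ x i y → x :* i :* y := x :* y :* i) refl x (inv x) y ⟩
    x * y * inv x  ≈⟨ *-congʳ xy≈0 ⟩
    0# * inv x  ≈⟨ zeroˡ _ ⟩
    0#  ∎)
    where open ≈-Reasoning

  ∣∣-nonneg-≈ : ∀ {x} → 0# ≤ x → ∣ x ∣ ≈ x
  ∣∣-nonneg-≈ {x} 0≤x with 0# ≤? x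
  ... | yes _  = refl
  ... | no 0≰x = ⊥-elim (0≰x 0≤x)

  ∣∣-nonpos-≈ : ∀ {x} → x ≤ 0# → ∣ x ∣ ≈ - x
  ∣∣-nonpos-≈ {x} x≤0 with 0# ≤? x
  ... | yes 0≤x = trans (≤-antisym x≤0 0≤x) (trans (sym -0#≈0#) (-‿cong (≤-antisym 0≤x x≤0)))
  ... | no _    = refl

  ∣∣-nonneg : ∀ x → 0# ≤ ∣ x ∣
  ∣∣-nonneg x with ≤-total 0# x
  ... | inj₁ 0≤x = ≤-resp refl (sym (∣∣-nonneg-≈ 0≤x)) 0≤x
  ... | inj₂ x≤0 = ≤-resp refl (sym (∣∣-nonpos-≈ x≤0)) (neg-nonneg x≤0)

  x≤∣x∣ : ∀ x → x ≤ ∣ x ∣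
  x≤∣x∣ x with ≤-total 0# x
  ... | inj₁ 0≤x = ≤-reflexive (sym (∣∣-nonneg-≈ 0≤x))
  ... | inj₂ x≤0 = ≤-trans x≤0 (∣∣-nonneg x)

  -x≤∣x∣ : ∀ x → - x ≤ ∣ x ∣
  -x≤∣x∣ x with ≤-total 0# x
  ... | inj₁ 0≤x = ≤-trans (≤-resp refl -0#≈0# (neg-mono-≤ 0≤x)) (∣∣-nonneg x)
  ... | inj₂ x≤0 = ≤-reflexive (sym (∣∣-nonpos-≈ x≤0))

  ∣∣-≤ : ∀ {x r} → x ≤ r → - x ≤ r → ∣ x ∣ ≤ r
  ∣∣-≤ {x} x≤r -x≤r with ≤-total 0# x
  ... | inj₁ 0≤x = ≤-resp (sym (∣∣-nonneg-≈ 0≤x)) refl x≤r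
  ... | inj₂ x≤0 = ≤-resp (sym (∣∣-nonpos-≈ x≤0)) refl -x≤r

  ∣∣-< : ∀ {x r} → x < r → - x < r → ∣ x ∣ < r
  ∣∣-< {x} x<r -x<r with ≤-total 0# x
  ... | inj₁ 0≤x = <-resp (sym (∣∣-nonneg-≈ 0≤x)) refl x<r
  ... | inj₂ x≤0 = <-resp (sym (∣∣-nonpos-≈ x≤0)) refl -x<r

  ∣∣-cong : ∀ {x y} → x ≈ y → ∣ x ∣ ≈ ∣ y ∣
  ∣∣-cong {x} {y} x≈y with ≤-total 0# x
  ... | inj₁ 0≤x = trans (∣∣-nonneg-≈ 0≤x) (trans x≈y (sym (∣∣-nonneg-≈ (≤-resp refl x≈y 0≤x))))
  ... | inj₂ x≤0 =
    trans (∣∣-nonpos-≈ x≤0) (trans (-‿cong x≈y) (sym (∣∣-nonpos-≈ (≤-resp x≈y refl x≤0))))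

  ∣-x∣≈∣x∣ : ∀ x → ∣ - x ∣ ≈ ∣ x ∣
  ∣-x∣≈∣x∣ x = ≤-antisym
    (∣∣-≤ (-x≤∣x∣ x) (≤-resp (solve 1 (λ x → x := :- (:- x)) refl x) refl (x≤∣x∣ x)))
    (∣∣-≤ (≤-resp (solve 1 (λ x → :- (:- x) := x) refl x) refl (-x≤∣x∣ (- x))) (x≤∣x∣ (- x)))

  ∣x+y∣≤∣x∣+∣y∣ : ∀ x y → ∣ x + y ∣ ≤ ∣ x ∣ + ∣ y ∣
  ∣x+y∣≤∣x∣+∣y∣ x y = ∣∣-≤ (+-mono-≤ (x≤∣x∣ x) (x≤∣x∣ y))
    (≤-resp (solve 2 (λ x y → :- x :+ :- y := :- (x :+ y)) refl x y) refl
      (+-mono-≤ (-x≤∣x∣ x) (-x≤∣x∣ y)))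

  ∣x*y∣≈∣x∣*y : ∀ x {y} → 0# ≤ y → ∣ x * y ∣ ≈ ∣ x ∣ * y
  ∣x*y∣≈∣x∣*y x {y} 0≤y with ≤-total 0# x
  ... | inj₁ 0≤x = trans (∣∣-nonneg-≈ (*-nonneg 0≤x 0≤y)) (*-congʳ (sym (∣∣-nonneg-≈ 0≤x)))
  ... | inj₂ x≤0 = trans (∣∣-nonpos-≈ (by-nonneg (*-nonneg (neg-nonneg x≤0) 0≤y)
      (solve 2 (λ x y → :0 := x :* y :+ (:- x) :* y) refl x y)))
    (trans (solve 2 (λ x y → :- (x :* y) := (:- x) :* y) refl x y) (*-congʳ (sym (∣∣-nonpos-≈ x≤0))))

  ∣x-y∣≈∣y-x∣ : ∀ x y → ∣ x - y ∣ ≈ ∣ y - x ∣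
  ∣x-y∣≈∣y-x∣ x y =
    trans (∣∣-cong (solve 2 (λ x y → x :- y := :- (y :- x)) refl x y)) (∣-x∣≈∣x∣ (y - x))

  ∣∣-square : ∀ x → ∣ x ∣ * ∣ x ∣ ≈ x * x
  ∣∣-square x with ≤-total 0# x
  ... | inj₁ 0≤x = *-cong (∣∣-nonneg-≈ 0≤x) (∣∣-nonneg-≈ 0≤x)
  ... | inj₂ x≤0 = trans (*-cong (∣∣-nonpos-≈ x≤0) (∣∣-nonpos-≈ x≤0))
    (solve 1 (λ x → (:- x) :* (:- x) := x :* x) refl x)

  ∣∣-≤-square : ∀ {x r} → 0# ≤ r → x * x ≤ r * r → ∣ x ∣ ≤ r
  ∣∣-≤-square {x} 0≤r xx≤rr = square-cancel-≤ 0≤r (≤-resp (sym (∣∣-square x)) refl xx≤rr)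

  -- If `x` bounded all naturals, they would have a supremum `s`; but `n + 1 ≤ s` for all `n` makes
  -- `s - 1#` a smaller upper bound.
  archimedean : ∀ x → ∃[ n ] x < num n
  archimedean x with em {∃[ n ] x < num n}
  ... | yes p = p
  ... | no ¬p = ⊥-elim (<⇒≱ s-1<s (s-least (s - 1#) s-1-bound))
    where
    Naturals : ℝ → Set
    Naturals y = ∃[ n ] y ≈ num n
    sup = supremum Naturals (0# , 0 , refl)
      (x , λ { y (n , y≈n) → ≤-resp (sym y≈n) refl (≮⇒≥ (λ x<n → ¬p (n , x<n))) })
    s = proj₁ sup
    s-least = proj₂ (proj₂ sup)
    s-1<s : s - 1# < s
    s-1<s = by-pos 0<1 (solve 1 (λ s → s := s :- :1 :+ :1) refl s)
    s-1-bound : UpperBound Naturals (s - 1#)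
    s-1-bound y (n , y≈n) = by-nonneg
      (gap-nonneg (≤-resp (num-suc n) refl (proj₁ (proj₂ sup) (num (suc n)) (suc n , refl))))
      (trans (solve 2 (λ s n → s :- :1 := n :+ (s :- (:1 :+ n))) refl s (num n))
        (+-congʳ (sym y≈n)))

  abstract
    ½ : ℝ
    ½ = inv (num 2)

    ½+½≈1 : ½ + ½ ≈ 1#
    ½+½≈1 = trans (solve 1 (λ x → x :+ x := :2 :* x) refl ½) (inv-inverseʳ (>0⇒≉0 (num-pos 1)))

    ½-pos : 0# < ½
    ½-pos = inv-pos (num-pos 1)

  ½^ : ℕ → ℝ
  ½^ zero    = 1#
  ½^ (suc n) = ½ * ½^ n

  ½^-pos : ∀ n → 0# < ½^ n
  ½^-pos zero    = 0<1
  ½^-pos (suc n) = *-pos ½-pos (½^-pos n)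

  ½^-nonneg : ∀ n → 0# ≤ ½^ n
  ½^-nonneg n = <⇒≤ (½^-pos n)

  ½^-double : ∀ n → ½^ (suc n) + ½^ (suc n) ≈ ½^ n
  ½^-double n = trans (sym (distribʳ (½^ n) ½ ½)) (trans (*-congʳ ½+½≈1) (*-identityˡ _))

  ½^-+ : ∀ m n → ½^ (m ℕ.+ n) ≈ ½^ m * ½^ n
  ½^-+ zero    n = sym (*-identityˡ _)
  ½^-+ (suc m) n = trans (*-congˡ (½^-+ m n)) (sym (*-assoc _ _ _))

  ½^-suc-≤ : ∀ n → ½^ (suc n) ≤ ½^ n
  ½^-suc-≤ n = by-nonneg (½^-nonneg (suc n)) (sym (½^-double n))

  ½^-antitone : ∀ {m n} → m ℕ.≤ n → ½^ n ≤ ½^ m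
  ½^-antitone {m} {n} m≤n = go {m} {n} (ℕ.≤⇒≤′ m≤n)
    where
    go : ∀ {m n} → m ℕ.≤′ n → ½^ n ≤ ½^ m
    go (ℕ.≤′-reflexive ≡.refl) = ≤-refl
    go {n = suc n} (ℕ.≤′-step p) = ≤-trans (½^-suc-≤ n) (go p)

  ½^-≤1 : ∀ n → ½^ n ≤ 1#
  ½^-≤1 n = ½^-antitone {0} {n} ℕ.z≤n

  num2^*½^ : ∀ n → num (2 ℕ.^ n) * ½^ n ≈ 1#
  num2^*½^ zero    = *-identityʳ _
  num2^*½^ (suc n) = begin
    num (2 ℕ.* 2 ℕ.^ n) * (½ * ½^ n)  ≈⟨ *-congʳ (num-* 2 (2 ℕ.^ n)) ⟩
    num 2 * num (2 ℕ.^ n) * (½ * ½^ n)  ≈⟨ solve 3 (λ a b c → :2 :* a :* (b :* c) := (b :+ b) :* (a :* c)) refl (num (2 ℕ.^ n)) ½ (½^ n) ⟩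
    (½ + ½) * (num (2 ℕ.^ n) * ½^ n)  ≈⟨ *-cong ½+½≈1 (num2^*½^ n) ⟩
    1# * 1#  ≈⟨ *-identityˡ _ ⟩
    1#  ∎
    where open ≈-Reasoning

  n<2^n : ∀ n → n ℕ.< 2 ℕ.^ n
  n<2^n zero    = ℕ.≤-refl
  n<2^n (suc n) = ℕ.≤-trans (ℕ.s≤s (n<2^n n))
    (ℕ.+-mono-≤ (ℕ.m^n>0 2 n) (ℕ.≤-reflexive (≡.sym (ℕ.+-identityʳ _))))

  num*½^-≤1 : ∀ n → num n * ½^ n ≤ 1#
  num*½^-≤1 n = ≤-trans (*-monoʳ-≤ (½^-nonneg n) (num-mono-≤ (ℕ.<⇒≤ (n<2^n n)))) (≤-reflexive (num2^*½^ n))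

  -- Choose `n` above 1/ε; then ½^ n < ε · (n · ½^ n) ≤ ε, because n ≤ 2ⁿ.
  ½^-small : ∀ {ε} → 0# < ε → ∃[ n ] ½^ n < ε
  ½^-small {ε} 0<ε with archimedean (inv ε)
  ... | n , inv<n = n , (begin-strict
    ½^ n  ≈⟨ *-identityʳ _ ⟨
    ½^ n * 1#  ≈⟨ *-congˡ (inv-inverseʳ (>0⇒≉0 0<ε)) ⟨
    ½^ n * (ε * inv ε)  <⟨ *-monoˡ-< (½^-pos n) (*-monoˡ-< 0<ε inv<n) ⟩
    ½^ n * (ε * num n)  ≈⟨ solve 3 (λ a b c → a :* (b :* c) := b :* (c :* a)) refl (½^ n) ε (num n) ⟩
    ε * (num n * ½^ n)  ≤⟨ *-monoˡ-≤ (<⇒≤ 0<ε) (num*½^-≤1 n) ⟩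
    ε * 1#  ≈⟨ *-identityʳ ε ⟩
    ε  ∎)
    where open ≤-Reasoning

  ≤-by-½^ : ∀ {x} C → (∀ n → x ≤ C * ½^ n) → x ≤ 0#
  ≤-by-½^ {x} C bound with <-or-≥ 0# x
  ... | inj₂ x≤0 = x≤0
  ... | inj₁ 0<x = ⊥-elim (<⇒≱ small (bound n))
    where
    -- The summand `1#` makes `D` invertible even for `C ≈ 0#`.
    D = ∣ C ∣ + 1#
    0<D : 0# < D
    0<D = <-resp (+-identityʳ 0#) refl (+-mono-≤-< (∣∣-nonneg C) 0<1)
    tiny = ½^-small (*-pos 0<x (inv-pos 0<D))
    n = proj₁ tiny
    small : C * ½^ n < x
    small = begin-strict
      C * ½^ n  ≤⟨ *-monoʳ-≤ (½^-nonneg n) (≤-trans (x≤∣x∣ C) (by-nonneg 0≤1 refl)) ⟩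
      D * ½^ n  <⟨ *-monoˡ-< 0<D (proj₂ tiny) ⟩
      D * (x * inv D)  ≈⟨ solve 3 (λ d x i → d :* (x :* i) := x :* (d :* i)) refl D x (inv D) ⟩
      x * (D * inv D)  ≈⟨ *-congˡ (inv-inverseʳ (>0⇒≉0 0<D)) ⟩
      x * 1#  ≈⟨ *-identityʳ x ⟩
      x  ∎
      where open ≤-Reasoning

-- Finite sums, limits and series of reals.

module Series (em : ExcludedMiddle 0ℓ) (𝓡 : CompleteOrderedField) where
  open Analysis 𝓡
  open OrderedField em 𝓡
  open SemiringSum semiring using (*-distribˡ-sum; *-distribʳ-sum)
    renaming (sum-cong-≋ to sum-cong; ∑-distrib-+ to sum-+; ∑-comm to sum-comm) public

  sum-zero : ∀ n {f : Fin n → ℝ} → (∀ i → f i ≈ 0#) → sum f ≈ 0#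
  sum-zero zero    f≈0 = refl
  sum-zero (suc n) f≈0 = trans (+-cong (f≈0 Fin.zero) (sum-zero n (f≈0 ∘ Fin.suc))) (+-identityˡ 0#)

  sum-mono : ∀ n {f g : Fin n → ℝ} → (∀ i → f i ≤ g i) → sum f ≤ sum g
  sum-mono zero    f≤g = ≤-refl
  sum-mono (suc n) f≤g = +-mono-≤ (f≤g Fin.zero) (sum-mono n (f≤g ∘ Fin.suc))

  sum-nonneg : ∀ n {f : Fin n → ℝ} → (∀ i → 0# ≤ f i) → 0# ≤ sum f
  sum-nonneg n 0≤f = ≤-trans (≤-reflexive (sym (sum-zero n (λ _ → refl)))) (sum-mono n 0≤f)

  sum-const : ∀ n c → sum {n} (λ _ → c) ≈ num n * c
  sum-const zero    c = sym (zeroˡ c)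
  sum-const (suc n) c = trans (+-congˡ (sum-const n c))
    (trans (solve 2 (λ c x → c :+ x :* c := (:1 :+ x) :* c) refl c (num n)) (*-congʳ (sym (num-suc n))))

  sum-single : ∀ n {f : Fin n → ℝ} i → (∀ j → ¬ (j ≡ i) → f j ≈ 0#) → sum f ≈ f i
  sum-single (suc n) Fin.zero f≈0 = trans (+-congˡ (sum-zero n (λ j → f≈0 (Fin.suc j) λ ()))) (+-identityʳ _)
  sum-single (suc n) (Fin.suc i) f≈0 = trans
    (+-cong (f≈0 Fin.zero λ ()) (sum-single n i (λ j j≢i → f≈0 (Fin.suc j) (j≢i ∘ Fin.suc-injective))))
    (+-identityˡ _)

  -- Definitionally the partial sums in `HasSum`.
  Σ< : ℕ → (ℕ → ℝ) → ℝ
  Σ< n a = sum {n} λ i → a (toℕ i)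

  Σ<-mono : ∀ n {a b} → (∀ i → a i ≤ b i) → Σ< n a ≤ Σ< n b
  Σ<-mono n a≤b = sum-mono n (a≤b ∘ toℕ)

  Σ<-cong : ∀ n {a b} → (∀ i → a i ≈ b i) → Σ< n a ≈ Σ< n b
  Σ<-cong n a≈b = sum-cong {n} (a≈b ∘ toℕ)

  Σ<-snoc : ∀ n a → Σ< (suc n) a ≈ Σ< n a + a n
  Σ<-snoc zero    a = +-comm _ _
  Σ<-snoc (suc n) a = trans (+-congˡ (Σ<-snoc n (a ∘ suc))) (sym (+-assoc _ _ _))

  Σ<-split : ∀ m n a → Σ< (m ℕ.+ n) a ≈ Σ< m a + Σ< n (λ i → a (m ℕ.+ i))
  Σ<-split zero    n a = sym (+-identityˡ _)
  Σ<-split (suc m) n a = trans (+-congˡ (Σ<-split m n (a ∘ suc))) (sym (+-assoc _ _ _))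

  Σ<-monoˡ : ∀ {m n a} → (∀ i → 0# ≤ a i) → m ℕ.≤ n → Σ< m a ≤ Σ< n a
  Σ<-monoˡ {m} {n} {a} 0≤a m≤n = by-nonneg (sum-nonneg (n ℕ.∸ m) (λ i → 0≤a (m ℕ.+ toℕ i)))
    (trans (reflexive (≡.cong (λ k → Σ< k a) (≡.sym (ℕ.m+[n∸m]≡n m≤n)))) (Σ<-split m (n ℕ.∸ m) a))

  ∣Σ<∣≤ : ∀ n a → ∣ Σ< n a ∣ ≤ Σ< n (λ i → ∣ a i ∣)
  ∣Σ<∣≤ zero    a = ≤-reflexive (∣∣-nonneg-≈ ≤-refl)
  ∣Σ<∣≤ (suc n) a = ≤-trans (∣x+y∣≤∣x∣+∣y∣ _ _) (+-monoʳ-≤ _ (∣Σ<∣≤ n (a ∘ suc)))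

  Σ<-½^ : ∀ n → Σ< n (½^ ∘ suc) + ½^ n ≈ 1#
  Σ<-½^ zero    = +-identityˡ _
  Σ<-½^ (suc n) = trans (+-congʳ (Σ<-snoc n (½^ ∘ suc)))
    (trans (+-assoc _ _ _) (trans (+-congˡ (½^-double n)) (Σ<-½^ n)))

  Σ<-½^-≤2 : ∀ n → Σ< n ½^ ≤ 1# + 1#
  Σ<-½^-≤2 zero    = +-nonneg 0≤1 0≤1
  Σ<-½^-≤2 (suc n) = +-monoʳ-≤ 1# (by-nonneg (½^-nonneg n) (sym (Σ<-½^ n)))

  private
    halve : ∀ {ε} → 0# < ε → 0# < ½ * ε
    halve = *-pos ½-pos

    halves : ∀ ε → ½ * ε + ½ * ε ≈ ε
    halves ε = trans (sym (distribʳ ε ½ ½)) (trans (*-congʳ ½+½≈1) (*-identityˡ ε))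

  lim-cong : ∀ {s t l m} → (∀ n → s n ≈ t n) → l ≈ m → ConvergesTo s l → ConvergesTo t m
  lim-cong s≈t l≈m s→l ε 0<ε =
    let N , close = s→l ε 0<ε in N , λ n N≤n → <-resp (∣∣-cong (+-cong (s≈t n) (-‿cong l≈m))) refl (close n N≤n)

  lim-const : ∀ l → ConvergesTo (λ _ → l) l
  lim-const l ε 0<ε = 0 , λ _ _ →
    <-resp (sym (trans (∣∣-cong (-‿inverseʳ l)) (∣∣-nonneg-≈ ≤-refl))) refl 0<ε

  lim-+ : ∀ {s t l m} → ConvergesTo s l → ConvergesTo t m → ConvergesTo (λ n → s n + t n) (l + m)
  lim-+ {s} {t} {l} {m} s→l t→m ε 0<ε =
    let N , p = s→l (½ * ε) (halve 0<ε)
        M , q = t→m (½ * ε) (halve 0<ε)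
    in N ℕ.⊔ M , λ n le → ≤-<-trans
    (≤-trans (≤-reflexive (∣∣-cong (solve 4 (λ s t l m → s :+ t :- (l :+ m) := (s :- l) :+ (t :- m)) refl (s n) (t n) l m)))
      (∣x+y∣≤∣x∣+∣y∣ _ _))
    (<-resp refl (halves ε) (+-mono-< (p n (ℕ.m⊔n≤o⇒m≤o N M le)) (q n (ℕ.m⊔n≤o⇒n≤o N M le))))

  lim-scale : ∀ c {s l} → ConvergesTo s l → ConvergesTo (λ n → c * s n) (c * l)
  lim-scale c {s} {l} s→l ε 0<ε =
    let N , p = s→l (ε * inv D) (*-pos 0<ε (inv-pos 0<D)) in N , λ n N≤n → begin-strict
    ∣ c * s n - c * l ∣  ≈⟨ ∣∣-cong (solve 3 (λ c s l → c :* s :- c :* l := c :* (s :- l)) refl c (s n) l) ⟩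
    ∣ c * (s n - l) ∣  ≤⟨ bound (s n - l) ⟩
    D * ∣ s n - l ∣  <⟨ *-monoˡ-< 0<D (p n N≤n) ⟩
    D * (ε * inv D)  ≈⟨ solve 3 (λ d x i → d :* (x :* i) := x :* (d :* i)) refl D ε (inv D) ⟩
    ε * (D * inv D)  ≈⟨ *-congˡ (inv-inverseʳ (>0⇒≉0 0<D)) ⟩
    ε * 1#  ≈⟨ *-identityʳ ε ⟩
    ε  ∎
    where
    open ≤-Reasoning
    D = ∣ c ∣ + 1#
    0<D : 0# < D
    0<D = <-resp (+-identityʳ 0#) refl (+-mono-≤-< (∣∣-nonneg c) 0<1)
    bound : ∀ x → ∣ c * x ∣ ≤ D * ∣ x ∣
    bound x = ∣∣-≤-square (*-nonneg (<⇒≤ 0<D) (∣∣-nonneg x)) (begin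
      c * x * (c * x)  ≈⟨ solve 2 (λ c x → c :* x :* (c :* x) := c :* c :* (x :* x)) refl c x ⟩
      c * c * (x * x)  ≤⟨ *-monoʳ-≤ (square-nonneg x) (≤-resp (∣∣-square c) refl
                                                 (square-mono-≤ (∣∣-nonneg c) (by-nonneg 0≤1 refl))) ⟩
      D * D * (x * x)  ≈⟨ *-congˡ (∣∣-square x) ⟨
      D * D * (∣ x ∣ * ∣ x ∣)  ≈⟨ solve 2 (λ d x → d :* d :* (x :* x) := d :* x :* (d :* x)) refl D ∣ x ∣ ⟩
      D * ∣ x ∣ * (D * ∣ x ∣)  ∎)

  lim-neg : ∀ {s l} → ConvergesTo s l → ConvergesTo (λ n → - s n) (- l)
  lim-neg s→l = lim-cong (λ n → neg (_)) (neg _) (lim-scale (- 1#) s→l)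
    where
    neg : ∀ x → - 1# * x ≈ - x
    neg x = solve 1 (λ x → (:- :1) :* x := :- x) refl x

  private
    lim-null-* : ∀ {s t} → ConvergesTo s 0# → ConvergesTo t 0# → ConvergesTo (λ n → s n * t n) 0#
    lim-null-* {s} {t} s→0 t→0 ε 0<ε =
      let N , p = s→0 ε 0<ε
          M , q = t→0 1# 0<1
      in N ℕ.⊔ M , λ n le → begin-strict
      ∣ s n * t n - 0# ∣  ≈⟨ ∣∣-cong (solve 1 (λ x → x :- :0 := x) refl _) ⟩
      ∣ s n * t n ∣  ≤⟨ ∣∣-≤-square (∣∣-nonneg _) (small n (q n (ℕ.m⊔n≤o⇒n≤o N M le))) ⟩
      ∣ s n - 0# ∣  <⟨ p n (ℕ.m⊔n≤o⇒m≤o N M le) ⟩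
      ε  ∎
      where
      open ≤-Reasoning
      small : ∀ n → ∣ t n - 0# ∣ < 1# → s n * t n * (s n * t n) ≤ ∣ s n - 0# ∣ * ∣ s n - 0# ∣
      small n t<1 = begin
        s n * t n * (s n * t n)  ≈⟨ solve 2 (λ c x → c :* x :* (c :* x) := c :* c :* ((x :- :0) :* (x :- :0))) refl (s n) (t n) ⟩
        s n * s n * ((t n - 0#) * (t n - 0#))  ≈⟨ *-congˡ (∣∣-square _) ⟨
        s n * s n * (∣ t n - 0# ∣ * ∣ t n - 0# ∣)  ≤⟨ *-monoˡ-≤ (square-nonneg _) (square-mono-≤ (∣∣-nonneg _) (<⇒≤ t<1)) ⟩
        s n * s n * (1# * 1#)  ≈⟨ solve 1 (λ s → s :* s :* (:1 :* :1) := (s :- :0) :* (s :- :0)) refl (s n) ⟩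
        (s n - 0#) * (s n - 0#)  ≈⟨ ∣∣-square _ ⟨
        ∣ s n - 0# ∣ * ∣ s n - 0# ∣  ∎

  -- From s t = (s - l)(t - m) + l t + m s - l m, which leaves only a product of null sequences and
  -- linear terms.
  lim-* : ∀ {s t l m} → ConvergesTo s l → ConvergesTo t m → ConvergesTo (λ n → s n * t n) (l * m)
  lim-* {s} {t} {l} {m} s→l t→m = lim-cong
    (λ n → solve 4 (λ s t l m → (s :+ :- l) :* (t :+ :- m) :+ (l :* t :+ (m :* s :+ :- (l :* m))) := s :* t) refl (s n) (t n) l m)
    (solve 2 (λ l m → :0 :+ (l :* m :+ (m :* l :+ :- (l :* m))) := l :* m) refl l m)
    (lim-+ (lim-null-* (null s→l) (null t→m))
      (lim-+ (lim-scale l t→m) (lim-+ (lim-scale m s→l) (lim-const _))))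
    where
    null : ∀ {s l} → ConvergesTo s l → ConvergesTo (λ n → s n + - l) 0#
    null {l = l} s→l = lim-cong (λ _ → refl) (-‿inverseʳ l) (lim-+ s→l (lim-const (- l)))

  lim-sub : ∀ {s l} (f : ℕ → ℕ) → (∀ n → n ℕ.≤ f n) → ConvergesTo s l → ConvergesTo (s ∘ f) l
  lim-sub f n≤f s→l ε 0<ε =
    let N , p = s→l ε 0<ε in N , λ n N≤n → p (f n) (ℕ.≤-trans N≤n (n≤f n))

  lim-≤ : ∀ {s l b} N → ConvergesTo s l → (∀ n → N ℕ.≤ n → s n ≤ b) → l ≤ b
  lim-≤ {s} {l} {b} N s→l s≤b = ≮⇒≥ λ b<l → <⇒≱ (too-close b<l) (s≤b (n b<l) (ℕ.m≤m⊔n N _))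
    where
    n : b < l → ℕ
    n b<l = N ℕ.⊔ proj₁ (s→l (l - b) (gap-pos b<l))
    too-close : ∀ b<l → b < s (n b<l)
    too-close b<l = by-pos (gap-pos (≤-<-trans (-x≤∣x∣ (s (n b<l) - l)) (proj₂ (s→l (l - b) (gap-pos b<l)) (n b<l) (ℕ.m≤n⊔m N _))))
      (solve 3 (λ s l b → s := b :+ (l :- b :- :- (s :- l))) refl (s (n b<l)) l b)

  lim-≥ : ∀ {s l b} N → ConvergesTo s l → (∀ n → N ℕ.≤ n → b ≤ s n) → b ≤ l
  lim-≥ {s} {l} {b} N s→l b≤s = by-nonneg
    (gap-nonneg (lim-≤ N (lim-neg s→l) (λ n N≤n → neg-mono-≤ (b≤s n N≤n))))
    (solve 2 (λ l b → l := b :+ (:- b :- :- l)) refl l b)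

  lim-unique : ∀ {s l m} → ConvergesTo s l → ConvergesTo s m → l ≈ m
  lim-unique {s} {l} {m} s→l s→m = begin
    l  ≈⟨ solve 2 (λ l m → l := m :+ (l :+ :- m)) refl l m ⟩
    m + (l + - m)  ≈⟨ +-congˡ (≤-antisym (lim-≤ 0 null (λ _ _ → ≤-reflexive (-‿inverseʳ _)))
                                          (lim-≥ 0 null (λ _ _ → ≤-reflexive (sym (-‿inverseʳ _))))) ⟩
    m + 0#  ≈⟨ +-identityʳ m ⟩
    m  ∎
    where
    open ≈-Reasoning
    null : ConvergesTo (λ n → s n + - s n) (l + - m)
    null = lim-+ s→l (lim-neg s→m)

  lim-squeeze : ∀ {s l e} N → ConvergesTo e 0# → (∀ n → N ℕ.≤ n → ∣ s n - l ∣ ≤ e n) → ConvergesTo s l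
  lim-squeeze {e = e} N e→0 close ε 0<ε =
    let M , p = e→0 ε 0<ε in N ℕ.⊔ M , λ n le → ≤-<-trans (close n (ℕ.m⊔n≤o⇒m≤o N M le)) (≤-<-trans
    (≤-trans (x≤∣x∣ _) (≤-reflexive (∣∣-cong (solve 1 (λ x → x := x :- :0) refl (e n)))))
    (p n (ℕ.m⊔n≤o⇒n≤o N M le)))

  lim-close : ∀ {s t l m d} → ConvergesTo d 0# → (∀ n → ∣ s n - t n ∣ ≤ d n) →
              ConvergesTo s l → ConvergesTo t m → l ≈ m
  lim-close {s} {t} {l} {m} {d} d→0 close s→l t→m = begin
    l  ≈⟨ solve 2 (λ l m → l := m :+ (l :+ :- m)) refl l m ⟩
    m + (l + - m)  ≈⟨ +-congˡ (lim-unique (lim-+ s→l (lim-neg t→m)) (lim-squeeze 0 d→0 λ n _ →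
                        ≤-trans (≤-reflexive (∣∣-cong (solve 1 (λ x → x :- :0 := x) refl _))) (close n))) ⟩
    m + 0#  ≈⟨ +-identityʳ m ⟩
    m  ∎
    where open ≈-Reasoning

  ½^-null : ConvergesTo ½^ 0#
  ½^-null ε 0<ε = let N , p = ½^-small 0<ε in N , λ n N≤n → ≤-<-trans
    (≤-reflexive (trans (∣∣-cong (solve 1 (λ x → x :- :0 := x) refl _)) (∣∣-nonneg-≈ (½^-nonneg n))))
    (≤-<-trans (½^-antitone {N} {n} N≤n) p)

  C*½^-null : ∀ C → ConvergesTo (λ n → C * ½^ n) 0#
  C*½^-null C = lim-cong (λ _ → refl) (zeroʳ C) (lim-scale C ½^-null)

  monotone-converges : ∀ s b → (∀ n → s n ≤ s (suc n)) → (∀ n → s n ≤ b) → ∃ (ConvergesTo s)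
  monotone-converges s b step s≤b = l , converges
    where
    Values : ℝ → Set
    Values y = ∃[ n ] y ≈ s n
    sup = supremum Values (s 0 , 0 , refl) (b , λ { y (n , y≈) → ≤-resp (sym y≈) refl (s≤b n) })
    l = proj₁ sup
    s≤l : ∀ n → s n ≤ l
    s≤l n = proj₁ (proj₂ sup) (s n) (n , refl)
    mono : ∀ {m n} → m ℕ.≤ n → s m ≤ s n
    mono m≤n = go (ℕ.≤⇒≤′ m≤n)
      where
      go : ∀ {m n} → m ℕ.≤′ n → s m ≤ s n
      go (ℕ.≤′-reflexive ≡.refl) = ≤-refl
      go (ℕ.≤′-step p) = ≤-trans (go p) (step _)
    near : ∀ ε → 0# < ε → ∃[ N ] l - ε < s N
    near ε 0<ε = decidable-stable em λ none →
      <⇒≱ (by-pos 0<ε (solve 2 (λ l ε → l := l :- ε :+ ε) refl l ε))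
        (proj₂ (proj₂ sup) (l - ε) λ { y (n , y≈) → ≤-resp (sym y≈) refl (≮⇒≥ λ p → none (n , p)) })
    converges : ConvergesTo s l
    converges ε 0<ε = let N , p = near ε 0<ε in N , λ n N≤n → ∣∣-<
      (≤-<-trans (≤-resp refl (-‿inverseʳ l) (+-monoˡ-≤ (- l) (s≤l n))) 0<ε)
      (by-pos (gap-pos (<-≤-trans p (mono N≤n)))
        (solve 3 (λ l ε s → ε := :- (s :- l) :+ (s :- (l :- ε))) refl l ε (s n)))

  bounded⇒absolutelySummable : ∀ {a} b → (∀ n → Σ< n (λ i → ∣ a i ∣) ≤ b) → AbsolutelySummable a
  bounded⇒absolutelySummable {a} b bound = monotone-converges (λ n → Σ< n (λ i → ∣ a i ∣)) b
    (λ n → Σ<-monoˡ {n} {suc n} (λ i → ∣∣-nonneg (a i)) (ℕ.n≤1+n n)) bound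

  partial≤sum : ∀ {a s} → (∀ n → 0# ≤ a n) → HasSum a s → ∀ n → Σ< n a ≤ s
  partial≤sum 0≤a a→s n = lim-≥ n a→s (λ m n≤m → Σ<-monoˡ {n} {m} 0≤a n≤m)

  -- Splits a into the difference of |a| and |a| - a, whose partial sums are monotone.
  absolutelySummable⇒summable : ∀ {a} → AbsolutelySummable a → ∃ (HasSum a)
  absolutelySummable⇒summable {a} (s , ∣a∣→s) = s - proj₁ c , lim-cong
      (λ n → trans (+-congˡ (-‿cong (split n))) (solve 2 (λ x y → x :+ :- (x :- y) := y) refl (Σ< n (λ i → ∣ a i ∣)) (Σ< n a)))
      refl
      (lim-+ ∣a∣→s (lim-neg (proj₂ c)))
    where
    b : ℕ → ℝ
    b i = ∣ a i ∣ - a i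
    split : ∀ n → Σ< n b ≈ Σ< n (λ i → ∣ a i ∣) - Σ< n a
    split zero    = solve 0 (:0 := :0 :- :0) refl
    split (suc n) = trans (Σ<-snoc n b) (trans (+-congʳ (split n)) (sym (trans
      (+-cong (Σ<-snoc n (λ i → ∣ a i ∣)) (-‿cong (Σ<-snoc n a)))
      (solve 4 (λ p q r t → p :+ q :- (r :+ t) := p :- r :+ (q :- t)) refl _ _ _ _))))
    0≤b : ∀ i → 0# ≤ b i
    0≤b i = gap-nonneg (x≤∣x∣ (a i))
    c = monotone-converges (λ n → Σ< n b) (s + s) (λ n → Σ<-monoˡ {n} {suc n} 0≤b (ℕ.n≤1+n n))
      (λ n → ≤-trans (≤-reflexive (split n)) (+-mono-≤ (partial n)
        (≤-trans (-x≤∣x∣ _) (≤-trans (∣Σ<∣≤ n a) (partial n)))))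
      where
      partial : ∀ n → Σ< n (λ i → ∣ a i ∣) ≤ s
      partial = partial≤sum (λ i → ∣∣-nonneg (a i)) ∣a∣→s

-- Cauchy products and exponential sequences, over ℝ and ℂ alike.

module CauchyProduct (R : CommutativeRing 0ℓ 0ℓ) where
  open CommutativeRing R
  open IntegerSolver R
  open RawSemiringOps (RawRing.rawSemiring rawRing) using (sum)
  open Mult′ semiring using (1+×) renaming (_×_ to _×′_)
  open SetoidReasoning setoid

  partialSum : ℕ → (ℕ → Carrier) → Carrier
  partialSum n a = sum {n} λ i → a (toℕ i)

  -- (α ⋆ β) n = Σ_{i ≤ n} αᵢ βₙ₋ᵢ  and  triangle α β n = Σ_{i + j < n} αᵢ βⱼ.
  _⋆_ : (ℕ → Carrier) → (ℕ → Carrier) → ℕ → Carrier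
  (α ⋆ β) zero    = α 0 * β 0
  (α ⋆ β) (suc n) = α 0 * β (suc n) + ((α ∘ suc) ⋆ β) n

  triangle : (ℕ → Carrier) → (ℕ → Carrier) → ℕ → Carrier
  triangle α β zero    = 0#
  triangle α β (suc n) = α 0 * partialSum (suc n) β + triangle (α ∘ suc) β n

  private
    partialSum-linear : ∀ n c a b → partialSum n (λ i → c * a i + b i) ≈ c * partialSum n a + partialSum n b
    partialSum-linear zero    c a b = sym (trans (+-identityʳ _) (zeroʳ c))
    partialSum-linear (suc n) c a b = trans (+-congˡ (partialSum-linear n c (a ∘ suc) (b ∘ suc)))
      (solve 5 (λ c a b x y → c :* a :+ b :+ (c :* x :+ y) := c :* (a :+ x) :+ (b :+ y)) refl c _ _ _ _)

  -- The same products are added by rows on the left and by antidiagonals on the right; the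
  -- induction removes row 0.
  triangle≈ : ∀ n α β → triangle α β n ≈ partialSum n (α ⋆ β)
  triangle≈ zero    α β = refl
  triangle≈ (suc n) α β = begin
    α 0 * (β 0 + partialSum n (β ∘ suc)) + triangle (α ∘ suc) β n
      ≈⟨ +-congˡ (triangle≈ n (α ∘ suc) β) ⟩
    α 0 * (β 0 + partialSum n (β ∘ suc)) + partialSum n ((α ∘ suc) ⋆ β)
      ≈⟨ solve 4 (λ a b x y → a :* (b :+ x) :+ y := a :* b :+ (a :* x :+ y)) refl _ _ _ _ ⟩
    α 0 * β 0 + (α 0 * partialSum n (β ∘ suc) + partialSum n ((α ∘ suc) ⋆ β))
      ≈⟨ +-congˡ (partialSum-linear n (α 0) (β ∘ suc) ((α ∘ suc) ⋆ β)) ⟨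
    partialSum (suc n) (α ⋆ β) ∎

  numᴿ : ℕ → Carrier
  numᴿ n = n ×′ 1#

  numᴿ-suc : ∀ n → numᴿ (suc n) ≈ 1# + numᴿ n
  numᴿ-suc n = 1+× n 1#

  private
    ⋆-congˡ : ∀ n {α α′} β → (∀ i → α i ≈ α′ i) → (α ⋆ β) n ≈ (α′ ⋆ β) n
    ⋆-congˡ zero    β eq = *-congʳ (eq 0)
    ⋆-congˡ (suc n) β eq = +-cong (*-congʳ (eq 0)) (⋆-congˡ n β (eq ∘ suc))

    ⋆-congʳ : ∀ n α {β β′} → (∀ i → β i ≈ β′ i) → (α ⋆ β) n ≈ (α ⋆ β′) n
    ⋆-congʳ zero    α eq = *-congˡ (eq 0)
    ⋆-congʳ (suc n) α eq = +-cong (*-congˡ (eq (suc n))) (⋆-congʳ n (α ∘ suc) eq)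

    ⋆-scaleˡ : ∀ n c α β → ((λ i → c * α i) ⋆ β) n ≈ c * (α ⋆ β) n
    ⋆-scaleˡ zero    c α β = *-assoc _ _ _
    ⋆-scaleˡ (suc n) c α β = trans (+-cong (*-assoc _ _ _) (⋆-scaleˡ n c (α ∘ suc) β)) (sym (distribˡ _ _ _))

    ⋆-scaleʳ : ∀ n c α β → (α ⋆ (λ i → c * β i)) n ≈ c * (α ⋆ β) n
    ⋆-scaleʳ zero    c α β = solve 3 (λ c a b → a :* (c :* b) := c :* (a :* b)) refl c _ _
    ⋆-scaleʳ (suc n) c α β = trans (+-congˡ (⋆-scaleʳ n c (α ∘ suc) β))
      (solve 4 (λ c a b x → a :* (c :* b) :+ c :* x := c :* (a :* b :+ x)) refl c _ _ _)

    ⋆-addˡ : ∀ n α α′ β → ((λ i → α i + α′ i) ⋆ β) n ≈ (α ⋆ β) n + (α′ ⋆ β) n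
    ⋆-addˡ zero    α α′ β = distribʳ _ _ _
    ⋆-addˡ (suc n) α α′ β = trans (+-congˡ (⋆-addˡ n (α ∘ suc) (α′ ∘ suc) β))
      (solve 5 (λ a a′ b x y → (a :+ a′) :* b :+ (x :+ y) := (a :* b :+ x) :+ (a′ :* b :+ y)) refl _ _ _ _ _)

    ⋆-dropʳ : ∀ n α β → β 0 ≈ 0# → (α ⋆ β) (suc n) ≈ (α ⋆ (β ∘ suc)) n
    ⋆-dropʳ zero    α β β0≈0 = trans (+-congˡ (trans (*-congˡ β0≈0) (zeroʳ _))) (+-identityʳ _)
    ⋆-dropʳ (suc n) α β β0≈0 = +-congˡ (⋆-dropʳ n (α ∘ suc) β β0≈0)

    euler : (ℕ → Carrier) → ℕ → Carrier
    euler α n = numᴿ n * α n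

    -- euler is z d/dz on generating functions, hence a derivation.
    euler-⋆ : ∀ n α β → numᴿ n * (α ⋆ β) n ≈ (euler α ⋆ β) n + (α ⋆ euler β) n
    euler-⋆ zero    α β = solve 2 (λ a b → :0 :* (a :* b) := :0 :* a :* b :+ a :* (:0 :* b)) refl (α 0) (β 0)
    euler-⋆ (suc n) α β = begin
      numᴿ (suc n) * (α 0 * β (suc n) + x)
        ≈⟨ solve 4 (λ m a b x → m :* (a :* b :+ x) := a :* (m :* b) :+ m :* x) refl (numᴿ (suc n)) _ _ _ ⟩
      α 0 * (numᴿ (suc n) * β (suc n)) + numᴿ (suc n) * x
        ≈⟨ +-congˡ (*-congʳ (numᴿ-suc n)) ⟩
      α 0 * (numᴿ (suc n) * β (suc n)) + (1# + numᴿ n) * x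
        ≈⟨ +-congˡ (solve 2 (λ m x → (:1 :+ m) :* x := x :+ m :* x) refl (numᴿ n) x) ⟩
      α 0 * (numᴿ (suc n) * β (suc n)) + (x + numᴿ n * x)
        ≈⟨ +-congˡ (+-congˡ (euler-⋆ n (α ∘ suc) β)) ⟩
      α 0 * (numᴿ (suc n) * β (suc n)) + (x + (y + z))
        ≈⟨ solve 6 (λ a b x y z d → a :* b :+ (x :+ (y :+ z)) := (:0 :* a) :* d :+ (x :+ y) :+ (a :* b :+ z)) refl (α 0) _ x y z (β (suc n)) ⟩
      (0# * α 0) * β (suc n) + (x + y) + (α 0 * (numᴿ (suc n) * β (suc n)) + z)
        ≈⟨ +-congʳ (+-congˡ (⋆-addˡ n (α ∘ suc) (euler (α ∘ suc)) β)) ⟨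
      (0# * α 0) * β (suc n) + ((λ i → α (suc i) + euler (α ∘ suc) i) ⋆ β) n + (α 0 * (numᴿ (suc n) * β (suc n)) + z)
        ≈⟨ +-congʳ (+-congˡ (⋆-congˡ n β (λ i → trans (solve 2 (λ m a → a :+ m :* a := (:1 :+ m) :* a) refl (numᴿ i) _) (*-congʳ (sym (numᴿ-suc i)))))) ⟩
      (euler α ⋆ β) (suc n) + (α ⋆ euler β) (suc n) ∎
      where
      x = ((α ∘ suc) ⋆ β) n
      y = (euler (α ∘ suc) ⋆ β) n
      z = ((α ∘ suc) ⋆ euler β) n

  -- α is the sequence of terms aⁿ / n! of the exponential series.
  IsExponential : Carrier → (ℕ → Carrier) → Set
  IsExponential a α = α 0 ≈ 1# × (∀ n → numᴿ (suc n) * α (suc n) ≈ a * α n)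

  -- The binomial theorem without binomial coefficients: `IsExponential a α` says that the
  -- generating function solves f′ = a f with f(0) = 1, and the Leibniz rule `euler-⋆` turns a
  -- product of two such solutions into one for a + b.
  ⋆-exponential : ∀ {a b α β} → IsExponential a α → IsExponential b β → IsExponential (a + b) (α ⋆ β)
  ⋆-exponential {a} {b} {α} {β} (α₀ , α₊) (β₀ , β₊) = trans (*-cong α₀ β₀) (*-identityˡ 1#) , λ n → begin
    numᴿ (suc n) * (α ⋆ β) (suc n)  ≈⟨ euler-⋆ (suc n) α β ⟩
    (euler α ⋆ β) (suc n) + (α ⋆ euler β) (suc n)  ≈⟨ +-cong (+-congʳ (trans (*-congʳ (zeroˡ _)) (zeroˡ _))) (⋆-dropʳ n α (euler β) (zeroˡ _)) ⟩
    0# + ((euler α ∘ suc) ⋆ β) n + (α ⋆ (euler β ∘ suc)) n  ≈⟨ +-cong (+-identityˡ _) refl ⟩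
    ((euler α ∘ suc) ⋆ β) n + (α ⋆ (euler β ∘ suc)) n  ≈⟨ +-cong (⋆-congˡ n β α₊) (⋆-congʳ n α β₊) ⟩
    ((λ i → a * α i) ⋆ β) n + (α ⋆ (λ i → b * β i)) n  ≈⟨ +-cong (⋆-scaleˡ n a α β) (⋆-scaleʳ n b α β) ⟩
    a * (α ⋆ β) n + b * (α ⋆ β) n  ≈⟨ distribʳ _ _ _ ⟨
    (a + b) * (α ⋆ β) n  ∎

  -- The recursion determines each term from the previous one once n + 1 can be divided by. This
  -- identifies the exponential terms of a sum with a Cauchy product.
  exponential-unique : (∀ n → ∃[ r ] numᴿ (suc n) * r ≈ 1#) →
    ∀ {a b α β} → a ≈ b → IsExponential a α → IsExponential b β → ∀ n → α n ≈ β n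
  exponential-unique recip {a} {b} {α} {β} a≈b (α₀ , α₊) (β₀ , β₊) = go
    where
    unit : ∀ n x → x ≈ proj₁ (recip n) * (numᴿ (suc n) * x)
    unit n x = trans (sym (*-identityˡ x)) (trans (*-congʳ (sym (proj₂ (recip n))))
      (solve 3 (λ m r x → m :* r :* x := r :* (m :* x)) refl (numᴿ (suc n)) _ x))
    go : ∀ n → α n ≈ β n
    go zero    = trans α₀ (sym β₀)
    go (suc n) = trans (unit n _) (trans (*-congˡ (trans (α₊ n) (trans (*-cong a≈b (go n)) (sym (β₊ n))))) (sym (unit n _)))

-- The field of complex numbers and bounds on moduli.

module Complex (em : ExcludedMiddle 0ℓ) (𝓡 : CompleteOrderedField) where
  open Analysis 𝓡
  open OrderedField em 𝓡
  open Series em 𝓡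

  ℂ-commutativeRing : CommutativeRing 0ℓ 0ℓ
  ℂ-commutativeRing = record
    { RawRing ℂ-rawRing
    ; isCommutativeRing = record
      { isRing = record
        { +-isAbelianGroup = record
          { isGroup = record
            { isMonoid = record
              { isSemigroup = record
                { isMagma = record
                  { isEquivalence = record
                    { refl  = refl , refl
                    ; sym   = λ (p , q) → sym p , sym q
                    ; trans = λ (p , q) (p′ , q′) → trans p p′ , trans q q′
                    }
                  ; ∙-cong = λ (p , q) (p′ , q′) → +-cong p p′ , +-cong q q′
                  }
                ; assoc = λ _ _ _ → +-assoc _ _ _ , +-assoc _ _ _
                }
              ; identity = (λ _ → +-identityˡ _ , +-identityˡ _) , (λ _ → +-identityʳ _ , +-identityʳ _)
              }
            ; inverse = (λ _ → -‿inverseˡ _ , -‿inverseˡ _) , (λ _ → -‿inverseʳ _ , -‿inverseʳ _)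
            ; ⁻¹-cong = λ (p , q) → -‿cong p , -‿cong q
            }
          ; comm = λ _ _ → +-comm _ _ , +-comm _ _
          }
        ; *-cong = λ (p , q) (p′ , q′) →
            +-cong (*-cong p p′) (-‿cong (*-cong q q′)) , +-cong (*-cong p q′) (*-cong q p′)
        ; *-assoc = λ z w v →
            solve 6 (λ a b c d e f → (a :* c :- b :* d) :* e :- (a :* d :+ b :* c) :* f := a :* (c :* e :- d :* f) :- b :* (c :* f :+ d :* e)) refl (re z) (im z) (re w) (im w) (re v) (im v) ,
            solve 6 (λ a b c d e f → (a :* c :- b :* d) :* f :+ (a :* d :+ b :* c) :* e := a :* (c :* f :+ d :* e) :+ b :* (c :* e :- d :* f)) refl (re z) (im z) (re w) (im w) (re v) (im v)
        ; *-identity =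
            (λ z → solve 2 (λ a b → :1 :* a :- :0 :* b := a) refl (re z) (im z) ,
                   solve 2 (λ a b → :1 :* b :+ :0 :* a := b) refl (re z) (im z)) ,
            (λ z → solve 2 (λ a b → a :* :1 :- b :* :0 := a) refl (re z) (im z) ,
                   solve 2 (λ a b → a :* :0 :+ b :* :1 := b) refl (re z) (im z))
        ; distrib =
            (λ z w v →
              solve 6 (λ a b c d e f → a :* (c :+ e) :- b :* (d :+ f) := (a :* c :- b :* d) :+ (a :* e :- b :* f)) refl (re z) (im z) (re w) (im w) (re v) (im v) ,
              solve 6 (λ a b c d e f → a :* (d :+ f) :+ b :* (c :+ e) := (a :* d :+ b :* c) :+ (a :* f :+ b :* e)) refl (re z) (im z) (re w) (im w) (re v) (im v)) ,
            (λ z w v →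
              solve 6 (λ a b c d e f → (c :+ e) :* a :- (d :+ f) :* b := (c :* a :- d :* b) :+ (e :* a :- f :* b)) refl (re z) (im z) (re w) (im w) (re v) (im v) ,
              solve 6 (λ a b c d e f → (c :+ e) :* b :+ (d :+ f) :* a := (c :* b :+ d :* a) :+ (e :* b :+ f :* a)) refl (re z) (im z) (re w) (im w) (re v) (im v))
        }
      ; *-comm = λ z w →
          solve 4 (λ a b c d → a :* c :- b :* d := c :* a :- d :* b) refl (re z) (im z) (re w) (im w) ,
          solve 4 (λ a b c d → a :* d :+ b :* c := c :* b :+ d :* a) refl (re z) (im z) (re w) (im w)
      }
    }

  module ℂR = CommutativeRing ℂ-commutativeRing
  open ℂR public using () renaming
    ( _+_ to _+ᶜ_; _*_ to _*ᶜ_; -_ to -ᶜ_; _-_ to _-ᶜ_; _≈_ to _≈ᶜ_; 0# to 0ᶜ; 1# to 1ᶜ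
    ; refl to reflᶜ; sym to symᶜ; trans to transᶜ )
  open IntegerSolver ℂ-commutativeRing public using () renaming
    ( solve to solveᶜ; _:+_ to _:+ᶜ_; _:*_ to _:*ᶜ_; _:-_ to _:-ᶜ_; :-_ to :-ᶜ_; _:=_ to _:=ᶜ_; :0 to :0ᶜ; :1 to :1ᶜ )

  module ≈ᶜ-Reasoning = SetoidReasoning ℂR.setoid

  fromℝ-cong : ∀ {x y} → x ≈ y → fromℝ x ≈ᶜ fromℝ y
  fromℝ-cong x≈y = x≈y , refl

  fromℝ-* : ∀ x y → fromℝ (x * y) ≈ᶜ fromℝ x *ᶜ fromℝ y
  fromℝ-* x y = solve 2 (λ x y → x :* y := x :* y :- :0 :* :0) refl x y ,
    solve 2 (λ x y → :0 := x :* :0 :+ :0 :* y) refl x y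

  conj : ℂ → ℂ
  conj z = re z +i (- im z)

  conj-* : ∀ z w → conj (z *ᶜ w) ≈ᶜ conj z *ᶜ conj w
  conj-* z w =
    solve 4 (λ a b c d → a :* c :- b :* d := a :* c :- (:- b) :* (:- d)) refl (re z) (im z) (re w) (im w) ,
    solve 4 (λ a b c d → :- (a :* d :+ b :* c) := a :* (:- d) :+ (:- b) :* c) refl (re z) (im z) (re w) (im w)

  -- The squared modulus: |z| itself would need square roots, so bounds |z| ≤ r are the relation z ⊑ r.
  ∥_∥² : ℂ → ℝ
  ∥ z ∥² = re z * re z + im z * im z

  ∥∥²-nonneg : ∀ z → 0# ≤ ∥ z ∥²
  ∥∥²-nonneg z = +-nonneg (square-nonneg (re z)) (square-nonneg (im z))

  ∥∥²-cong : ∀ {z w} → z ≈ᶜ w → ∥ z ∥² ≈ ∥ w ∥²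
  ∥∥²-cong (p , q) = +-cong (*-cong p p) (*-cong q q)

  ∥∥²-* : ∀ z w → ∥ z *ᶜ w ∥² ≈ ∥ z ∥² * ∥ w ∥²
  ∥∥²-* z w = solve 4 (λ a b c d →
    (a :* c :- b :* d) :* (a :* c :- b :* d) :+ (a :* d :+ b :* c) :* (a :* d :+ b :* c) :=
    (a :* a :+ b :* b) :* (c :* c :+ d :* d)) refl (re z) (im z) (re w) (im w)

  ∥∥²-neg : ∀ z → ∥ -ᶜ z ∥² ≈ ∥ z ∥²
  ∥∥²-neg z = solve 2 (λ a b → (:- a) :* (:- a) :+ (:- b) :* (:- b) := a :* a :+ b :* b) refl (re z) (im z)

  ∥∥²-conj : ∀ z → ∥ conj z ∥² ≈ ∥ z ∥²
  ∥∥²-conj z = solve 2 (λ a b → a :* a :+ (:- b) :* (:- b) := a :* a :+ b :* b) refl (re z) (im z)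

  conj-inverse : ∀ z → z *ᶜ conj z ≈ᶜ fromℝ ∥ z ∥²
  conj-inverse z =
    solve 2 (λ a b → a :* a :- b :* (:- b) := a :* a :+ b :* b) refl (re z) (im z) ,
    solve 2 (λ a b → a :* (:- b) :+ b :* a := :0) refl (re z) (im z)

  ∥fromℝ∥² : ∀ x → ∥ fromℝ x ∥² ≈ x * x
  ∥fromℝ∥² x = solve 1 (λ x → x :* x :+ :0 :* :0 := x :* x) refl x

  ∥∥²-zero : ∀ {z} → ∥ z ∥² ≈ 0# → z ≈ᶜ 0ᶜ
  ∥∥²-zero {z} eq =
    square-zero (≤-antisym (≤-resp refl eq (by-nonneg (square-nonneg (im z)) refl)) (square-nonneg _)) ,
    square-zero (≤-antisym (≤-resp refl eq (by-nonneg (square-nonneg (re z)) (+-comm _ _))) (square-nonneg _))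

  -- The sign of `r` is recorded because `r * r` does not determine it.
  infix 4 _⊑_
  record _⊑_ (z : ℂ) (r : ℝ) : Set where
    constructor bounded
    field
      radius-nonneg : 0# ≤ r
      ∥∥²-≤         : ∥ z ∥² ≤ r * r
  open _⊑_ public

  ⊑-cong : ∀ {z w r s} → z ≈ᶜ w → r ≈ s → z ⊑ r → w ⊑ s
  ⊑-cong z≈w r≈s (bounded 0≤r p) = bounded (≤-resp refl r≈s 0≤r) (≤-resp (∥∥²-cong z≈w) (*-cong r≈s r≈s) p)

  ⊑-weaken : ∀ {z r s} → r ≤ s → z ⊑ r → z ⊑ s
  ⊑-weaken r≤s (bounded 0≤r p) = bounded (≤-trans 0≤r r≤s) (≤-trans p (square-mono-≤ 0≤r r≤s))

  ⊑-* : ∀ {z w r s} → z ⊑ r → w ⊑ s → z *ᶜ w ⊑ r * s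
  ⊑-* {z} {w} {r} {s} (bounded 0≤r p) (bounded 0≤s q) = bounded (*-nonneg 0≤r 0≤s) (≤-resp
    (sym (∥∥²-* z w)) (solve 2 (λ r s → r :* r :* (s :* s) := r :* s :* (r :* s)) refl r s)
    (*-mono-≤ (∥∥²-nonneg z) (∥∥²-nonneg w) p q))

  ⊑-neg : ∀ {z r} → z ⊑ r → -ᶜ z ⊑ r
  ⊑-neg {z} (bounded 0≤r p) = bounded 0≤r (≤-resp (sym (∥∥²-neg z)) refl p)

  ⊑-conj : ∀ {z r} → z ⊑ r → conj z ⊑ r
  ⊑-conj {z} (bounded 0≤r p) = bounded 0≤r (≤-resp (sym (∥∥²-conj z)) refl p)

  private
    -- Cauchy-Schwarz: the left side is the real part of `conj z *ᶜ w`, whose modulus is at most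
    -- `r * s`.
    inner≤ : ∀ {z w r s} → z ⊑ r → w ⊑ s → re z * re w + im z * im w ≤ r * s
    inner≤ {z} {w} {r} {s} z⊑r w⊑s = ≤-trans (x≤∣x∣ _) (∣∣-≤-square (radius-nonneg z̄w⊑rs)
      (≤-trans (by-nonneg (square-nonneg (im (conj z *ᶜ w)))
        (solve 4 (λ a b c d → (a :* c :- (:- b) :* d) :* (a :* c :- (:- b) :* d) :+ (a :* d :+ (:- b) :* c) :* (a :* d :+ (:- b) :* c) :=
           (a :* c :+ b :* d) :* (a :* c :+ b :* d) :+ (a :* d :+ (:- b) :* c) :* (a :* d :+ (:- b) :* c)) refl (re z) (im z) (re w) (im w)))
        (∥∥²-≤ z̄w⊑rs)))
      where
      z̄w⊑rs : conj z *ᶜ w ⊑ r * s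
      z̄w⊑rs = ⊑-* (⊑-conj z⊑r) w⊑s

  ⊑-+ : ∀ {z w r s} → z ⊑ r → w ⊑ s → z +ᶜ w ⊑ r + s
  ⊑-+ {z} {w} {r} {s} z⊑r w⊑s = bounded (+-nonneg (radius-nonneg z⊑r) (radius-nonneg w⊑s))
    (≤-resp
      (solve 4 (λ a b c d → a :* a :+ b :* b :+ (c :* c :+ d :* d) :+ ((a :* c :+ b :* d) :+ (a :* c :+ b :* d)) :=
        (a :+ c) :* (a :+ c) :+ (b :+ d) :* (b :+ d)) refl (re z) (im z) (re w) (im w))
      (solve 2 (λ r s → r :* r :+ s :* s :+ (r :* s :+ r :* s) := (r :+ s) :* (r :+ s)) refl r s)
      (+-mono-≤ (+-mono-≤ (∥∥²-≤ z⊑r) (∥∥²-≤ w⊑s)) (+-mono-≤ (inner≤ z⊑r w⊑s) (inner≤ z⊑r w⊑s))))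

  ⊑-- : ∀ {z w r s} → z ⊑ r → w ⊑ s → z -ᶜ w ⊑ r + s
  ⊑-- z⊑r w⊑s = ⊑-+ z⊑r (⊑-neg w⊑s)

  ⊑-0 : 0ᶜ ⊑ 0#
  ⊑-0 = bounded ≤-refl (≤-reflexive (solve 0 (:0 :* :0 :+ :0 :* :0 := :0 :* :0) refl))

  ⊑-fromℝ : ∀ {x} → 0# ≤ x → fromℝ x ⊑ x
  ⊑-fromℝ {x} 0≤x = bounded 0≤x (≤-reflexive (∥fromℝ∥² x))

  ∣re∣≤ : ∀ {z r} → z ⊑ r → ∣ re z ∣ ≤ r
  ∣re∣≤ {z} (bounded 0≤r p) = ∣∣-≤-square 0≤r (≤-trans (by-nonneg (square-nonneg (im z)) refl) p)

  ∣im∣≤ : ∀ {z r} → z ⊑ r → ∣ im z ∣ ≤ r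
  ∣im∣≤ {z} (bounded 0≤r p) = ∣∣-≤-square 0≤r (≤-trans (by-nonneg (square-nonneg (re z)) (+-comm _ _)) p)

  ⊑-lim : ∀ {s z r} N → ConvergesTo (re ∘ s) (re z) → ConvergesTo (im ∘ s) (im z) →
          (∀ n → N ℕ.≤ n → s n ⊑ r) → z ⊑ r
  ⊑-lim {s} {z} {r} N re→ im→ s⊑r = bounded (radius-nonneg (s⊑r N ℕ.≤-refl))
    (lim-≤ N (lim-+ (lim-* re→ re→) (lim-* im→ im→)) (λ n N≤n → ∥∥²-≤ (s⊑r n N≤n)))

  Σ<ᶜ : ℕ → (ℕ → ℂ) → ℂ
  Σ<ᶜ n a = Σ< n (re ∘ a) +i Σ< n (im ∘ a)

  Σ<ᶜ-⊑ : ∀ n {a u} → (∀ i → a i ⊑ u i) → Σ<ᶜ n a ⊑ Σ< n u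
  Σ<ᶜ-⊑ zero    a⊑u = ⊑-0
  Σ<ᶜ-⊑ (suc n) a⊑u = ⊑-+ (a⊑u 0) (Σ<ᶜ-⊑ n (a⊑u ∘ suc))

  Σ<ᶜ-tail : ∀ {k n a u} → (∀ i → a i ⊑ u i) → k ℕ.≤ n → Σ<ᶜ n a -ᶜ Σ<ᶜ k a ⊑ Σ< n u - Σ< k u
  Σ<ᶜ-tail {k} {n} {a} {u} a⊑u k≤n = ⊑-cong
    (symᶜ (diff (re ∘ a) , diff (im ∘ a))) (sym (diff u)) (Σ<ᶜ-⊑ (n ℕ.∸ k) (λ i → a⊑u (k ℕ.+ i)))
    where
    diff : ∀ b → Σ< n b - Σ< k b ≈ Σ< (n ℕ.∸ k) (λ i → b (k ℕ.+ i))
    diff b = trans (+-congʳ (trans (reflexive (≡.cong (λ m → Σ< m b) (≡.sym (ℕ.m+[n∸m]≡n k≤n)))) (Σ<-split k (n ℕ.∸ k) b)))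
      (solve 2 (λ x y → x :+ y :- x := y) refl _ _)

-- The exponential series on the imaginary axis and its addition formula.

module Exponential (em : ExcludedMiddle 0ℓ) (𝓡 : CompleteOrderedField) where
  open Analysis 𝓡
  open OrderedField em 𝓡
  open Series em 𝓡
  open Complex em 𝓡
  private
    module Cℝ = CauchyProduct commutativeRing
    module Cℂ = CauchyProduct ℂ-commutativeRing

  num*1/suc : ∀ n → num (suc n) * 1/suc n ≈ 1#
  num*1/suc n = trans (*-congʳ (sym (·1≈num (suc n)))) (proj₂ (inverse (suc n · 1#) _))

  1/suc-pos : ∀ n → 0# < 1/suc n
  1/suc-pos n = *-cancelˡ-< (num-nonneg (suc n)) (<-resp (sym (zeroʳ _)) (sym (num*1/suc n)) 0<1)

  -- The real exponential series serves as majorant: at `r` it dominates `expTerm z` termwise for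
  -- every `z ⊑ r`.
  expTermᴿ : ℝ → ℕ → ℝ
  expTermᴿ x zero    = 1#
  expTermᴿ x (suc n) = expTermᴿ x n * (x * 1/suc n)

  expTermᴿ-nonneg : ∀ {x} → 0# ≤ x → ∀ n → 0# ≤ expTermᴿ x n
  expTermᴿ-nonneg 0≤x zero    = 0≤1
  expTermᴿ-nonneg 0≤x (suc n) = *-nonneg (expTermᴿ-nonneg 0≤x n) (*-nonneg 0≤x (<⇒≤ (1/suc-pos n)))

  expTermᴿ-exponential : ∀ x → Cℝ.IsExponential x (expTermᴿ x)
  expTermᴿ-exponential x = refl , λ n → trans
    (solve 4 (λ m e x r → m :* (e :* (x :* r)) := (m :* r) :* (x :* e)) refl (num (suc n)) (expTermᴿ x n) x (1/suc n))
    (trans (*-congʳ (num*1/suc n)) (*-identityˡ _))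

  expTermᴿ-+ : ∀ x y n → expTermᴿ (x + y) n ≈ (expTermᴿ x Cℝ.⋆ expTermᴿ y) n
  expTermᴿ-+ x y = Cℝ.exponential-unique (λ n → 1/suc n , num*1/suc n) refl
    (expTermᴿ-exponential (x + y)) (Cℝ.⋆-exponential (expTermᴿ-exponential x) (expTermᴿ-exponential y))

  private
    numᶜ : ∀ n → Cℂ.numᴿ n ≈ᶜ fromℝ (num n)
    numᶜ zero    = reflᶜ
    numᶜ (suc n) = transᶜ (Cℂ.numᴿ-suc n) (transᶜ (ℂR.+-congˡ (numᶜ n))
      (sym (num-suc n) , +-identityʳ 0#))

    recipᶜ : ∀ n → Cℂ.numᴿ (suc n) *ᶜ fromℝ (1/suc n) ≈ᶜ 1ᶜ
    recipᶜ n = transᶜ (ℂR.*-congʳ (numᶜ (suc n))) (transᶜ (symᶜ (fromℝ-* _ _)) (fromℝ-cong (num*1/suc n)))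

  expTerm-exponential : ∀ z → Cℂ.IsExponential z (expTerm z)
  expTerm-exponential z = reflᶜ , λ n → transᶜ
    (solveᶜ 4 (λ m e x r → m :*ᶜ (e :*ᶜ (x :*ᶜ r)) :=ᶜ (m :*ᶜ r) :*ᶜ (x :*ᶜ e)) reflᶜ (Cℂ.numᴿ (suc n)) (expTerm z n) z (fromℝ (1/suc n)))
    (transᶜ (ℂR.*-congʳ (recipᶜ n)) (ℂR.*-identityˡ _))

  -- `v` is a separate variable because `0# +i (a + b)` is the sum of `0# +i a` and `0# +i b` only
  -- up to `≈ᶜ`.
  expTerm-+ : ∀ {z w v} → v ≈ᶜ z +ᶜ w → ∀ n → expTerm v n ≈ᶜ (expTerm z Cℂ.⋆ expTerm w) n
  expTerm-+ {z} {w} {v} eq = Cℂ.exponential-unique (λ n → fromℝ (1/suc n) , recipᶜ n) eq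
    (expTerm-exponential v) (Cℂ.⋆-exponential (expTerm-exponential z) (expTerm-exponential w))

  expTerm-⊑ : ∀ {z r} → z ⊑ r → ∀ n → expTerm z n ⊑ expTermᴿ r n
  expTerm-⊑ z⊑r zero    = ⊑-fromℝ 0≤1
  expTerm-⊑ z⊑r (suc n) = ⊑-* (expTerm-⊑ z⊑r n) (⊑-* z⊑r (⊑-fromℝ (<⇒≤ (1/suc-pos n))))

  partialSum≡Σ<ᶜ : ∀ n a → Cℂ.partialSum n a ≡ Σ<ᶜ n a
  partialSum≡Σ<ᶜ zero    a = ≡.refl
  partialSum≡Σ<ᶜ (suc n) a = ≡.cong (a 0 +ᶜ_) (partialSum≡Σ<ᶜ n (a ∘ suc))

  x/suc≤½ : ∀ {x n} → 0# ≤ x → x + x ≤ num (suc n) → x * 1/suc n ≤ ½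
  x/suc≤½ {x} {n} 0≤x 2x≤ = *-cancelˡ-≤ (num-pos 1) (begin
    num 2 * (x * 1/suc n)  ≈⟨ solve 2 (λ x r → :2 :* (x :* r) := (x :+ x) :* r) refl x (1/suc n) ⟩
    (x + x) * 1/suc n  ≤⟨ *-monoʳ-≤ (<⇒≤ (1/suc-pos n)) 2x≤ ⟩
    num (suc n) * 1/suc n  ≈⟨ num*1/suc n ⟩
    1#  ≈⟨ ½+½≈1 ⟨
    ½ + ½  ≈⟨ solve 1 (λ x → x :+ x := :2 :* x) refl ½ ⟩
    num 2 * ½  ∎)
    where open ≤-Reasoning

  -- From index `k` on, the ratio x/(k + n + 1) of consecutive terms is at most ½.
  expTermᴿ-decay : ∀ {x k} → 0# ≤ x → x + x ≤ num (suc k) → ∀ n → expTermᴿ x (k ℕ.+ n) ≤ expTermᴿ x k * ½^ n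
  expTermᴿ-decay {x} {k} 0≤x 2x≤ zero = ≤-reflexive
    (trans (reflexive (≡.cong (expTermᴿ x) (ℕ.+-identityʳ k))) (sym (*-identityʳ _)))
  expTermᴿ-decay {x} {k} 0≤x 2x≤ (suc n) = begin
    expTermᴿ x (k ℕ.+ suc n)  ≡⟨ ≡.cong (expTermᴿ x) (ℕ.+-suc k n) ⟩
    expTermᴿ x (k ℕ.+ n) * (x * 1/suc (k ℕ.+ n))  ≤⟨ *-mono-≤ (expTermᴿ-nonneg 0≤x (k ℕ.+ n))
                                                          (*-nonneg 0≤x (<⇒≤ (1/suc-pos (k ℕ.+ n))))
                                                          (expTermᴿ-decay {x} {k} 0≤x 2x≤ n)
                                                          (x/suc≤½ {x} {k ℕ.+ n} 0≤x (≤-trans 2x≤ (num-mono-≤ (ℕ.s≤s (ℕ.m≤m+n k n))))) ⟩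
    expTermᴿ x k * ½^ n * ½  ≈⟨ solve 3 (λ a b c → a :* b :* c := a :* (c :* b)) refl (expTermᴿ x k) (½^ n) ½ ⟩
    expTermᴿ x k * (½ * ½^ n)  ∎
    where open ≤-Reasoning

  expTermᴿ-tail : ∀ {x k} → 0# ≤ x → x + x ≤ num (suc k) → ∀ n →
                  Σ< n (expTermᴿ x) ≤ Σ< k (expTermᴿ x) + num 2 * expTermᴿ x k
  expTermᴿ-tail {x} {k} 0≤x 2x≤ n = begin
    Σ< n e  ≤⟨ Σ<-monoˡ {n} {k ℕ.+ n} (expTermᴿ-nonneg 0≤x) (ℕ.m≤n+m n k) ⟩
    Σ< (k ℕ.+ n) e  ≈⟨ Σ<-split k n e ⟩
    Σ< k e + Σ< n (λ i → e (k ℕ.+ i))  ≤⟨ +-monoʳ-≤ _ (Σ<-mono n (expTermᴿ-decay {x} {k} 0≤x 2x≤)) ⟩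
    Σ< k e + Σ< n (λ i → e k * ½^ i)  ≈⟨ +-congˡ (*-distribˡ-sum {n} (e k) (λ i → ½^ (toℕ i))) ⟨
    Σ< k e + e k * Σ< n ½^  ≤⟨ +-monoʳ-≤ _ (*-monoˡ-≤ (expTermᴿ-nonneg 0≤x k) (Σ<-½^-≤2 n)) ⟩
    Σ< k e + e k * (1# + 1#)  ≈⟨ +-congˡ (*-comm _ _) ⟩
    Σ< k e + num 2 * e k  ∎
    where
    open ≤-Reasoning
    e = expTermᴿ x

  expᴿ : ∀ {x} → 0# ≤ x → ∃ (HasSum (expTermᴿ x))
  expᴿ {x} 0≤x = let k , 2x<k = archimedean (x + x) in
    monotone-converges (λ n → Σ< n (expTermᴿ x)) _
      (λ n → Σ<-monoˡ {n} {suc n} (expTermᴿ-nonneg 0≤x) (ℕ.n≤1+n n))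
      (expTermᴿ-tail {x} {k} 0≤x (≤-trans (<⇒≤ 2x<k) (num-mono-≤ (ℕ.n≤1+n k))))

  private
    i∙_ : ℝ → ℂ
    i∙ θ = 0# +i θ

    i∙-⊑ : ∀ θ → i∙ θ ⊑ ∣ θ ∣
    i∙-⊑ θ = bounded (∣∣-nonneg θ) (≤-reflexive
      (trans (solve 1 (λ θ → :0 :* :0 :+ θ :* θ := θ :* θ) refl θ) (sym (∣∣-square θ))))

  cis-term : ℝ → ℕ → ℂ
  cis-term θ = expTerm (i∙ θ)

  cis-term-⊑ : ∀ {θ r} → ∣ θ ∣ ≤ r → ∀ n → cis-term θ n ⊑ expTermᴿ r n
  cis-term-⊑ {θ} ∣θ∣≤r = expTerm-⊑ (⊑-weaken ∣θ∣≤r (i∙-⊑ θ))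

  private
    converges : ∀ θ (part : ℂ → ℝ) → (∀ {z r} → z ⊑ r → ∣ part z ∣ ≤ r) → ∃ (HasSum (part ∘ cis-term θ))
    converges θ part part≤ = absolutelySummable⇒summable {part ∘ cis-term θ} (bounded⇒absolutelySummable {part ∘ cis-term θ} _ λ n →
      ≤-trans (Σ<-mono n (λ i → part≤ (cis-term-⊑ {θ} ≤-refl i)))
        (partial≤sum (expTermᴿ-nonneg (∣∣-nonneg θ)) (proj₂ (expᴿ (∣∣-nonneg θ))) n))

  abstract
    cis : ℝ → ℂ
    cis θ = proj₁ (converges θ re ∣re∣≤) +i proj₁ (converges θ im ∣im∣≤)

    cis-isCis : ∀ θ → IsCis θ (cis θ)
    cis-isCis θ = proj₂ (converges θ re ∣re∣≤) , proj₂ (converges θ im ∣im∣≤)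

  cis-unique : ∀ {θ z} → IsCis θ z → z ≈ᶜ cis θ
  cis-unique {θ} (re→ , im→) = lim-unique re→ (proj₁ (cis-isCis θ)) , lim-unique im→ (proj₂ (cis-isCis θ))

  -- The remainder is dominated by the tail of the majorant, which from index `k` on is below a
  -- geometric series with ratio ½; hence twice the first omitted term.
  cis-approx : ∀ {θ r} k → ∣ θ ∣ ≤ r → r + r ≤ num (suc k) → cis θ -ᶜ Σ<ᶜ k (cis-term θ) ⊑ num 2 * expTermᴿ r k
  cis-approx {θ} {r} k ∣θ∣≤r 2r≤ = ⊑-lim {s = λ n → Σ<ᶜ n (cis-term θ) -ᶜ Σ<ᶜ k (cis-term θ)} k
    (lim-+ (proj₁ (cis-isCis θ)) (lim-const _))
    (lim-+ (proj₂ (cis-isCis θ)) (lim-const _))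
    (λ n k≤n → ⊑-weaken
      (≤-resp refl (solve 2 (λ s t → s :+ t :- s := t) refl _ _)
        (+-monoˡ-≤ _ (expTermᴿ-tail {r} {k} (≤-trans (∣∣-nonneg θ) ∣θ∣≤r) 2r≤ n)))
      (Σ<ᶜ-tail {k} {n} (cis-term-⊑ {θ} ∣θ∣≤r) k≤n))

  private
    -- For n ≤ m the triangle lies in the rectangle, so the difference collects the αᵢ βⱼ with i <
    -- n, j < m and i + j ≥ n, each dominated by uᵢ vⱼ. A separate `m` lets the induction peel off
    -- rows while the width of the rectangle stays fixed.
    triangle-bound : ∀ {α β u v} → (∀ i → α i ⊑ u i) → (∀ i → β i ⊑ v i) → ∀ n m → n ℕ.≤ m →
      Cℂ.partialSum n α *ᶜ Σ<ᶜ m β -ᶜ Cℂ.triangle α β n ⊑ Σ< n u * Σ< m v - Cℝ.triangle u v n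
    triangle-bound {β = β} {v = v} α⊑u β⊑v zero m _ = ⊑-cong
      (solveᶜ 1 (λ b → :0ᶜ :=ᶜ :0ᶜ :*ᶜ b :-ᶜ :0ᶜ) reflᶜ (Σ<ᶜ m β))
      (solve 1 (λ b → :0 := :0 :* b :- :0) refl (Σ< m v))
      ⊑-0
    triangle-bound {α} {β} {u} {v} α⊑u β⊑v (suc n) m n<m = ⊑-cong
      (transᶜ (ℂR.+-congʳ (ℂR.*-congˡ (ℂR.+-congˡ (ℂR.-‿cong (ℂR.reflexive (≡.sym (partialSum≡Σ<ᶜ (suc n) β)))))))
        (solveᶜ 5 (λ a b p s t → a :*ᶜ (b :-ᶜ p) :+ᶜ (s :*ᶜ b :-ᶜ t) :=ᶜ (a :+ᶜ s) :*ᶜ b :-ᶜ (a :*ᶜ p :+ᶜ t)) reflᶜ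
          (α 0) (Σ<ᶜ m β) (Cℂ.partialSum (suc n) β) (Cℂ.partialSum n (α ∘ suc)) (Cℂ.triangle (α ∘ suc) β n)))
      (solve 5 (λ a b p s t → a :* (b :- p) :+ (s :* b :- t) := (a :+ s) :* b :- (a :* p :+ t)) refl
          (u 0) (Σ< m v) (Σ< (suc n) v) (Σ< n (u ∘ suc)) (Cℝ.triangle (u ∘ suc) v n))
      (⊑-+ (⊑-* (α⊑u 0) (Σ<ᶜ-tail {suc n} {m} β⊑v n<m))
           (triangle-bound (α⊑u ∘ suc) β⊑v n m (ℕ.<⇒≤ n<m)))

    -- The `n` by `k` rectangle of indices fits into the triangle of side n + k.
    triangle-lower : ∀ {u v} → (∀ i → 0# ≤ u i) → (∀ i → 0# ≤ v i) → ∀ n k →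
      Σ< n u * Σ< k v ≤ Cℝ.triangle u v (n ℕ.+ k)
    triangle-lower {u} {v} 0≤u 0≤v zero k = ≤-resp (sym (zeroˡ _)) refl (nonneg k u 0≤u)
      where
      nonneg : ∀ k u → (∀ i → 0# ≤ u i) → 0# ≤ Cℝ.triangle u v k
      nonneg zero    u 0≤u = ≤-refl
      nonneg (suc k) u 0≤u = +-nonneg (*-nonneg (0≤u 0) (sum-nonneg (suc k) (λ i → 0≤v (toℕ i)))) (nonneg k (u ∘ suc) (0≤u ∘ suc))
    triangle-lower {u} {v} 0≤u 0≤v (suc n) k = ≤-resp (sym (distribʳ _ _ _)) refl (+-mono-≤
      (*-monoˡ-≤ (0≤u 0) (Σ<-monoˡ {k} {suc (n ℕ.+ k)} 0≤v (ℕ.m≤n⇒m≤1+n (ℕ.m≤n+m k n))))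
      (triangle-lower (0≤u ∘ suc) 0≤v n k))

  -- The n-th partial sums of the product and of the Cauchy product differ by at most `d n`, the
  -- same difference for the majorants. The limit U V - W of `d` is at most 0 because rectangles fit
  -- into triangles, and at least 0 because every `d n` is a radius.
  cis-+ : ∀ a b → cis (a + b) ≈ᶜ cis a *ᶜ cis b
  cis-+ a b =
    symᶜ
      ( lim-close d→0 (λ n → ∣re∣≤ (close n)) (lim-+ (lim-* reA reB) (lim-neg (lim-* imA imB))) (proj₁ (cis-isCis (a + b)))
      , lim-close d→0 (λ n → ∣im∣≤ (close n)) (lim-+ (lim-* reA imB) (lim-* imA reB)) (proj₂ (cis-isCis (a + b))) )
    where
    reA = proj₁ (cis-isCis a)
    imA = proj₂ (cis-isCis a)
    reB = proj₁ (cis-isCis b)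
    imB = proj₂ (cis-isCis b)
    u = expTermᴿ ∣ a ∣
    v = expTermᴿ ∣ b ∣
    0≤u = expTermᴿ-nonneg (∣∣-nonneg a)
    0≤v = expTermᴿ-nonneg (∣∣-nonneg b)
    w = expTermᴿ (∣ a ∣ + ∣ b ∣)
    0≤w = expTermᴿ-nonneg (+-nonneg (∣∣-nonneg a) (∣∣-nonneg b))
    U = expᴿ (∣∣-nonneg a)
    V = expᴿ (∣∣-nonneg b)
    W = expᴿ (+-nonneg (∣∣-nonneg a) (∣∣-nonneg b))
    triangle≈w : ∀ n → Cℝ.triangle u v n ≈ Σ< n w
    triangle≈w n = trans (Cℝ.triangle≈ n u v) (Σ<-cong n (λ i → sym (expTermᴿ-+ ∣ a ∣ ∣ b ∣ i)))
    UV≤W : proj₁ U * proj₁ V ≤ proj₁ W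
    UV≤W = lim-≤ 0 (lim-* (proj₂ U) (proj₂ V)) λ n _ →
      ≤-trans (triangle-lower 0≤u 0≤v n n)
        (≤-trans (≤-reflexive (triangle≈w (n ℕ.+ n))) (partial≤sum 0≤w (proj₂ W) (n ℕ.+ n)))
    d : ℕ → ℝ
    d n = Σ< n u * Σ< n v - Cℝ.triangle u v n
    AB : ℕ → ℂ
    AB n = Σ<ᶜ n (cis-term a) *ᶜ Σ<ᶜ n (cis-term b)
    close : ∀ n → AB n -ᶜ Σ<ᶜ n (cis-term (a + b)) ⊑ d n
    close n = ⊑-cong
      (ℂR.+-cong (ℂR.*-congʳ (ℂR.reflexive (partialSum≡Σ<ᶜ n (cis-term a))))
        (ℂR.-‿cong (transᶜ (Cℂ.triangle≈ n (cis-term a) (cis-term b))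
          (transᶜ (ℂR.reflexive (partialSum≡Σ<ᶜ n (cis-term a Cℂ.⋆ cis-term b)))
            ( Σ<-cong n (λ i → sym (proj₁ (expTerm-+ {i∙ a} {i∙ b} {i∙ (a + b)} (sym (+-identityˡ 0#) , refl) i)))
            , Σ<-cong n (λ i → sym (proj₂ (expTerm-+ {i∙ a} {i∙ b} {i∙ (a + b)} (sym (+-identityˡ 0#) , refl) i))))))))
      refl (triangle-bound (cis-term-⊑ {a} ≤-refl) (cis-term-⊑ {b} ≤-refl) n n ℕ.≤-refl)
    d→ : ConvergesTo d (proj₁ U * proj₁ V + - proj₁ W)
    d→ = lim-cong (λ n → +-congˡ (-‿cong (sym (triangle≈w n)))) refl
      (lim-+ (lim-* (proj₂ U) (proj₂ V)) (lim-neg (proj₂ W)))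
    d→0 : ConvergesTo d 0#
    d→0 = lim-cong (λ _ → refl) (≤-antisym
      (≤-resp refl (-‿inverseʳ _) (+-monoˡ-≤ _ UV≤W))
      (lim-≥ 0 d→ (λ n _ → radius-nonneg (close n)))) d→

-- Sine, cosine and the existence of π.

module Trigonometry (em : ExcludedMiddle 0ℓ) (𝓡 : CompleteOrderedField) where
  open Analysis 𝓡
  open OrderedField em 𝓡
  open Series em 𝓡
  open Complex em 𝓡
  open Exponential em 𝓡

  sin cos : ℝ → ℝ
  sin θ = im (cis θ)
  cos θ = re (cis θ)

  expTerm-cong : ∀ {z w} → z ≈ᶜ w → ∀ n → expTerm z n ≈ᶜ expTerm w n
  expTerm-cong z≈w zero    = reflᶜ
  expTerm-cong z≈w (suc n) = ℂR.*-cong (expTerm-cong z≈w n) (ℂR.*-congʳ z≈w)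

  cis-cong : ∀ {a b} → a ≈ b → cis a ≈ᶜ cis b
  cis-cong {a} {b} a≈b = cis-unique
    ( lim-cong (λ n → Σ<-cong n {re ∘ cis-term a} {re ∘ cis-term b} λ i → proj₁ (expTerm-cong (refl , a≈b) i)) refl (proj₁ (cis-isCis a))
    , lim-cong (λ n → Σ<-cong n {im ∘ cis-term a} {im ∘ cis-term b} λ i → proj₂ (expTerm-cong (refl , a≈b) i)) refl (proj₂ (cis-isCis a)) )

  expTerm-conj : ∀ z n → expTerm (conj z) n ≈ᶜ conj (expTerm z n)
  expTerm-conj z zero    = refl , sym -0#≈0#
  expTerm-conj z (suc n) = transᶜ (ℂR.*-cong (expTerm-conj z n) (transᶜ (ℂR.*-congˡ (refl , sym -0#≈0#)) (symᶜ (conj-* z _))))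
    (symᶜ (conj-* (expTerm z n) _))

  cis-neg : ∀ a → cis (- a) ≈ᶜ conj (cis a)
  cis-neg a = symᶜ (cis-unique
    ( lim-cong (λ n → Σ<-cong n {re ∘ cis-term a} {re ∘ cis-term (- a)} λ i → sym (proj₁ (terms i))) refl (proj₁ (cis-isCis a))
    , lim-cong (λ n → trans (neg-sum n (im ∘ cis-term a))
        (Σ<-cong n {λ i → - im (cis-term a i)} {im ∘ cis-term (- a)} λ i → sym (proj₂ (terms i)))) refl (lim-neg (proj₂ (cis-isCis a))) ))
    where
    terms : ∀ i → cis-term (- a) i ≈ᶜ conj (cis-term a i)
    terms i = expTerm-conj (0# +i a) i
    neg-sum : ∀ n b → - Σ< n b ≈ Σ< n (λ i → - b i)
    neg-sum zero    b = -0#≈0#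
    neg-sum (suc n) b = trans (solve 2 (λ x y → :- (x :+ y) := :- x :+ :- y) refl _ _) (+-congˡ (neg-sum n (b ∘ suc)))

  -- With radius 0 the error bound for the first partial sum, which is 1, vanishes.
  cis-0 : cis 0# ≈ᶜ 1ᶜ
  cis-0 = begin
    cis 0#  ≈⟨ solveᶜ 2 (λ z w → z :=ᶜ z :-ᶜ w :+ᶜ w) reflᶜ _ _ ⟩
    cis 0# -ᶜ Σ<ᶜ 1 (cis-term 0#) +ᶜ Σ<ᶜ 1 (cis-term 0#)  ≈⟨ ℂR.+-cong (∥∥²-zero (≤-antisym (≤-trans (∥∥²-≤ error) (≤-reflexive
                                                                   (solve 1 (λ r → :2 :* (:1 :* (:0 :* r)) :* (:2 :* (:1 :* (:0 :* r))) := :0) refl (1/suc 0))))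
                                                                   (∥∥²-nonneg (cis 0# -ᶜ Σ<ᶜ 1 (cis-term 0#))))) (+-identityʳ _ , +-identityʳ _) ⟩
    0ᶜ +ᶜ 1ᶜ  ≈⟨ ℂR.+-identityˡ 1ᶜ ⟩
    1ᶜ  ∎
    where
    open ≈ᶜ-Reasoning
    error = cis-approx {0#} {0#} 1 (≤-reflexive (∣∣-nonneg-≈ ≤-refl)) (≤-resp (sym (+-identityˡ 0#)) refl (num-nonneg 2))

  cis-conj : ∀ θ → cis θ *ᶜ conj (cis θ) ≈ᶜ 1ᶜ
  cis-conj θ = transᶜ (ℂR.*-congˡ (symᶜ (cis-neg θ))) (transᶜ (symᶜ (cis-+ θ (- θ))) (transᶜ (cis-cong (-‿inverseʳ θ)) cis-0))

  ∥cis∥² : ∀ θ → ∥ cis θ ∥² ≈ 1#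
  ∥cis∥² θ = proj₁ (transᶜ (symᶜ (conj-inverse (cis θ))) (cis-conj θ))

  cis-⊑1 : ∀ θ → cis θ ⊑ 1#
  cis-⊑1 θ = bounded 0≤1 (≤-reflexive (trans (∥cis∥² θ) (sym (*-identityˡ 1#))))

  -- For |h| ≤ 1 this is the Taylor estimate with one term; for |h| ≥ 1 the left side is at most 2
  -- anyway.
  cis-near-1 : ∀ h → cis h -ᶜ 1ᶜ ⊑ num 2 * ∣ h ∣
  cis-near-1 h = [ small , large ]′ (≤-total ∣ h ∣ 1#)
    where
    small : ∣ h ∣ ≤ 1# → cis h -ᶜ 1ᶜ ⊑ num 2 * ∣ h ∣
    small ∣h∣≤1 = ⊑-cong (ℂR.+-congˡ (ℂR.-‿cong (+-identityʳ _ , +-identityʳ _)))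
      (*-congˡ (trans (solve 2 (λ h r → :1 :* (h :* r) := (:1 :* r) :* h) refl ∣ h ∣ (1/suc 0)) (trans (*-congʳ (num*1/suc 0)) (*-identityˡ _))))
      (cis-approx {h} {∣ h ∣} 1 ≤-refl (+-mono-≤ ∣h∣≤1 ∣h∣≤1))
    large : 1# ≤ ∣ h ∣ → cis h -ᶜ 1ᶜ ⊑ num 2 * ∣ h ∣
    large 1≤∣h∣ = ⊑-weaken (≤-resp refl (solve 1 (λ x → x :+ x := :2 :* x) refl _) (+-mono-≤ 1≤∣h∣ 1≤∣h∣))
      (⊑-- (cis-⊑1 h) (⊑-fromℝ 0≤1))

  cis-lipschitz : ∀ a b → cis a -ᶜ cis b ⊑ num 2 * ∣ a - b ∣
  cis-lipschitz a b = ⊑-cong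
    (transᶜ (solveᶜ 2 (λ z w → z :*ᶜ (w :-ᶜ :1ᶜ) :=ᶜ z :*ᶜ w :-ᶜ z) reflᶜ (cis b) (cis (a - b)))
      (ℂR.+-congʳ (transᶜ (symᶜ (cis-+ b (a - b))) (cis-cong (solve 2 (λ a b → b :+ (a :- b) := a) refl a b)))))
    (*-identityˡ _)
    (⊑-* (cis-⊑1 b) (cis-near-1 (a - b)))

  private
    r₁ r₂ r₃ : ℝ
    r₁ = 1/suc 1
    r₂ = 1/suc 2
    r₃ = 1/suc 3

    0≤r₁ = <⇒≤ (1/suc-pos 1)
    0≤r₂ = <⇒≤ (1/suc-pos 2)
    0≤r₃ = <⇒≤ (1/suc-pos 3)

    r₀≈1 : 1/suc 0 ≈ 1#
    r₀≈1 = trans (sym (*-identityˡ _)) (num*1/suc 0)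

    1/suc≤½ : ∀ n → 1/suc (suc n) ≤ ½
    1/suc≤½ n = ≤-resp (*-identityˡ _) refl (x/suc≤½ {1#} {suc n} 0≤1 (num-mono-≤ {2} {suc (suc n)} (ℕ.s≤s (ℕ.s≤s ℕ.z≤n))))

    r₁≈½ : r₁ ≈ ½
    r₁≈½ = begin
      r₁  ≈⟨ *-identityˡ r₁ ⟨
      1# * r₁  ≈⟨ *-congʳ ½+½≈1 ⟨
      (½ + ½) * r₁  ≈⟨ solve 2 (λ h r → (h :+ h) :* r := (:2 :* r) :* h) refl ½ r₁ ⟩
      (num 2 * r₁) * ½  ≈⟨ *-congʳ (num*1/suc 1) ⟩
      1# * ½  ≈⟨ *-identityˡ ½ ⟩
      ½  ∎
      where open ≈-Reasoning

    r₃≈¼ : r₃ ≈ ½ * ½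
    r₃≈¼ = begin
      r₃  ≈⟨ solve 1 (λ r → r := :1 :* :1 :* r) refl r₃ ⟩
      1# * 1# * r₃  ≈⟨ *-congʳ (*-cong ½+½≈1 ½+½≈1) ⟨
      (½ + ½) * (½ + ½) * r₃  ≈⟨ solve 2 (λ h r → (h :+ h) :* (h :+ h) :* r := (con (+ 4) :* r) :* (h :* h)) refl ½ r₃ ⟩
      (num 4 * r₃) * (½ * ½)  ≈⟨ *-congʳ (num*1/suc 3) ⟩
      1# * (½ * ½)  ≈⟨ *-identityˡ _ ⟩
      ½ * ½  ∎
      where open ≈-Reasoning

    -- Cubic Taylor polynomials on [0,1], with error 2 θ⁴/4! = θ⁴/12. They show that sine is
    -- positive on (0,1] and locate cos 1 between ½ - ⅛ and ½ + ⅛.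
    module Cubic {θ} (0≤θ : 0# ≤ θ) (θ≤1 : θ ≤ 1#) where
      error-size : num 2 * expTermᴿ θ 4 ≈ (θ * θ) * (θ * θ) * (r₂ * r₃)
      error-size = trans (solve 5 (λ θ a b c d → :2 :* (:1 :* (θ :* a) :* (θ :* b) :* (θ :* c) :* (θ :* d)) :=
          a :* (:2 :* b) :* (θ :* θ :* (θ :* θ) :* (c :* d))) refl θ (1/suc 0) r₁ r₂ r₃)
        (trans (*-congʳ (trans (*-cong r₀≈1 (num*1/suc 1)) (*-identityˡ 1#))) (*-identityˡ _))

      approx : cis θ -ᶜ Σ<ᶜ 4 (cis-term θ) ⊑ num 2 * expTermᴿ θ 4
      approx = cis-approx {θ} {θ} 4 (≤-reflexive (∣∣-nonneg-≈ 0≤θ))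
        (≤-trans (+-mono-≤ θ≤1 θ≤1) (num-mono-≤ {2} {5} (ℕ.s≤s (ℕ.s≤s ℕ.z≤n))))

      im-sum : im (Σ<ᶜ 4 (cis-term θ)) ≈ θ - θ * (θ * θ * (r₁ * r₂))
      -- `xₙ` and `yₙ` are the real and imaginary parts of `cis-term θ n` exactly as they unfold;
      -- `a`, `b`, `c` stand for 1/1, 1/2, 1/3.
      im-sum = trans (solve 4 (λ θ a b c →
          let x₁ = :1 :* (:0 :* a :- θ :* :0) :- :0 :* (:0 :* :0 :+ θ :* a)
              y₁ = :1 :* (:0 :* :0 :+ θ :* a) :+ :0 :* (:0 :* a :- θ :* :0)
              x₂ = x₁ :* (:0 :* b :- θ :* :0) :- y₁ :* (:0 :* :0 :+ θ :* b)
              y₂ = x₁ :* (:0 :* :0 :+ θ :* b) :+ y₁ :* (:0 :* b :- θ :* :0)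
              y₃ = x₂ :* (:0 :* :0 :+ θ :* c) :+ y₂ :* (:0 :* c :- θ :* :0)
          in :0 :+ (y₁ :+ (y₂ :+ (y₃ :+ :0))) := a :* (θ :- θ :* (θ :* θ :* (b :* c))))
          refl θ (1/suc 0) r₁ r₂)
        (trans (*-congʳ r₀≈1) (*-identityˡ _))

      re-sum : re (Σ<ᶜ 4 (cis-term θ)) ≈ 1# - θ * θ * r₁
      re-sum = trans (solve 4 (λ θ a b c →
          let x₁ = :1 :* (:0 :* a :- θ :* :0) :- :0 :* (:0 :* :0 :+ θ :* a)
              y₁ = :1 :* (:0 :* :0 :+ θ :* a) :+ :0 :* (:0 :* a :- θ :* :0)
              x₂ = x₁ :* (:0 :* b :- θ :* :0) :- y₁ :* (:0 :* :0 :+ θ :* b)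
              y₂ = x₁ :* (:0 :* :0 :+ θ :* b) :+ y₁ :* (:0 :* b :- θ :* :0)
              x₃ = x₂ :* (:0 :* c :- θ :* :0) :- y₂ :* (:0 :* :0 :+ θ :* c)
          in :1 :+ (x₁ :+ (x₂ :+ (x₃ :+ :0))) := :1 :- a :* (θ :* θ :* b))
          refl θ (1/suc 0) r₁ r₂)
        (+-congˡ (-‿cong (trans (*-congʳ r₀≈1) (*-identityˡ _))))

      θθ≤1 : θ * θ ≤ 1#
      θθ≤1 = ≤-resp refl (*-identityˡ 1#) (square-mono-≤ 0≤θ θ≤1)

      -- sin θ ≥ θ (1 - ¼ - ¼)
      sin-lower : ½ * θ ≤ sin θ
      sin-lower = begin
        ½ * θ  ≈⟨ solve 2 (λ h θ → h :* θ := θ :- θ :* (h :* :1) :+ (h :+ h :- :1) :* θ) refl ½ θ ⟩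
        θ - θ * (½ * 1#) + (½ + ½ - 1#) * θ  ≈⟨ +-cong (+-congˡ (-‿cong (*-congˡ (*-congˡ (sym ½+½≈1))))) (*-congʳ (trans (+-congʳ ½+½≈1) (-‿inverseʳ 1#))) ⟩
        θ - θ * (½ * (½ + ½)) + 0# * θ  ≈⟨ solve 2 (λ h θ → θ :- θ :* (h :* (h :+ h)) :+ :0 :* θ := θ :- θ :* (:1 :* (h :* h)) :- θ :* (:1 :* (h :* h))) refl ½ θ ⟩
        θ - θ * (1# * (½ * ½)) - θ * (1# * (½ * ½))  ≤⟨ +-mono-≤ (+-monoʳ-≤ θ (neg-mono-≤ (*-monoˡ-≤ 0≤θ (*-mono-≤ (square-nonneg θ) (*-nonneg 0≤r₁ 0≤r₂) θθ≤1 (*-mono-≤ 0≤r₁ 0≤r₂ (1/suc≤½ 0) (1/suc≤½ 1))))))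
                                                                (neg-mono-≤ (*-monoˡ-≤ 0≤θ (*-mono-≤ (*-nonneg 0≤θ (square-nonneg θ)) (*-nonneg 0≤r₂ 0≤r₃) (≤-resp refl (*-identityˡ 1#) (*-mono-≤ 0≤θ (square-nonneg θ) θ≤1 θθ≤1)) (*-mono-≤ 0≤r₂ 0≤r₃ (1/suc≤½ 1) (1/suc≤½ 2))))) ⟩
        θ - θ * (θ * θ * (r₁ * r₂)) - θ * (θ * (θ * θ) * (r₂ * r₃))  ≈⟨ +-cong (sym im-sum) (-‿cong (trans (solve 2 (λ θ r → θ :* (θ :* (θ :* θ) :* r) := θ :* θ :* (θ :* θ) :* r) refl θ (r₂ * r₃)) (sym error-size))) ⟩
        im (Σ<ᶜ 4 (cis-term θ)) - num 2 * expTermᴿ θ 4  ≤⟨ by-nonneg (gap-nonneg (≤-trans (-x≤∣x∣ _) (∣im∣≤ approx))) (solve 3 (λ s t e → s := t :- e :+ (e :- (:- (s :- t)))) refl (sin θ) _ _) ⟩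
        sin θ  ∎
        where open ≤-Reasoning

    sin-pos≤1 : ∀ {θ} → 0# < θ → θ ≤ 1# → 0# < sin θ
    sin-pos≤1 0<θ θ≤1 = <-≤-trans (*-pos ½-pos 0<θ) (Cubic.sin-lower (<⇒≤ 0<θ) θ≤1)

    module One = Cubic 0≤1 ≤-refl

    ⅛ : ℝ
    ⅛ = ½ * (½ * ½)

    error₁≤⅛ : num 2 * expTermᴿ 1# 4 ≤ ⅛
    error₁≤⅛ = begin
      num 2 * expTermᴿ 1# 4  ≈⟨ One.error-size ⟩
      1# * 1# * (1# * 1#) * (r₂ * r₃)  ≈⟨ solve 1 (λ x → :1 :* :1 :* (:1 :* :1) :* x := x) refl _ ⟩
      r₂ * r₃  ≤⟨ *-mono-≤ 0≤r₂ 0≤r₃ (1/suc≤½ 1) (≤-reflexive r₃≈¼) ⟩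
      ½ * (½ * ½)  ∎
      where open ≤-Reasoning

    re-sum₁ : re (Σ<ᶜ 4 (cis-term 1#)) ≈ ½
    re-sum₁ = trans One.re-sum (trans (+-cong (sym ½+½≈1) (-‿cong (*-congˡ r₁≈½)))
      (solve 1 (λ h → h :+ h :- :1 :* :1 :* h := h) refl ½))

    cos1≤ : cos 1# ≤ ½ + ⅛
    cos1≤ = by-nonneg (gap-nonneg (≤-trans (x≤∣x∣ _) (≤-trans (∣re∣≤ One.approx) error₁≤⅛)))
      (trans (+-congʳ (sym re-sum₁)) (solve 3 (λ c s e → s :+ e := c :+ (e :- (c :- s))) refl (cos 1#) _ ⅛))

    cos1≥ : ½ - ⅛ ≤ cos 1#
    cos1≥ = by-nonneg (gap-nonneg (≤-trans (-x≤∣x∣ _) (≤-trans (∣re∣≤ One.approx) error₁≤⅛)))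
      (trans (solve 3 (λ c s e → c := s :- e :+ (e :- (:- (c :- s)))) refl (cos 1#) _ ⅛) (+-congʳ (+-congʳ re-sum₁)))

    ½⅛ : ½ ≈ ⅛ + ⅛ + ⅛ + ⅛
    ½⅛ = trans (solve 1 (λ h → h := :1 :* :1 :* h) refl ½) (trans (*-congʳ (*-cong (sym ½+½≈1) (sym ½+½≈1)))
      (solve 1 (λ h → (h :+ h) :* (h :+ h) :* h := h :* (h :* h) :+ h :* (h :* h) :+ h :* (h :* h) :+ h :* (h :* h)) refl ½))

    ⅛-pos : 0# < ⅛
    ⅛-pos = *-pos ½-pos (*-pos ½-pos ½-pos)

    cos1-pos : 0# < cos 1#
    cos1-pos = <-≤-trans (<-resp refl (trans (solve 1 (λ e → e :+ e :+ e := e :+ e :+ e :+ e :- e) refl ⅛) (+-congʳ (sym ½⅛)))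
      (+-pos (+-pos ⅛-pos ⅛-pos) ⅛-pos)) cos1≥

  sin-double : ∀ θ → sin (θ + θ) ≈ num 2 * (cos θ * sin θ)
  sin-double θ = trans (proj₂ (cis-+ θ θ)) (solve 2 (λ c s → c :* s :+ s :* c := :2 :* (c :* s)) refl (cos θ) (sin θ))

  cos-double : ∀ θ → cos (θ + θ) ≈ num 2 * (cos θ * cos θ) - 1#
  cos-double θ = trans (proj₁ (cis-+ θ θ)) (trans
    (solve 2 (λ c s → c :* c :- s :* s := :2 :* (c :* c) :- (c :* c :+ s :* s)) refl (cos θ) (sin θ))
    (+-congˡ (-‿cong (∥cis∥² θ))))

  private
    2# 4# : ℝ
    2# = 1# + 1#
    4# = 2# + 2#

    -- cos 1 ≤ ⅝, and 2 (⅝)² = 50/64 < 1.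
    cos2-neg : 0# < - cos 2#
    cos2-neg = <-≤-trans (*-pos (num-pos 13) (*-pos ⅛-pos ⅛-pos)) (≤-resp refl (-‿cong (sym (cos-double 1#)))
      (by-nonneg (*-nonneg (num-nonneg 2) (gap-nonneg (square-mono-≤ (<⇒≤ cos1-pos) (≤-trans cos1≤ (≤-reflexive (+-congʳ ½⅛))))))
        (trans (-‿cong (+-congˡ (-‿cong (sym 1≈64)))) (solve 2 (λ c e → :- (:2 :* (c :* c) :- con (+ 64) :* (e :* e)) :=
          con (+ 14) :* (e :* e) :+ :2 :* ((e :+ e :+ e :+ e :+ e) :* (e :+ e :+ e :+ e :+ e) :- c :* c)) refl (cos 1#) ⅛))))
      where
      1≈64 = trans (solve 1 (λ e → con (+ 64) :* (e :* e) := (e :+ e :+ e :+ e :+ (e :+ e :+ e :+ e)) :* (e :+ e :+ e :+ e :+ (e :+ e :+ e :+ e))) refl ⅛)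
        (trans (*-cong 8⅛≈1 8⅛≈1) (*-identityˡ 1#))
        where
        8⅛≈1 : ⅛ + ⅛ + ⅛ + ⅛ + (⅛ + ⅛ + ⅛ + ⅛) ≈ 1#
        8⅛≈1 = trans (+-cong (sym ½⅛) (sym ½⅛)) ½+½≈1

    -- By doubling twice, sin 4 = 4 sin 1 cos 1 cos 2, where only cos 2 is negative.
    sin4-neg : 0# < - sin 4#
    sin4-neg = <-resp refl (trans (solve 3 (λ c s d → :2 :* (:- d :* (:2 :* (c :* s))) := :- (:2 :* (d :* (:2 :* (c :* s))))) refl (cos 1#) (sin 1#) (cos 2#))
        (-‿cong (trans (*-congˡ (*-congˡ (sym (sin-double 1#)))) (sym (sin-double 2#)))))
      (*-pos (num-pos 1) (*-pos cos2-neg (*-pos (num-pos 1) (*-pos cos1-pos (sin-pos≤1 0<1 ≤-refl)))))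

    -- π is obtained as the supremum of these `s`: 1 is among them by the cubic estimate, and sin 4
    -- < 0 bounds them by 4.
    SinPositive : ℝ → Set
    SinPositive s = ∀ r → 0# < r → r ≤ s → 0# < sin r

    sin-not-positive-past-4 : UpperBound SinPositive 4#
    sin-not-positive-past-4 s pos = ≮⇒≥ λ 4<s → <⇒≱ sin4-neg
      (≤-resp refl -0#≈0# (neg-mono-≤ (<⇒≤ (pos 4# (+-pos 0<2 0<2) (<⇒≤ 4<s)))))
      where
      0<2 : 0# < 2#
      0<2 = +-pos 0<1 0<1

    sup-π = supremum SinPositive (1# , λ r 0<r r≤1 → sin-pos≤1 0<r r≤1) (4# , sin-not-positive-past-4)

  abstract
    π : ℝ
    π = proj₁ sup-π

    π-upper : UpperBound SinPositive π
    π-upper = proj₁ (proj₂ sup-π)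

    π-least : ∀ b → UpperBound SinPositive b → π ≤ b
    π-least = proj₂ (proj₂ sup-π)

    π≤4 : π ≤ num 4
    π≤4 = ≤-trans (π-least 4# sin-not-positive-past-4)
      (≤-reflexive (solve 0 (:1 :+ :1 :+ (:1 :+ :1) := con (+ 4)) refl))

  0<π : 0# < π
  0<π = <-≤-trans 0<1 (π-upper 1# λ r 0<r r≤1 → sin-pos≤1 0<r r≤1)

  -- Otherwise `θ` would be an upper bound of `SinPositive` smaller than the least one.
  sin-pos : ∀ {θ} → 0# < θ → θ < π → 0# < sin θ
  sin-pos {θ} 0<θ θ<π = decidable-stable em λ sin≯0 → <⇒≱ θ<π (π-least θ λ s pos →
    [ (λ θ<s → ⊥-elim (sin≯0 (pos θ 0<θ (<⇒≤ θ<s)))) , (λ s≤θ → s≤θ) ]′ (<-or-≥ θ s))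

  sin-lipschitz : ∀ a b → ∣ sin a - sin b ∣ ≤ num 2 * ∣ a - b ∣
  sin-lipschitz a b = ∣im∣≤ (cis-lipschitz a b)

  -- Both signs are excluded by Lipschitz continuity: sin π is at least sin (π - d) - 2 d with sin
  -- (π - d) > 0 for small `d`, and a positive value at π would keep sine positive beyond π.
  sin-π : sin π ≈ 0#
  sin-π = ≤-antisym (≮⇒≥ λ 0<sin → <⇒≱ (beyond-π 0<sin) (π-upper _ (positive-beyond 0<sin)))
    (≤-resp (solve 1 (λ x → :- (:- x) := x) refl 0#) (solve 1 (λ x → :- (:- x) := x) refl (sin π)) (neg-mono-≤ (≤-trans nonneg (≤-reflexive (sym -0#≈0#)))))
    where
    nonneg : - sin π ≤ 0#
    nonneg = ≤-by-½^ π λ n →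
      -- Chosen so that the Lipschitz error 2 d is π · ½^ n.
      let d = π * ½^ (suc n)
          0<d = *-pos 0<π (½^-pos (suc n))
          d<π : d < π
          d<π = <-resp refl (*-identityʳ π) (*-monoˡ-< 0<π (<-≤-trans (by-pos (½^-pos (suc n)) (sym (½^-double n))) (½^-≤1 n)))
          ∣π-d-π∣ : ∣ π - d - π ∣ ≈ d
          ∣π-d-π∣ = trans (∣∣-cong (solve 2 (λ p d → p :- d :- p := :- d) refl π d)) (trans (∣-x∣≈∣x∣ d) (∣∣-nonneg-≈ (<⇒≤ 0<d)))
      in by-nonneg
        (+-nonneg (<⇒≤ (sin-pos (gap-pos d<π) (by-pos 0<d (solve 2 (λ p d → p := p :- d :+ d) refl π d))))
                  (gap-nonneg (≤-trans (x≤∣x∣ _) (≤-resp refl (*-congˡ ∣π-d-π∣) (sin-lipschitz (π - d) π)))))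
        (trans (*-congˡ (sym (½^-double n)))
          (solve 4 (λ p h s t → p :* (h :+ h) := :- t :+ (s :+ (:2 :* (p :* h) :- (s :- t)))) refl π (½^ (suc n)) (sin (π - d)) (sin π)))

    -- With Lipschitz constant 2, sine loses at most half of `sin π` over a distance of a quarter of
    -- `sin π`.
    beyond : ℝ
    beyond = π + ½ * (½ * sin π)
    beyond-π : 0# < sin π → π < beyond
    beyond-π 0<sin = by-pos (*-pos ½-pos (*-pos ½-pos 0<sin)) refl
    positive-beyond : 0# < sin π → SinPositive beyond
    positive-beyond 0<sin r 0<r r≤ = [ sin-pos 0<r , past ]′ (<-or-≥ r π)
      where
      past : π ≤ r → 0# < sin r
      past π≤r = <-≤-trans (*-pos ½-pos 0<sin) (by-nonneg
        (+-nonneg (gap-nonneg (≤-trans (x≤∣x∣ _) (≤-resp (∣x-y∣≈∣y-x∣ _ _) (*-congˡ (∣∣-nonneg-≈ (gap-nonneg π≤r))) (sin-lipschitz r π))))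
                  (*-nonneg (num-nonneg 2) (gap-nonneg r≤)))
        (trans (solve 4 (λ p r s t → s := t :- :2 :* (r :- p) :+ (:2 :* (r :- p) :- (t :- s))) refl π r (sin r) (sin π))
        (trans (+-congʳ (trans (+-congʳ (trans (sym (*-identityˡ _)) (*-congʳ (sym (trans (*-cong ½+½≈1 ½+½≈1) (*-identityˡ 1#))))))
            (trans (solve 4 (λ h t r p → (h :+ h) :* (h :+ h) :* t :- :2 :* (r :- p) := (h :+ h) :* (h :* t) :+ :2 :* (p :+ h :* (h :* t) :- r)) refl ½ (sin π) r π)
              (+-congʳ (trans (*-congʳ ½+½≈1) (*-identityˡ _))))))
          (solve 3 (λ a b c → a :+ b :+ c := a :+ (c :+ b)) refl _ _ _))))

  π-isPi : IsPi π
  π-isPi = 0<π , (cis π , cis-isCis π , sin-π) , λ θ 0<θ θ<π w isCis im≈0 →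
    <⇒≉ (sin-pos 0<θ θ<π) (sym (trans (sym (proj₂ (cis-unique isCis))) im≈0))

-- The unit circle, and counting roots of unity in a disc.

module Circle (em : ExcludedMiddle 0ℓ) (𝓡 : CompleteOrderedField) where
  open Analysis 𝓡
  open OrderedField em 𝓡
  open Series em 𝓡
  open Complex em 𝓡
  open Exponential em 𝓡
  open Trigonometry em 𝓡

  private
    ½π : ℝ
    ½π = ½ * π

    ½π+½π : ½π + ½π ≈ π
    ½π+½π = trans (sym (distribʳ π ½ ½)) (trans (*-congʳ ½+½≈1) (*-identityˡ π))

    0<½π : 0# < ½π
    0<½π = *-pos ½-pos 0<π

    ½π<π : ½π < π
    ½π<π = by-pos 0<½π (sym ½π+½π)

    sin-½π-pos : 0# < sin ½π
    sin-½π-pos = sin-pos 0<½π ½π<π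

    -- From 0 = sin π = 2 cos ½π sin ½π, where sin ½π is positive.
    cos-½π : cos ½π ≈ 0#
    cos-½π = [ (λ 2≈0 → ⊥-elim (>0⇒≉0 (num-pos 1) 2≈0))
             , (λ cs≈0 → [ (λ c≈0 → c≈0) , (λ s≈0 → ⊥-elim (>0⇒≉0 sin-½π-pos s≈0)) ]′ (*-zero-product cs≈0)) ]′
      (*-zero-product (trans (sym (sin-double ½π)) (trans (proj₂ (cis-cong ½π+½π)) sin-π)))

    sin-½π : sin ½π ≈ 1#
    sin-½π = [ (λ s-1≈0 → trans (solve 1 (λ s → s := s :- :1 :+ :1) refl (sin ½π)) (trans (+-congʳ s-1≈0) (+-identityˡ 1#)))
             , (λ s+1≈0 → ⊥-elim (>0⇒≉0 (+-pos sin-½π-pos 0<1) s+1≈0)) ]′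
      (*-zero-product (begin
        (sin ½π - 1#) * (sin ½π + 1#)  ≈⟨ solve 1 (λ s → (s :- :1) :* (s :+ :1) := :0 :* :0 :+ s :* s :- :1) refl (sin ½π) ⟩
        0# * 0# + sin ½π * sin ½π - 1#  ≈⟨ +-congʳ (+-congʳ (*-cong cos-½π cos-½π)) ⟨
        ∥ cis ½π ∥² - 1#  ≈⟨ +-congʳ (∥cis∥² ½π) ⟩
        1# - 1#  ≈⟨ -‿inverseʳ 1# ⟩
        0#  ∎))
      where open ≈-Reasoning

    cis-½π : cis ½π ≈ᶜ (0# +i 1#)
    cis-½π = cos-½π , sin-½π

    cis-π : cis π ≈ᶜ -ᶜ 1ᶜ
    cis-π = transᶜ (cis-cong (sym ½π+½π)) (transᶜ (cis-+ ½π ½π) (transᶜ (ℂR.*-cong cis-½π cis-½π)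
      ( solve 0 (:0 :* :0 :- :1 :* :1 := :- :1) refl
      , solve 0 (:0 :* :1 :+ :1 :* :0 := :- :0) refl )))

    2·π≈ : 2 · π ≈ π + π
    2·π≈ = +-congˡ (+-identityʳ π)

    sin-nonneg : ∀ {θ} → 0# ≤ θ → θ < π → 0# ≤ sin θ
    sin-nonneg (inj₁ 0<θ) θ<π = <⇒≤ (sin-pos 0<θ θ<π)
    sin-nonneg (inj₂ 0≈θ) θ<π = ≤-reflexive (sym (trans (proj₂ (cis-cong (sym 0≈θ))) (proj₂ cis-0)))

  abstract
    e : ℝ → ℂ
    e t = cis (2 · π * t)

    e-isUnitCircle : ∀ t → IsUnitCircle t (e t)
    e-isUnitCircle t = π , π-isPi , cis-isCis (2 · π * t)

    e-cong : ∀ {s t} → s ≈ t → e s ≈ᶜ e t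
    e-cong s≈t = cis-cong (*-congˡ s≈t)

    e-+ : ∀ s t → e (s + t) ≈ᶜ e s *ᶜ e t
    e-+ s t = transᶜ (cis-cong (distribˡ _ s t)) (cis-+ _ _)

    e-0 : e 0# ≈ᶜ 1ᶜ
    e-0 = transᶜ (cis-cong (zeroʳ _)) cis-0

    e-1 : e 1# ≈ᶜ 1ᶜ
    e-1 = transᶜ (cis-cong (trans (*-identityʳ _) 2·π≈)) (transᶜ (cis-+ π π) (transᶜ (ℂR.*-cong cis-π cis-π)
      (solveᶜ 0 ((:-ᶜ :1ᶜ) :*ᶜ (:-ᶜ :1ᶜ) :=ᶜ :1ᶜ) reflᶜ)))

    e-neg : ∀ t → e (- t) ≈ᶜ conj (e t)
    e-neg t = transᶜ (cis-cong (solve 2 (λ p t → p :* (:- t) := :- (p :* t)) refl _ t)) (cis-neg _)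

    ∥e∥² : ∀ t → ∥ e t ∥² ≈ 1#
    ∥e∥² t = ∥cis∥² _

    e-lipschitz : ∀ s t → e s -ᶜ e t ⊑ num 16 * ∣ s - t ∣
    e-lipschitz s t = ⊑-weaken (begin
        num 2 * ∣ 2 · π * s - 2 · π * t ∣  ≈⟨ *-congˡ (∣∣-cong (solve 3 (λ p s t → p :* s :- p :* t := (s :- t) :* p) refl (2 · π) s t)) ⟩
        num 2 * ∣ (s - t) * (2 · π) ∣  ≈⟨ *-congˡ (∣x*y∣≈∣x∣*y (s - t) 0≤2π) ⟩
        num 2 * (∣ s - t ∣ * (2 · π))  ≤⟨ *-monoˡ-≤ (num-nonneg 2) (*-monoˡ-≤ (∣∣-nonneg _) 2π≤8) ⟩
        num 2 * (∣ s - t ∣ * (num 4 + num 4))  ≈⟨ solve 1 (λ x → :2 :* (x :* (con (+ 4) :+ con (+ 4))) := con (+ 16) :* x) refl ∣ s - t ∣ ⟩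
        num 16 * ∣ s - t ∣  ∎)
      (cis-lipschitz _ _)
      where
      open ≤-Reasoning
      0≤2π : 0# ≤ 2 · π
      0≤2π = ≤-resp refl (sym 2·π≈) (+-nonneg (<⇒≤ 0<π) (<⇒≤ 0<π))
      2π≤8 : 2 · π ≤ num 4 + num 4
      2π≤8 = ≤-resp (sym 2·π≈) refl (+-mono-≤ π≤4 π≤4)

    -- cis (½π + φ) = i cis φ has real part - sin φ.
    re-e-nonpos : ∀ {s} → ½^ 2 ≤ s → s ≤ ½ → re (e s) ≤ 0#
    re-e-nonpos {s} ¼≤s s≤½ = ≤-resp
      (sym (trans (proj₁ (cis-cong split)) (trans (proj₁ (cis-+ ½π φ)) (trans (proj₁ (ℂR.*-congʳ {x = cis φ} cis-½π))
        (solve 2 (λ c s → :0 :* c :- :1 :* s := :- s) refl (cos φ) (sin φ))))))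
      -0#≈0# (neg-mono-≤ (sin-nonneg 0≤φ φ<π))
      where
      φ : ℝ
      φ = (π + π) * (s - ½^ 2)
      ¼+¼≈½ : ½^ 2 + ½^ 2 ≈ ½
      ¼+¼≈½ = trans (½^-double 1) (*-identityʳ ½)
      split : 2 · π * s ≈ ½π + φ
      split = trans (*-congʳ 2·π≈) (trans (solve 3 (λ p s q → (p :+ p) :* s := (q :+ q) :* p :+ (p :+ p) :* (s :- q)) refl π s (½^ 2))
        (+-congʳ (*-congʳ ¼+¼≈½)))
      0≤φ : 0# ≤ φ
      0≤φ = *-nonneg (+-nonneg (<⇒≤ 0<π) (<⇒≤ 0<π)) (gap-nonneg ¼≤s)
      φ<π : φ < π
      φ<π = ≤-<-trans (≤-trans (*-monoˡ-≤ (+-nonneg (<⇒≤ 0<π) (<⇒≤ 0<π)) (+-monoˡ-≤ (- ½^ 2) s≤½))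
        (≤-reflexive (trans (*-congˡ (+-congʳ (sym ¼+¼≈½))) (trans (solve 2 (λ p q → (p :+ p) :* (q :+ q :- q) := (q :+ q) :* p) refl π (½^ 2)) (*-congʳ ¼+¼≈½)))))
        ½π<π

    im-e-pos : ∀ {t} → 0# < t → t < ½ → 0# < im (e t)
    im-e-pos {t} 0<t t<½ = sin-pos (*-pos (<-resp refl (sym 2·π≈) (+-pos 0<π 0<π)) 0<t)
      (<-resp refl (trans (*-congʳ 2·π≈) (trans (solve 2 (λ p h → (p :+ p) :* h := (h :+ h) :* p) refl π ½) (trans (*-congʳ ½+½≈1) (*-identityˡ π))))
        (*-monoˡ-< (<-resp refl (sym 2·π≈) (+-pos 0<π 0<π)) t<½))

  e-⊑1 : ∀ t → e t ⊑ 1#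
  e-⊑1 t = bounded 0≤1 (≤-reflexive (trans (∥e∥² t) (sym (*-identityˡ 1#))))

  e-conj : ∀ t → e t *ᶜ conj (e t) ≈ᶜ 1ᶜ
  e-conj t = transᶜ (conj-inverse (e t)) (fromℝ-cong (∥e∥² t))

  e-num : ∀ m → e (num m) ≈ᶜ 1ᶜ
  e-num zero    = e-0
  e-num (suc m) = transᶜ (e-cong (num-suc m)) (transᶜ (e-+ _ _) (transᶜ (ℂR.*-cong e-1 (e-num m)) (ℂR.*-identityˡ 1ᶜ)))

  e-1- : ∀ t → e (1# - t) ≈ᶜ conj (e t)
  e-1- t = transᶜ (e-+ 1# (- t)) (transᶜ (ℂR.*-cong e-1 (e-neg t)) (ℂR.*-identityˡ _))

  -- These are the zeros of `im (e t)` on the unit interval; the half above ½ is reflected by t ↦ 1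
  -- - t. All three are grid points of every level, which is how the lemma is applied.
  e≈-1 : ∀ {t} → 0# ≤ t → t ≤ 1# → e t ≈ᶜ -ᶜ 1ᶜ → t ≈ 0# ⊎ t ≈ ½ ⊎ t ≈ 1#
  e≈-1 {t} 0≤t t≤1 e≈-1 = cases (Order.compare t ½) 0≤t t≤1
    where
    im≈0 : im (e t) ≈ 0#
    im≈0 = trans (proj₂ e≈-1) -0#≈0#
    cases : _ → 0# ≤ t → t ≤ 1# → t ≈ 0# ⊎ t ≈ ½ ⊎ t ≈ 1#
    cases (tri≈ _ t≈½ _) _ _ = inj₂ (inj₁ t≈½)
    cases (tri< t<½ _ _) (inj₂ 0≈t) _ = inj₁ (sym 0≈t)
    cases (tri< t<½ _ _) (inj₁ 0<t) _ = ⊥-elim (>0⇒≉0 (im-e-pos 0<t t<½) im≈0)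
    cases (tri> _ _ ½<t) _ (inj₂ t≈1) = inj₂ (inj₂ t≈1)
    cases (tri> _ _ ½<t) _ (inj₁ t<1) = ⊥-elim (>0⇒≉0
      (im-e-pos (gap-pos t<1) (by-pos (gap-pos ½<t) (trans (solve 2 (λ h t → h := h :+ h :- t :+ (t :- h)) refl ½ t) (+-congʳ (+-congʳ ½+½≈1)))))
      (trans (proj₂ (e-1- t)) (trans (-‿cong im≈0) -0#≈0#)))

  ∥e-1∥²-far : ∀ {s} → ½^ 2 ≤ s → s ≤ ½ → 1# ≤ ∥ e s -ᶜ 1ᶜ ∥²
  ∥e-1∥²-far {s} ¼≤s s≤½ = by-nonneg (+-nonneg 0≤1 (*-nonneg (num-nonneg 2) (neg-nonneg (re-e-nonpos ¼≤s s≤½))))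
    (trans (solve 2 (λ a b → (a :+ :- :1) :* (a :+ :- :1) :+ (b :+ :- :0) :* (b :+ :- :0) :=
        a :* a :+ b :* b :+ (:1 :+ :2 :* (:- a))) refl (re (e s)) (im (e s)))
      (+-congʳ (∥e∥² s)))

  ∥e-1∥²-double : ∀ s → ∥ e (s + s) -ᶜ 1ᶜ ∥² ≤ num 4 * ∥ e s -ᶜ 1ᶜ ∥²
  ∥e-1∥²-double s = begin
    ∥ e (s + s) -ᶜ 1ᶜ ∥²  ≈⟨ ∥∥²-cong (ℂR.+-congʳ (e-+ s s)) ⟩
    ∥ e s *ᶜ e s -ᶜ 1ᶜ ∥²  ≈⟨ ∥∥²-cong (solveᶜ 1 (λ z → z :*ᶜ z :-ᶜ :1ᶜ :=ᶜ (z :+ᶜ :1ᶜ) :*ᶜ (z :-ᶜ :1ᶜ)) reflᶜ (e s)) ⟩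
    ∥ (e s +ᶜ 1ᶜ) *ᶜ (e s -ᶜ 1ᶜ) ∥²  ≈⟨ ∥∥²-* _ _ ⟩
    ∥ e s +ᶜ 1ᶜ ∥² * ∥ e s -ᶜ 1ᶜ ∥²  ≤⟨ *-monoʳ-≤ (∥∥²-nonneg _) (≤-trans (∥∥²-≤ (⊑-+ (e-⊑1 s) (⊑-fromℝ 0≤1)))
                                                    (≤-reflexive (solve 0 ((:1 :+ :1) :* (:1 :+ :1) := con (+ 4)) refl))) ⟩
    num 4 * ∥ e s -ᶜ 1ᶜ ∥²  ∎
    where open ≤-Reasoning

  ½^-square : ∀ a → ½^ a * ½^ a ≈ num 4 * (½^ (suc a) * ½^ (suc a))
  ½^-square a = trans (*-cong (sym (½^-double a)) (sym (½^-double a)))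
    (solve 1 (λ x → (x :+ x) :* (x :+ x) := con (+ 4) :* (x :* x)) refl (½^ (suc a)))

  -- By doubling: |e (s + s) - 1| ≤ 2 |e s - 1|.
  ∥e-1∥²-near : ∀ a {s} → 0# ≤ s → s ≤ ½ → ∥ e s -ᶜ 1ᶜ ∥² < ½^ a * ½^ a → s < ½^ (2 ℕ.+ a)
  ∥e-1∥²-near zero {s} 0≤s s≤½ near = ≰⇒> λ ¼≤s →
    <⇒≱ (<-resp refl (*-identityˡ 1#) near) (∥e-1∥²-far ¼≤s s≤½)
  ∥e-1∥²-near (suc a) {s} 0≤s s≤½ near = *-cancelˡ-< (num-nonneg 2) (<-resp
    (solve 1 (λ s → s :+ s := :2 :* s) refl s)
    (trans (sym (½^-double (2 ℕ.+ a))) (solve 1 (λ s → s :+ s := :2 :* s) refl (½^ (3 ℕ.+ a))))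
    (∥e-1∥²-near a (+-nonneg 0≤s 0≤s)
      (≤-resp refl (trans (½^-double 1) (*-identityʳ ½)) (+-mono-≤ (<⇒≤ s<¼) (<⇒≤ s<¼)))
      (≤-<-trans (∥e-1∥²-double s) (<-resp refl (sym (½^-square a)) (*-monoˡ-< (num-pos 3) near)))))
    where
    s<¼ : s < ½^ 2
    s<¼ = ∥e-1∥²-near 0 0≤s s≤½ (<-≤-trans near (square-mono-≤ (½^-nonneg (suc a)) (½^-≤1 (suc a))))

  -- Iverson bracket, so that counting becomes summation.
  [_<_] : ℝ → ℝ → ℝ
  [ x < y ] = if does (Order._<?_ x y) then 1# else 0#

  [<]-true : ∀ {x y} → x < y → [ x < y ] ≈ 1#
  [<]-true {x} {y} x<y with Order._<?_ x y
  ... | yes _  = refl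
  ... | no x≮y = ⊥-elim (x≮y x<y)

  [<]-false : ∀ {x y} → ¬ (x < y) → [ x < y ] ≈ 0#
  [<]-false {x} {y} x≮y with Order._<?_ x y
  ... | yes x<y = ⊥-elim (x≮y x<y)
  ... | no _    = refl

  [<]-mono : ∀ {x y x′ y′} → (x < y → x′ < y′) → [ x < y ] ≤ [ x′ < y′ ]
  [<]-mono {x} {y} {x′} {y′} imp with Order._<?_ x y | Order._<?_ x′ y′
  ... | no _    | no _    = ≤-refl
  ... | no _    | yes _   = 0≤1
  ... | yes x<y | no ¬p   = ⊥-elim (¬p (imp x<y))
  ... | yes _   | yes _   = ≤-refl

  [<]-nonneg : ∀ x y → 0# ≤ [ x < y ]
  [<]-nonneg x y with Order._<?_ x y
  ... | no _  = ≤-refl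
  ... | yes _ = 0≤1

  [<]-≤1 : ∀ x y → [ x < y ] ≤ 1#
  [<]-≤1 x y with Order._<?_ x y
  ... | no _  = 0≤1
  ... | yes _ = ≤-refl


  Periodic : ℕ → (ℕ → ℝ) → Set
  Periodic N g = ∀ i → g (i ℕ.+ N) ≈ g i

  Σ<-shift : ∀ N k {g} → Periodic N g → Σ< N (λ i → g (i ℕ.+ k)) ≈ Σ< N g
  Σ<-shift N zero    {g} per = Σ<-cong N {λ i → g (i ℕ.+ 0)} {g} λ i → reflexive (≡.cong g (ℕ.+-identityʳ i))
  Σ<-shift N (suc k) {g} per = begin
    Σ< N (λ i → g (i ℕ.+ suc k))  ≈⟨ Σ<-cong N {λ i → g (i ℕ.+ suc k)} {λ i → g′ (suc i)} (λ i → reflexive (≡.cong g (ℕ.+-suc i k))) ⟩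
    Σ< N (g′ ∘ suc)  ≈⟨ solve 2 (λ x y → y := x :+ y :- x) refl (g′ 0) _ ⟩
    g′ 0 + Σ< N (g′ ∘ suc) - g′ 0  ≈⟨ +-cong (Σ<-snoc N g′) (-‿cong g′-wraps) ⟩
    Σ< N g′ + g′ N - g′ N  ≈⟨ solve 2 (λ x y → x :+ y :- y := x) refl (Σ< N g′) (g′ N) ⟩
    Σ< N g′  ≈⟨ Σ<-shift N k per ⟩
    Σ< N g  ∎
    where
    open ≈-Reasoning
    g′ : ℕ → ℝ
    g′ i = g (i ℕ.+ k)
    g′-wraps : g′ 0 ≈ g′ N
    g′-wraps = trans (sym (per k)) (reflexive (≡.cong g (ℕ.+-comm k N)))

  Σ<-reverse : ∀ N g → Σ< N (λ i → g (N ℕ.∸ suc i)) ≈ Σ< N g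
  Σ<-reverse zero    g = refl
  Σ<-reverse (suc N) g = trans (+-congˡ (Σ<-reverse N g)) (trans (+-comm _ _) (sym (Σ<-snoc N g)))

  module Roots (n : ℕ) where
    N : ℕ
    N = 2 ℕ.^ n

    ζ : ℕ → ℂ
    ζ i = e (num i * ½^ n)

    numN*½^ : num N * ½^ n ≈ 1#
    numN*½^ = num2^*½^ n

    ζ-+ : ∀ i j → ζ (i ℕ.+ j) ≈ᶜ ζ i *ᶜ ζ j
    ζ-+ i j = transᶜ (e-cong (trans (*-congʳ (num-+ i j)) (distribʳ _ _ _))) (e-+ _ _)

    ζ-*N : ∀ k → ζ (k ℕ.* N) ≈ᶜ 1ᶜ
    ζ-*N k = transᶜ (e-cong (trans (*-congʳ (num-* k N)) (trans (*-assoc _ _ _) (trans (*-congˡ numN*½^) (*-identityʳ _))))) (e-num k)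

    ζ-N : ζ N ≈ᶜ 1ᶜ
    ζ-N = transᶜ (e-cong numN*½^) e-1

    ζ-periodic : ∀ i → ζ (i ℕ.+ N) ≈ᶜ ζ i
    ζ-periodic i = transᶜ (ζ-+ i N) (transᶜ (ℂR.*-congˡ ζ-N) (ℂR.*-identityʳ _))

    ∥ζ∥² : ∀ i → ∥ ζ i ∥² ≈ 1#
    ∥ζ∥² i = ∥e∥² _

    ζ-conj : ∀ i → ζ i *ᶜ conj (ζ i) ≈ᶜ 1ᶜ
    ζ-conj i = e-conj _

    ζ-inverse : ∀ {i j} → ζ (i ℕ.+ j) ≈ᶜ 1ᶜ → ζ j ≈ᶜ conj (ζ i)
    ζ-inverse {i} {j} eq = begin
      ζ j  ≈⟨ ℂR.*-identityˡ _ ⟨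
      1ᶜ *ᶜ ζ j  ≈⟨ ℂR.*-congʳ (ζ-conj i) ⟨
      ζ i *ᶜ conj (ζ i) *ᶜ ζ j  ≈⟨ solveᶜ 3 (λ z c w → z :*ᶜ c :*ᶜ w :=ᶜ z :*ᶜ w :*ᶜ c) reflᶜ (ζ i) (conj (ζ i)) (ζ j) ⟩
      ζ i *ᶜ ζ j *ᶜ conj (ζ i)  ≈⟨ ℂR.*-congʳ (transᶜ (symᶜ (ζ-+ i j)) eq) ⟩
      1ᶜ *ᶜ conj (ζ i)  ≈⟨ ℂR.*-identityˡ _ ⟩
      conj (ζ i)  ∎
      where open ≈ᶜ-Reasoning

    -- The disc has centre `-c`, which suits the expressions 1 + x, x + y and (1 + x + y) + z.
    near : ℂ → ℕ → ℕ → ℝ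
    near c a k = [ ∥ c +ᶜ ζ k ∥² < ½^ a * ½^ a ]

    near-periodic : ∀ c a → Periodic N (near c a)
    near-periodic c a i = ≤-antisym
      ([<]-mono (<-resp (∥∥²-cong (ℂR.+-congˡ (ζ-periodic i))) refl))
      ([<]-mono (<-resp (∥∥²-cong (ℂR.+-congˡ (symᶜ (ζ-periodic i)))) refl))

    private
      -- Index 2ᵏ is the parameter ½^ (2 + a), from which on `∥e-1∥²-near` excludes points of the
      -- disc; parameters above ½ are reflected by e (1 - t) = conj (e t).
      ζ-far-from-1 : ∀ a k → n ≡ 2 ℕ.+ a ℕ.+ k → ∀ j → 2 ℕ.^ k ℕ.≤ j → j ℕ.+ 2 ℕ.^ k ℕ.≤ N →
        ¬ (∥ -ᶜ 1ᶜ +ᶜ ζ j ∥² < ½^ a * ½^ a)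
      ζ-far-from-1 a k n≡ j M≤j j+M≤N close = [ left , right ]′ (≤-total s ½)
        where
        s = num j * ½^ n
        M = 2 ℕ.^ k
        M/N : num M * ½^ n ≈ ½^ (2 ℕ.+ a)
        M/N = trans (*-congˡ (trans (reflexive (≡.cong ½^ n≡)) (½^-+ (2 ℕ.+ a) k)))
          (trans (solve 3 (λ m x y → m :* (x :* y) := m :* y :* x) refl _ _ _) (trans (*-congʳ (num2^*½^ k)) (*-identityˡ _)))
        close′ : ∥ e s -ᶜ 1ᶜ ∥² < ½^ a * ½^ a
        close′ = <-resp (∥∥²-cong (ℂR.+-comm _ _)) refl close
        left : s ≤ ½ → ⊥
        left s≤½ = <⇒≱ (∥e-1∥²-near a (*-nonneg (num-nonneg j) (½^-nonneg n)) s≤½ close′)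
          (≤-resp M/N refl (*-monoʳ-≤ (½^-nonneg n) (num-mono-≤ M≤j)))
        1-s : num (N ℕ.∸ j) * ½^ n ≈ 1# - s
        1-s = begin
          num (N ℕ.∸ j) * ½^ n  ≈⟨ solve 3 (λ x j h → x :* h := (j :+ x) :* h :- j :* h) refl (num (N ℕ.∸ j)) (num j) (½^ n) ⟩
          (num j + num (N ℕ.∸ j)) * ½^ n - s  ≈⟨ +-congʳ (*-congʳ (num-+ j (N ℕ.∸ j))) ⟨
          num (j ℕ.+ (N ℕ.∸ j)) * ½^ n - s  ≡⟨ ≡.cong (λ x → num x * ½^ n - s) (ℕ.m+[n∸m]≡n (ℕ.≤-trans (ℕ.m≤m+n j M) j+M≤N)) ⟩
          num N * ½^ n - s  ≈⟨ +-congʳ numN*½^ ⟩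
          1# - s  ∎
          where open ≈-Reasoning
        right : ½ ≤ s → ⊥
        right ½≤s = <⇒≱ (∥e-1∥²-near a
            (≤-resp refl 1-s (*-nonneg (num-nonneg (N ℕ.∸ j)) (½^-nonneg n)))
            (by-nonneg (gap-nonneg ½≤s) (trans (solve 2 (λ h s → h := h :+ h :- s :+ (s :- h)) refl ½ s) (+-congʳ (+-congʳ ½+½≈1))))
            (<-resp (trans (sym (∥∥²-conj _)) (∥∥²-cong (transᶜ (refl , solve 1 (λ b → :- (b :+ :- :0) := :- b :+ :- :0) refl _) (ℂR.+-congʳ (symᶜ (e-1- s)))))) refl close′))
          (≤-resp M/N 1-s (*-monoʳ-≤ (½^-nonneg n) (num-mono-≤ (ℕ.m+n≤o⇒m≤o∸n M (ℕ.≤-trans (ℕ.≤-reflexive (ℕ.+-comm M j)) j+M≤N)))))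

    -- Only the first `M` and the last `M` indices can be counted, where 2 M = N · ½^ (a + 1); the
    -- `L` indices between them are too far from 1.
    near-1-count : ∀ a → 2 ℕ.+ a ℕ.≤ n → Σ< N (near (-ᶜ 1ᶜ) a) ≤ num N * ½^ (suc a)
    near-1-count a 2+a≤n = begin
      Σ< N f  ≡⟨ ≡.cong (λ x → Σ< x f) N≡ ⟩
      Σ< (M ℕ.+ (L ℕ.+ M)) f  ≈⟨ Σ<-split M (L ℕ.+ M) f ⟩
      Σ< M f + Σ< (L ℕ.+ M) (λ i → f (M ℕ.+ i))  ≈⟨ +-congˡ (Σ<-split L M (λ i → f (M ℕ.+ i))) ⟩
      Σ< M f + (Σ< L (λ i → f (M ℕ.+ i)) + Σ< M (λ i → f (M ℕ.+ (L ℕ.+ i))))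
        ≤⟨ +-mono-≤ (Σ<-≤ f (λ _ → [<]-≤1 _ _)) (+-mono-≤ (≤-reflexive middle) (Σ<-≤ (λ i → f (M ℕ.+ (L ℕ.+ i))) (λ _ → [<]-≤1 _ _))) ⟩
      num M + (0# + num M)  ≈⟨ solve 1 (λ m → m :+ (:0 :+ m) := :2 :* m :* :1) refl (num M) ⟩
      num 2 * num M * 1#  ≈⟨ *-cong (num-* 2 M) (num2^*½^ (suc a)) ⟨
      num (2 ℕ.^ (suc k)) * (num (2 ℕ.^ suc a) * ½^ (suc a))  ≈⟨ *-assoc _ _ _ ⟨
      num (2 ℕ.^ (suc k)) * num (2 ℕ.^ suc a) * ½^ (suc a)  ≈⟨ *-congʳ (num-* (2 ℕ.^ (suc k)) (2 ℕ.^ suc a)) ⟨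
      num (2 ℕ.^ (suc k) ℕ.* 2 ℕ.^ suc a) * ½^ (suc a)  ≡⟨ ≡.cong (λ x → num x * ½^ (suc a)) N≡′ ⟩
      num N * ½^ (suc a)  ∎
      where
      open ≤-Reasoning
      f = near (-ᶜ 1ᶜ) a
      k = n ℕ.∸ (2 ℕ.+ a)
      M = 2 ℕ.^ k
      n≡ : n ≡ 2 ℕ.+ a ℕ.+ k
      n≡ = ≡.sym (ℕ.m+[n∸m]≡n 2+a≤n)
      N≡′ : 2 ℕ.^ (suc k) ℕ.* 2 ℕ.^ suc a ≡ N
      N≡′ = ≡.trans (≡.sym (ℕ.^-distribˡ-+-* 2 (suc k) (suc a)))
        (≡.cong (2 ℕ.^_) (≡.trans (≡.cong suc (≡.trans (ℕ.+-comm k (suc a)) ≡.refl)) (≡.sym n≡)))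
      2M≤N : M ℕ.+ M ℕ.≤ N
      2M≤N = ℕ.≤-trans (ℕ.≤-reflexive (≡.cong (M ℕ.+_) (≡.sym (ℕ.+-identityʳ M)))) (ℕ.^-monoʳ-≤ 2 {suc k} {n}
        (ℕ.≤-trans (ℕ.s≤s (ℕ.≤-trans (ℕ.m≤n+m k a) (ℕ.n≤1+n _))) (ℕ.≤-reflexive (≡.sym n≡))))
      L = N ℕ.∸ (M ℕ.+ M)
      N≡ : N ≡ M ℕ.+ (L ℕ.+ M)
      N≡ = ≡.sym (≡.trans (≡.cong (M ℕ.+_) (ℕ.+-comm L M)) (≡.trans (≡.sym (ℕ.+-assoc M M L)) (ℕ.m+[n∸m]≡n 2M≤N)))
      Σ<-≤ : ∀ g → (∀ i → g i ≤ 1#) → Σ< M g ≤ num M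
      Σ<-≤ g g≤1 = ≤-trans (Σ<-mono M {g} {λ _ → 1#} g≤1) (≤-reflexive (trans (sum-const M 1#) (*-identityʳ _)))
      middle : Σ< L (λ i → f (M ℕ.+ i)) ≈ 0#
      middle = sum-zero L λ i → [<]-false (ζ-far-from-1 a k n≡ (M ℕ.+ toℕ i) (ℕ.m≤m+n M (toℕ i))
        (ℕ.≤-trans (ℕ.≤-trans (ℕ.≤-reflexive (ℕ.+-assoc M (toℕ i) M)) (ℕ.+-monoʳ-≤ M (ℕ.+-monoˡ-≤ M (ℕ.<⇒≤ (Fin.toℕ<n i)))))
          (ℕ.≤-reflexive (≡.sym N≡))))

    -- If one point of the disc about -c is a root of unity, dividing by it moves the disc to one about 1 of twice the radius.
    near-count : ∀ c a → suc a ℕ.≤ n → Σ< N (near c a) ≤ num N * ½^ a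
    near-count c zero    _ = ≤-trans (Σ<-mono N {near c 0} {λ _ → 1#} (λ _ → [<]-≤1 _ _)) (≤-reflexive (sum-const N 1#))
    near-count c (suc a) 2+a≤n = cases em
      where
      cases : Dec (∃[ k ] ∥ c +ᶜ ζ k ∥² < ½^ (suc a) * ½^ (suc a)) → Σ< N (near c (suc a)) ≤ num N * ½^ (suc a)
      cases (no none) = ≤-trans (≤-reflexive (sum-zero N λ i → [<]-false λ p → none (toℕ i , p)))
        (*-nonneg (num-nonneg N) (½^-nonneg (suc a)))
      cases (yes (k₀ , close₀)) = ≤-trans
        (≤-trans (Σ<-mono N {near c (suc a)} {λ k → near (-ᶜ 1ᶜ) a (k ℕ.+ K)} moved)
          (≤-reflexive (Σ<-shift N K {near (-ᶜ 1ᶜ) a} (near-periodic (-ᶜ 1ᶜ) a))))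
        (near-1-count a 2+a≤n)
        where
        -- `ζ K` is the inverse of `ζ k₀`, since k₀ + k₀ (N - 1) is a multiple of N; subtraction of
        -- indices is avoided.
        K = k₀ ℕ.* ℕ.pred N
        ζK : ζ K ≈ᶜ conj (ζ k₀)
        ζK = ζ-inverse {k₀} {K} (transᶜ (ℂR.reflexive (≡.cong ζ (≡.trans (≡.sym (ℕ.*-suc k₀ (ℕ.pred N)))
          (≡.cong (k₀ ℕ.*_) (ℕ.suc-pred N {{ℕ.m^n≢0 2 n}}))))) (ζ-*N k₀))
        moved : ∀ k → near c (suc a) k ≤ near (-ᶜ 1ᶜ) a (k ℕ.+ K)
        moved k = [<]-mono λ close → <-resp refl (sym (½^-square a)) (≤-<-trans
          (≤-trans (≤-reflexive (begin
              ∥ -ᶜ 1ᶜ +ᶜ ζ (k ℕ.+ K) ∥²  ≈⟨ ∥∥²-cong (ℂR.+-cong (ℂR.-‿cong (symᶜ (ζ-conj k₀))) (transᶜ (ζ-+ k K) (ℂR.*-congˡ ζK))) ⟩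
              ∥ -ᶜ (ζ k₀ *ᶜ conj (ζ k₀)) +ᶜ ζ k *ᶜ conj (ζ k₀) ∥²  ≈⟨ ∥∥²-cong (solveᶜ 4 (λ z w x c → :-ᶜ (z :*ᶜ x) :+ᶜ w :*ᶜ x :=ᶜ ((c :+ᶜ w) :-ᶜ (c :+ᶜ z)) :*ᶜ x) reflᶜ (ζ k₀) (ζ k) (conj (ζ k₀)) c) ⟩
              ∥ ((c +ᶜ ζ k) -ᶜ (c +ᶜ ζ k₀)) *ᶜ conj (ζ k₀) ∥²  ≈⟨ ∥∥²-* ((c +ᶜ ζ k) -ᶜ (c +ᶜ ζ k₀)) (conj (ζ k₀)) ⟩
              ∥ (c +ᶜ ζ k) -ᶜ (c +ᶜ ζ k₀) ∥² * ∥ conj (ζ k₀) ∥²  ≈⟨ *-congˡ (trans (∥∥²-conj (ζ k₀)) (∥ζ∥² k₀)) ⟩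
              ∥ (c +ᶜ ζ k) -ᶜ (c +ᶜ ζ k₀) ∥² * 1#  ≈⟨ *-identityʳ _ ⟩
              ∥ (c +ᶜ ζ k) -ᶜ (c +ᶜ ζ k₀) ∥²  ∎))
            (parallelogram (c +ᶜ ζ k) (c +ᶜ ζ k₀)))
          (<-resp refl (solve 1 (λ x → :2 :* x :+ :2 :* x := con (+ 4) :* x) refl _)
            (+-mono-< (*-monoˡ-< (num-pos 1) close) (*-monoˡ-< (num-pos 1) close₀))))
          where
          open ≈-Reasoning
          parallelogram : ∀ z w → ∥ z -ᶜ w ∥² ≤ num 2 * ∥ z ∥² + num 2 * ∥ w ∥²
          parallelogram z w = by-nonneg (∥∥²-nonneg (z +ᶜ w))
            (solve 4 (λ a b c d → :2 :* (a :* a :+ b :* b) :+ :2 :* (c :* c :+ d :* d) :=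
              (a :+ :- c) :* (a :+ :- c) :+ (b :+ :- d) :* (b :+ :- d) :+ ((a :+ c) :* (a :+ c) :+ (b :+ d) :* (b :+ d))) refl (re z) (im z) (re w) (im w))

-- Truncated quotients.

module Truncation (em : ExcludedMiddle 0ℓ) (𝓡 : CompleteOrderedField) where
  open Analysis 𝓡
  open OrderedField em 𝓡
  open Series em 𝓡
  open Complex em 𝓡
  open Exponential em 𝓡
  open Circle em 𝓡

  -- Total: the junk value of `inv` makes `z ÷ p` zero at `p ≈ᶜ 0ᶜ`.
  infixl 7 _÷_
  _÷_ : ℂ → ℂ → ℂ
  z ÷ p = z *ᶜ conj p *ᶜ fromℝ (inv ∥ p ∥²)

  ÷-* : ∀ z {p} → 0# < ∥ p ∥² → (z ÷ p) *ᶜ p ≈ᶜ z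
  ÷-* z {p} 0<p = begin
    z *ᶜ conj p *ᶜ fromℝ (inv ∥ p ∥²) *ᶜ p  ≈⟨ solveᶜ 4 (λ z c i p → z :*ᶜ c :*ᶜ i :*ᶜ p :=ᶜ z :*ᶜ (p :*ᶜ c :*ᶜ i)) reflᶜ z (conj p) (fromℝ (inv ∥ p ∥²)) p ⟩
    z *ᶜ (p *ᶜ conj p *ᶜ fromℝ (inv ∥ p ∥²))  ≈⟨ ℂR.*-congˡ (ℂR.*-congʳ (conj-inverse p)) ⟩
    z *ᶜ (fromℝ ∥ p ∥² *ᶜ fromℝ (inv ∥ p ∥²))  ≈⟨ ℂR.*-congˡ (transᶜ (symᶜ (fromℝ-* _ _)) (fromℝ-cong (inv-inverseʳ (>0⇒≉0 0<p)))) ⟩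
    z *ᶜ 1ᶜ  ≈⟨ ℂR.*-identityʳ z ⟩
    z  ∎
    where open ≈ᶜ-Reasoning

  *-cancelʳᶜ : ∀ {v w p} → 0# < ∥ p ∥² → v *ᶜ p ≈ᶜ w *ᶜ p → v ≈ᶜ w
  *-cancelʳᶜ {v} {w} {p} 0<p eq = transᶜ (symᶜ (cancel v)) (transᶜ (ℂR.*-congʳ (ℂR.*-congʳ eq)) (cancel w))
    where
    cancel : ∀ v → v *ᶜ p ÷ p ≈ᶜ v
    cancel v = transᶜ (solveᶜ 4 (λ z c i p → z :*ᶜ p :*ᶜ c :*ᶜ i :=ᶜ z :*ᶜ c :*ᶜ i :*ᶜ p) reflᶜ v (conj p) (fromℝ (inv ∥ p ∥²)) p) (÷-* v 0<p)

  ⊑-cancelʳ : ∀ {v p r ρ} → 0# < ρ → ρ * ρ ≤ ∥ p ∥² → v *ᶜ p ⊑ r → v ⊑ r * inv ρ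
  ⊑-cancelʳ {v} {p} {r} {ρ} 0<ρ ρ≤p (bounded 0≤r vp≤) = bounded (*-nonneg 0≤r (<⇒≤ (inv-pos 0<ρ)))
    (*-cancelˡ-≤ (*-pos 0<ρ 0<ρ) (begin
      ρ * ρ * ∥ v ∥²  ≤⟨ *-monoʳ-≤ (∥∥²-nonneg v) ρ≤p ⟩
      ∥ p ∥² * ∥ v ∥²  ≈⟨ *-comm _ _ ⟩
      ∥ v ∥² * ∥ p ∥²  ≈⟨ ∥∥²-* v p ⟨
      ∥ v *ᶜ p ∥²  ≤⟨ vp≤ ⟩
      r * r  ≈⟨ solve 1 (λ r → r :* r := r :* r :* (:1 :* :1)) refl r ⟩
      r * r * (1# * 1#)  ≈⟨ *-congˡ (*-cong (inv-inverseʳ (>0⇒≉0 0<ρ)) (inv-inverseʳ (>0⇒≉0 0<ρ))) ⟨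
      r * r * (ρ * inv ρ * (ρ * inv ρ))  ≈⟨ solve 3 (λ r p i → r :* r :* (p :* i :* (p :* i)) := p :* p :* (r :* i :* (r :* i))) refl r ρ (inv ρ) ⟩
      ρ * ρ * (r * inv ρ * (r * inv ρ))  ∎))
    where open ≤-Reasoning

  square-pos : ∀ {ρ x} → 0# < ρ → ρ * ρ ≤ x → 0# < x
  square-pos 0<ρ ρρ≤x = <-≤-trans (*-pos 0<ρ 0<ρ) ρρ≤x

  ÷-⊑ : ∀ {z p ρ} → 0# < ρ → ρ * ρ ≤ ∥ p ∥² → z ⊑ 1# → z ÷ p ⊑ inv ρ
  ÷-⊑ {z} 0<ρ ρ≤p z⊑1 = ⊑-cong reflᶜ (*-identityˡ _)
    (⊑-cancelʳ 0<ρ ρ≤p (⊑-cong (symᶜ (÷-* z (square-pos 0<ρ ρ≤p))) refl z⊑1))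

  -- Multiplied by p p′ the difference becomes z (p′ - p) + p (z - z′), of modulus at most 3 η + 4
  -- η.
  ÷-lipschitz : ∀ {z z′ p p′ ρ ρ′ η} → 0# < ρ → ρ * ρ ≤ ∥ p ∥² → 0# < ρ′ → ρ′ * ρ′ ≤ ∥ p′ ∥² →
                z ⊑ 1# → p ⊑ num 4 → z -ᶜ z′ ⊑ η → p′ -ᶜ p ⊑ num 3 * η →
                z ÷ p -ᶜ z′ ÷ p′ ⊑ num 7 * η * inv ρ′ * inv ρ
  ÷-lipschitz {z} {z′} {p} {p′} {η = η} 0<ρ ρ≤p 0<ρ′ ρ′≤p′ z⊑1 p⊑4 Δz Δp =
    ⊑-cancelʳ 0<ρ ρ≤p (⊑-cancelʳ 0<ρ′ ρ′≤p′ (⊑-cong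
      (begin
        z *ᶜ (p′ -ᶜ p) +ᶜ p *ᶜ (z -ᶜ z′)
          ≈⟨ solveᶜ 4 (λ z z′ p p′ → z :*ᶜ (p′ :-ᶜ p) :+ᶜ p :*ᶜ (z :-ᶜ z′) :=ᶜ z :*ᶜ p′ :-ᶜ z′ :*ᶜ p) reflᶜ z z′ p p′ ⟩
        z *ᶜ p′ -ᶜ z′ *ᶜ p
          ≈⟨ ℂR.+-cong (ℂR.*-congʳ (÷-* z (square-pos 0<ρ ρ≤p))) (ℂR.-‿cong (ℂR.*-congʳ (÷-* z′ (square-pos 0<ρ′ ρ′≤p′)))) ⟨
        (z ÷ p) *ᶜ p *ᶜ p′ -ᶜ (z′ ÷ p′) *ᶜ p′ *ᶜ p
          ≈⟨ solveᶜ 4 (λ v w p p′ → v :*ᶜ p :*ᶜ p′ :-ᶜ w :*ᶜ p′ :*ᶜ p :=ᶜ (v :-ᶜ w) :*ᶜ p :*ᶜ p′) reflᶜ (z ÷ p) (z′ ÷ p′) p p′ ⟩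
        (z ÷ p -ᶜ z′ ÷ p′) *ᶜ p *ᶜ p′ ∎)
      (solve 1 (λ η → :1 :* (con (+ 3) :* η) :+ con (+ 4) :* η := con (+ 7) :* η) refl η)
      (⊑-+ (⊑-* z⊑1 Δp) (⊑-* p⊑4 Δz))))
    where open ≈ᶜ-Reasoning

  ¼ : ℝ
  ¼ = 1/suc 3

  four-¼ : fromℝ ¼ +ᶜ fromℝ ¼ +ᶜ fromℝ ¼ +ᶜ fromℝ ¼ ≈ᶜ 1ᶜ
  four-¼ = trans (solve 1 (λ q → q :+ q :+ q :+ q := con (+ 4) :* q) refl ¼) (num*1/suc 3) ,
    solve 0 (:0 :+ :0 :+ :0 :+ :0 := :0) refl

  -- z / p away from the zeros of p.  The value ¼ near them is what makes the four numerators
  -- 1, x, y, z still add up to 1 when p = 1 + x + y + z.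
  truncate : ℝ → ℂ → ℂ → ℂ
  truncate D z p = if does (Order._<?_ ∥ p ∥² D) then fromℝ ¼ else z ÷ p

  truncate-small : ∀ {D} z {p} → ∥ p ∥² < D → truncate D z p ≈ᶜ fromℝ ¼
  truncate-small {D} z {p} p<D with Order._<?_ ∥ p ∥² D
  ... | yes _  = reflᶜ
  ... | no p≮D = ⊥-elim (p≮D p<D)

  truncate-large : ∀ {D} z {p} → D ≤ ∥ p ∥² → truncate D z p ≈ᶜ z ÷ p
  truncate-large {D} z {p} D≤p with Order._<?_ ∥ p ∥² D
  ... | yes p<D = ⊥-elim (<⇒≱ p<D D≤p)
  ... | no _    = reflᶜ

  -- The quotient is recognised by multiplying `w` back, so that identities between quotients reduce
  -- to identities without division.
  truncate-unique : ∀ {D z p v w} → 0# < D → (∥ p ∥² < D → v ≈ᶜ fromℝ ¼) → (D ≤ ∥ p ∥² → w ≈ᶜ v × w *ᶜ p ≈ᶜ z) → v ≈ᶜ truncate D z p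
  truncate-unique {D} {z} {p} 0<D small large = [ (λ p<D → transᶜ (small p<D) (symᶜ (truncate-small z p<D)))
    , (λ D≤p → let w≈v , wp≈z = large D≤p; 0<p = <-≤-trans 0<D D≤p in
        transᶜ (symᶜ w≈v) (transᶜ (*-cancelʳᶜ 0<p (transᶜ wp≈z (symᶜ (÷-* z 0<p)))) (symᶜ (truncate-large z D≤p)))) ]′
    (<-or-≥ ∥ p ∥² D)

  truncate-cong : ∀ {D z z′ p p′} → 0# < D → z ≈ᶜ z′ → p ≈ᶜ p′ → truncate D z p ≈ᶜ truncate D z′ p′
  truncate-cong {D} {z} {z′} {p} {p′} 0<D z≈z′ p≈p′ = truncate-unique 0<D
    (λ p′<D → truncate-small z (<-resp (sym (∥∥²-cong p≈p′)) refl p′<D))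
    (λ D≤p′ → let D≤p = ≤-resp refl (sym (∥∥²-cong p≈p′)) D≤p′ in
      symᶜ (truncate-large z D≤p) ,
      transᶜ (ℂR.*-congˡ (symᶜ p≈p′)) (transᶜ (÷-* z (<-≤-trans 0<D D≤p)) z≈z′))

  -- A unit factor does not change the modulus of the denominator, so both sides are truncated at
  -- the same points, and elsewhere 1/(ū p) = u/p. This keeps the inversion symmetry exact after
  -- truncation.
  truncate-rotate : ∀ {D u p} → 0# < D → u *ᶜ conj u ≈ᶜ 1ᶜ → truncate D 1ᶜ (conj u *ᶜ p) ≈ᶜ truncate D u p
  truncate-rotate {D} {u} {p} 0<D uū≈1 = truncate-unique 0<D
    (λ p<D → truncate-small 1ᶜ (<-resp (sym same) refl p<D))
    (λ D≤p → let D≤ūp = ≤-resp refl (sym same) D≤p in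
      symᶜ (truncate-large 1ᶜ D≤ūp) ,
      (begin
        1ᶜ ÷ (conj u *ᶜ p) *ᶜ p  ≈⟨ ℂR.*-identityˡ _ ⟨
        1ᶜ *ᶜ (1ᶜ ÷ (conj u *ᶜ p) *ᶜ p)  ≈⟨ ℂR.*-congʳ uū≈1 ⟨
        u *ᶜ conj u *ᶜ (1ᶜ ÷ (conj u *ᶜ p) *ᶜ p)  ≈⟨ solveᶜ 4 (λ u c v p → u :*ᶜ c :*ᶜ (v :*ᶜ p) :=ᶜ u :*ᶜ (v :*ᶜ (c :*ᶜ p))) reflᶜ u (conj u) _ p ⟩
        u *ᶜ (1ᶜ ÷ (conj u *ᶜ p) *ᶜ (conj u *ᶜ p))  ≈⟨ ℂR.*-congˡ (÷-* 1ᶜ (<-≤-trans 0<D D≤ūp)) ⟩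
        u *ᶜ 1ᶜ  ≈⟨ ℂR.*-identityʳ u ⟩
        u  ∎))
    where
    open ≈ᶜ-Reasoning
    same : ∥ conj u *ᶜ p ∥² ≈ ∥ p ∥²
    same = trans (∥∥²-* (conj u) p) (trans (*-congʳ (trans (∥∥²-conj u) (proj₁ (transᶜ (symᶜ (conj-inverse u)) uū≈1)))) (*-identityˡ _))

  truncate-sum : ∀ {D x y z p} → 0# < D → p ≈ᶜ 1ᶜ +ᶜ x +ᶜ y +ᶜ z →
    truncate D 1ᶜ p +ᶜ truncate D x p +ᶜ truncate D y p +ᶜ truncate D z p ≈ᶜ 1ᶜ
  truncate-sum {D} {x} {y} {z} {p} 0<D p≈ = [ small , large ]′ (<-or-≥ ∥ p ∥² D)
    where
    small : ∥ p ∥² < D → _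
    small p<D = transᶜ (ℂR.+-cong (ℂR.+-cong (ℂR.+-cong (truncate-small 1ᶜ p<D) (truncate-small x p<D)) (truncate-small y p<D)) (truncate-small z p<D)) four-¼
    large : D ≤ ∥ p ∥² → _
    large D≤p = transᶜ (ℂR.+-cong (ℂR.+-cong (ℂR.+-cong (truncate-large 1ᶜ D≤p) (truncate-large x D≤p)) (truncate-large y D≤p)) (truncate-large z D≤p))
      (transᶜ (solveᶜ 5 (λ x y z c i → :1ᶜ :*ᶜ c :*ᶜ i :+ᶜ x :*ᶜ c :*ᶜ i :+ᶜ y :*ᶜ c :*ᶜ i :+ᶜ z :*ᶜ c :*ᶜ i :=ᶜ
          c :*ᶜ i :*ᶜ (:1ᶜ :+ᶜ x :+ᶜ y :+ᶜ z)) reflᶜ x y z (conj p) (fromℝ (inv ∥ p ∥²)))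
        (transᶜ (ℂR.*-cong (ℂR.*-congʳ (symᶜ (ℂR.*-identityˡ _))) (symᶜ p≈)) (÷-* 1ᶜ (<-≤-trans 0<D D≤p))))

  truncate-⊑ : ∀ {D z p ρ} → D ≈ ρ * ρ → 0# < ρ → ρ ≤ 1# → z ⊑ 1# → truncate D z p ⊑ inv ρ
  truncate-⊑ {D} {z} {p} {ρ} D≈ 0<ρ ρ≤1 z⊑1 = [ small , large ]′ (<-or-≥ ∥ p ∥² D)
    where
    1≤inv : 1# ≤ inv ρ
    1≤inv = *-cancelˡ-≤ 0<ρ (≤-resp (sym (*-identityʳ ρ)) (sym (inv-inverseʳ (>0⇒≉0 0<ρ))) ρ≤1)
    small : ∥ p ∥² < D → _
    small p<D = ⊑-cong (symᶜ (truncate-small z p<D)) refl (⊑-weaken (≤-trans ¼≤1 1≤inv) (⊑-fromℝ (<⇒≤ (1/suc-pos 3))))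
      where
      ¼≤1 : ¼ ≤ 1#
      ¼≤1 = by-nonneg (*-nonneg (num-nonneg 3) (<⇒≤ (1/suc-pos 3)))
        (trans (sym (num*1/suc 3)) (solve 1 (λ q → con (+ 4) :* q := q :+ con (+ 3) :* q) refl ¼))
    large : D ≤ ∥ p ∥² → _
    large D≤p = ⊑-cong (symᶜ (truncate-large z D≤p)) refl (÷-⊑ 0<ρ (≤-resp D≈ refl D≤p) z⊑1)

  denominator : ℂ → ℂ → ℂ → ℂ
  denominator x y z = 1ᶜ +ᶜ x +ᶜ y +ᶜ z

  -- Stands for re or im, so that both parts of the integral are treated at once.
  record Part : Set where
    field
      part      : ℂ → ℝ
      part-cong : ∀ {z w} → z ≈ᶜ w → part z ≈ part w
      part-+    : ∀ z w → part (z +ᶜ w) ≈ part z + part w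
      part-neg  : ∀ z → part (-ᶜ z) ≈ - part z
      part-≤    : ∀ {z r} → z ⊑ r → ∣ part z ∣ ≤ r

  rePart imPart : Part
  rePart = record { part = re ; part-cong = proj₁ ; part-+ = λ _ _ → refl ; part-neg = λ _ → refl ; part-≤ = ∣re∣≤ }
  imPart = record { part = im ; part-cong = proj₂ ; part-+ = λ _ _ → refl ; part-neg = λ _ → refl ; part-≤ = ∣im∣≤ }

  Σ³ : ℕ → (ℕ → ℕ → ℕ → ℝ) → ℝ
  Σ³ N f = Σ< N λ i → Σ< N λ j → Σ< N λ k → f i j k

  Σ³-cong : ∀ N {f g} → (∀ i j k → f i j k ≈ g i j k) → Σ³ N f ≈ Σ³ N g
  Σ³-cong N {f} {g} f≈g =
    Σ<-cong N {λ i → Σ< N λ j → Σ< N (f i j)} {λ i → Σ< N λ j → Σ< N (g i j)} λ i →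
    Σ<-cong N {λ j → Σ< N (f i j)} {λ j → Σ< N (g i j)} λ j →
    Σ<-cong N {f i j} {g i j} (f≈g i j)

  Σ<-+ : ∀ N f g → Σ< N (λ i → f i + g i) ≈ Σ< N f + Σ< N g
  Σ<-+ N f g = sum-+ {N} (f ∘ toℕ) (g ∘ toℕ)

  Σ³-+ : ∀ N f g → Σ³ N (λ i j k → f i j k + g i j k) ≈ Σ³ N f + Σ³ N g
  Σ³-+ N f g = trans
    (Σ<-cong N {λ i → Σ< N λ j → Σ< N λ k → f i j k + g i j k} {λ i → Σ< N (λ j → Σ< N (f i j)) + Σ< N (λ j → Σ< N (g i j))} λ i → trans
      (Σ<-cong N {λ j → Σ< N λ k → f i j k + g i j k} {λ j → Σ< N (f i j) + Σ< N (g i j)} λ j → Σ<-+ N (f i j) (g i j))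
      (Σ<-+ N (λ j → Σ< N (f i j)) (λ j → Σ< N (g i j))))
    (Σ<-+ N (λ i → Σ< N λ j → Σ< N (f i j)) (λ i → Σ< N λ j → Σ< N (g i j)))

  Σ³-const : ∀ N c → Σ³ N (λ _ _ _ → c) ≈ num N * (num N * (num N * c))
  Σ³-const N c = trans (sum-const N _) (*-congˡ (trans (sum-const N _) (*-congˡ (sum-const N c))))

  -- Exact means of the truncated quotients over roots of unity.

  module Mean (P : Part) (n : ℕ) {D : ℝ} (0<D : 0# < D) where
    open Part P
    open Roots n

    private
      F : ℂ → ℂ → ℝ
      F z p = part (truncate D z p)

      F-cong : ∀ {z z′ p p′} → z ≈ᶜ z′ → p ≈ᶜ p′ → F z p ≈ F z′ p′
      F-cong z≈ p≈ = part-cong (truncate-cong 0<D z≈ p≈)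

      den : ℕ → ℕ → ℕ → ℂ
      den i j k = denominator (ζ i) (ζ j) (ζ k)

      M₁ Mx My Mz : ℝ
      M₁ = Σ³ N λ i j k → F 1ᶜ (den i j k)
      Mx = Σ³ N λ i j k → F (ζ i) (den i j k)
      My = Σ³ N λ i j k → F (ζ j) (den i j k)
      Mz = Σ³ N λ i j k → F (ζ k) (den i j k)

      den-swap₂₃ : ∀ i j k → F (ζ k) (den i k j) ≈ F (ζ k) (den i j k)
      den-swap₂₃ i j k = F-cong (reflᶜ {ζ k})
        (solveᶜ 3 (λ a b c → a :+ᶜ b :+ᶜ c :=ᶜ a :+ᶜ c :+ᶜ b) reflᶜ (1ᶜ +ᶜ ζ i) (ζ k) (ζ j))

      den-swap₁₂ : ∀ i j k → F (ζ j) (den j i k) ≈ F (ζ j) (den i j k)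
      den-swap₁₂ i j k = F-cong (reflᶜ {ζ j})
        (solveᶜ 3 (λ b c d → :1ᶜ :+ᶜ b :+ᶜ c :+ᶜ d :=ᶜ :1ᶜ :+ᶜ c :+ᶜ b :+ᶜ d) reflᶜ (ζ j) (ζ i) (ζ k))

      Σ²-cong : ∀ {f g : ℕ → ℕ → ℝ} → (∀ j k → f j k ≈ g j k) → Σ< N (λ j → Σ< N (f j)) ≈ Σ< N (λ j → Σ< N (g j))
      Σ²-cong {f} {g} f≈g = Σ<-cong N {λ j → Σ< N (f j)} {λ j → Σ< N (g j)} λ j → Σ<-cong N {f j} {g j} (f≈g j)

      My≈Mz : My ≈ Mz
      My≈Mz = Σ<-cong N row
        where
        row : ∀ i → Σ< N (λ j → Σ< N λ k → F (ζ j) (den i j k)) ≈ Σ< N (λ j → Σ< N λ k → F (ζ k) (den i j k))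
        row i = trans
          (sum-comm {N} {N} λ j k → F (ζ (toℕ j)) (den i (toℕ j) (toℕ k)))
          (Σ²-cong (den-swap₂₃ i))

      Mx≈My : Mx ≈ My
      Mx≈My = trans
        (sum-comm {N} {N} λ i j → Σ< N λ k → F (ζ (toℕ i)) (den (toℕ i) (toℕ j) k))
        (Σ³-cong N den-swap₁₂)

      G H : ℕ → ℝ
      G i = Σ< N λ j → Σ< N λ k → F 1ᶜ (den i j k)
      H i = Σ< N λ j → Σ< N λ k → F (ζ i) (den i j k)

      F-cong₁ : ∀ {i i′ j j′ k k′} → ζ i ≈ᶜ ζ i′ → ζ j ≈ᶜ ζ j′ → ζ k ≈ᶜ ζ k′ → F 1ᶜ (den i j k) ≈ F 1ᶜ (den i′ j′ k′)
      F-cong₁ {i} {i′} {j} {j′} p q r = F-cong (reflᶜ {1ᶜ}) (ℂR.+-cong (ℂR.+-cong (ℂR.+-congˡ {1ᶜ} p) q) r)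

      G-periodic : Periodic N G
      G-periodic i = Σ²-cong λ j k → F-cong₁ {i ℕ.+ N} {i} {j} {j} {k} {k} (ζ-periodic i) reflᶜ reflᶜ

      -- The substitution (x, y, z) ↦ (1/x, y/x, z/x) turns 1/(1+x+y+z) into x/(1+x+y+z).
      G-inverse : ∀ i i′ → ζ i′ ≈ᶜ conj (ζ i) → G i′ ≈ H i
      G-inverse i i′ ζi′ = begin
        Σ< N row  ≈⟨ Σ<-shift N i′ {row} row-periodic ⟨
        Σ< N (λ j → Σ< N λ k → F 1ᶜ (den i′ (j ℕ.+ i′) k))  ≈⟨ Σ<-cong N {λ j → row (j ℕ.+ i′)} {λ j → Σ< N λ k → F 1ᶜ (den i′ (j ℕ.+ i′) (k ℕ.+ i′))}
                                                                                  (λ j → sym (Σ<-shift N i′ {λ k → F 1ᶜ (den i′ (j ℕ.+ i′) k)} (column-periodic j))) ⟩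
        Σ< N (λ j → Σ< N λ k → F 1ᶜ (den i′ (j ℕ.+ i′) (k ℕ.+ i′)))  ≈⟨ Σ²-cong rotate ⟩
        H i  ∎
        where
        open ≈-Reasoning
        row : ℕ → ℝ
        row j = Σ< N λ k → F 1ᶜ (den i′ j k)
        row-periodic : Periodic N row
        row-periodic j = Σ<-cong N {λ k → F 1ᶜ (den i′ (j ℕ.+ N) k)} {λ k → F 1ᶜ (den i′ j k)}
          λ k → F-cong₁ {i′} {i′} {j ℕ.+ N} {j} {k} {k} reflᶜ (ζ-periodic j) reflᶜ
        column-periodic : ∀ j → Periodic N (λ k → F 1ᶜ (den i′ (j ℕ.+ i′) k))
        column-periodic j k = F-cong₁ {i′} {i′} {j ℕ.+ i′} {j ℕ.+ i′} {k ℕ.+ N} {k} reflᶜ reflᶜ (ζ-periodic k)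
        rotated : ∀ j k → den i′ (j ℕ.+ i′) (k ℕ.+ i′) ≈ᶜ conj (ζ i) *ᶜ den i j k
        rotated j k = transᶜ
          (ℂR.+-cong (ℂR.+-cong (ℂR.+-cong (symᶜ (ζ-conj i)) ζi′) (transᶜ (ζ-+ j i′) (ℂR.*-congˡ ζi′))) (transᶜ (ζ-+ k i′) (ℂR.*-congˡ ζi′)))
          (solveᶜ 4 (λ x c y z → x :*ᶜ c :+ᶜ c :+ᶜ y :*ᶜ c :+ᶜ z :*ᶜ c :=ᶜ c :*ᶜ (:1ᶜ :+ᶜ x :+ᶜ y :+ᶜ z)) reflᶜ (ζ i) (conj (ζ i)) (ζ j) (ζ k))
        rotate : ∀ j k → F 1ᶜ (den i′ (j ℕ.+ i′) (k ℕ.+ i′)) ≈ F (ζ i) (den i j k)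
        rotate j k = part-cong (transᶜ (truncate-cong 0<D (reflᶜ {1ᶜ}) (rotated j k)) (truncate-rotate 0<D (ζ-conj i)))

      M₁≈Mx : M₁ ≈ Mx
      M₁≈Mx = sym (trans
        -- Reversal sends `i` to N - 1 - i and the shift by 1 corrects this to N - i, the index of
        -- the inverse root.
        (sum-cong {N} {λ i → H (toℕ i)} {λ i → G (N ℕ.∸ suc (toℕ i) ℕ.+ 1)} λ i → sym (G-inverse (toℕ i) (N ℕ.∸ suc (toℕ i) ℕ.+ 1) (opposite (toℕ i) (Fin.toℕ<n i))))
        (trans (Σ<-reverse N (λ i → G (i ℕ.+ 1))) (Σ<-shift N 1 {G} G-periodic)))
        where
        opposite : ∀ i → i ℕ.< N → ζ (N ℕ.∸ suc i ℕ.+ 1) ≈ᶜ conj (ζ i)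
        opposite i i<N = ζ-inverse {i} {N ℕ.∸ suc i ℕ.+ 1} (transᶜ (ℂR.reflexive (≡.cong ζ (≡.trans
          (≡.trans (≡.cong (i ℕ.+_) (ℕ.+-comm _ 1)) (ℕ.+-suc i (N ℕ.∸ suc i))) (ℕ.m+[n∸m]≡n i<N)))) ζ-N)

      t₁ tx ty tz : ℕ → ℕ → ℕ → ℂ
      t₁ i j k = truncate D 1ᶜ (den i j k)
      tx i j k = truncate D (ζ i) (den i j k)
      ty i j k = truncate D (ζ j) (den i j k)
      tz i j k = truncate D (ζ k) (den i j k)

      part-+⁴ : ∀ a b c d → part (a +ᶜ b +ᶜ c +ᶜ d) ≈ part a + part b + part c + part d
      part-+⁴ a b c d = trans (part-+ (a +ᶜ b +ᶜ c) d) (+-congʳ (trans (part-+ (a +ᶜ b) c) (+-congʳ (part-+ a b))))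

      Σ³-+⁴ : ∀ f g h l → Σ³ N (λ i j k → f i j k + g i j k + h i j k + l i j k) ≈ Σ³ N f + Σ³ N g + Σ³ N h + Σ³ N l
      Σ³-+⁴ f g h l = trans (Σ³-+ N (λ i j k → f i j k + g i j k + h i j k) l)
        (+-congʳ (trans (Σ³-+ N (λ i j k → f i j k + g i j k) h) (+-congʳ (Σ³-+ N f g))))

      ¼s : ℂ
      ¼s = fromℝ ¼ +ᶜ fromℝ ¼ +ᶜ fromℝ ¼ +ᶜ fromℝ ¼

    truncate-mean : Σ³ N (λ i j k → part (truncate D (ζ k) (denominator (ζ i) (ζ j) (ζ k)))) ≈ num N * (num N * (num N * part (fromℝ ¼)))
    truncate-mean = *-cancel-4 (begin
      num 4 * Mz
        ≈⟨ solve 1 (λ m → con (+ 4) :* m := m :+ m :+ m :+ m) refl Mz ⟩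
      Mz + Mz + Mz + Mz
        ≈⟨ +-congʳ (+-cong (+-cong (trans M₁≈Mx (trans Mx≈My My≈Mz)) (trans Mx≈My My≈Mz)) My≈Mz) ⟨
      M₁ + Mx + My + Mz
        ≈⟨ Σ³-+⁴ (λ i j k → part (t₁ i j k)) (λ i j k → part (tx i j k)) (λ i j k → part (ty i j k)) (λ i j k → part (tz i j k)) ⟨
      Σ³ N (λ i j k → part (t₁ i j k) + part (tx i j k) + part (ty i j k) + part (tz i j k))
        ≈⟨ Σ³-cong N total ⟩
      Σ³ N (λ _ _ _ → part ¼s)
        ≈⟨ Σ³-const N (part ¼s) ⟩
      num N * (num N * (num N * part ¼s))
        ≈⟨ *-congˡ (*-congˡ (*-congˡ (part-+⁴ (fromℝ ¼) (fromℝ ¼) (fromℝ ¼) (fromℝ ¼)))) ⟩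
      num N * (num N * (num N * (part (fromℝ ¼) + part (fromℝ ¼) + part (fromℝ ¼) + part (fromℝ ¼))))
        ≈⟨ solve 2 (λ m q → m :* (m :* (m :* (q :+ q :+ q :+ q))) := con (+ 4) :* (m :* (m :* (m :* q)))) refl (num N) (part (fromℝ ¼)) ⟩
      num 4 * (num N * (num N * (num N * part (fromℝ ¼)))) ∎)
      where
      open ≈-Reasoning
      total : ∀ i j k → part (t₁ i j k) + part (tx i j k) + part (ty i j k) + part (tz i j k) ≈ part ¼s
      total i j k = trans
        (sym (part-+⁴ (t₁ i j k) (tx i j k) (ty i j k) (tz i j k)))
        (part-cong (transᶜ (truncate-sum {x = ζ i} {ζ j} {ζ k} 0<D reflᶜ) (symᶜ four-¼)))
      *-cancel-4 : ∀ {x y} → num 4 * x ≈ num 4 * y → x ≈ y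
      *-cancel-4 eq = ≤-antisym (*-cancelˡ-≤ (num-pos 3) (≤-reflexive eq)) (*-cancelˡ-≤ (num-pos 3) (≤-reflexive (sym eq)))

-- Counting the grid points at which the denominator is small.

module Estimates (em : ExcludedMiddle 0ℓ) (𝓡 : CompleteOrderedField) where
  open Analysis 𝓡
  open OrderedField em 𝓡
  open Series em 𝓡
  open Complex em 𝓡
  open Circle em 𝓡
  open Truncation em 𝓡

  inv-½^ : ∀ k → inv (½^ k) ≈ num (2 ℕ.^ k)
  inv-½^ k = sym (inv-unique (trans (*-comm _ _) (num2^*½^ k)))

  -- (1 + x)(1 + y)(x + y) = x y (w w̄ - 1) for w = 1 + x + y, and w w̄ - 1 = w̄ P - z P̄ for P = w + z.
  factorisation : ∀ {x y z x̄ ȳ z̄} → x *ᶜ x̄ ≈ᶜ 1ᶜ → y *ᶜ ȳ ≈ᶜ 1ᶜ → z *ᶜ z̄ ≈ᶜ 1ᶜ →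
    (1ᶜ +ᶜ x) *ᶜ (1ᶜ +ᶜ y) *ᶜ (x +ᶜ y) *ᶜ (x̄ *ᶜ ȳ) ≈ᶜ
    (1ᶜ +ᶜ x̄ +ᶜ ȳ) *ᶜ denominator x y z -ᶜ z *ᶜ denominator x̄ ȳ z̄
  factorisation {x} {y} {z} {x̄} {ȳ} {z̄} xx̄ yȳ zz̄ = begin
    (1ᶜ +ᶜ x) *ᶜ (1ᶜ +ᶜ y) *ᶜ (x +ᶜ y) *ᶜ (x̄ *ᶜ ȳ)
      ≈⟨ solveᶜ 4 (λ x y a b → (:1ᶜ :+ᶜ x) :*ᶜ (:1ᶜ :+ᶜ y) :*ᶜ (x :+ᶜ y) :*ᶜ (a :*ᶜ b) :=ᶜ
           (:1ᶜ :+ᶜ x :+ᶜ y) :*ᶜ ((x :*ᶜ a) :*ᶜ b :+ᶜ (y :*ᶜ b) :*ᶜ a) :+ᶜ ((x :*ᶜ a) :*ᶜ (y :*ᶜ b) :*ᶜ (x :+ᶜ y))) reflᶜ x y x̄ ȳ ⟩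
    (1ᶜ +ᶜ x +ᶜ y) *ᶜ ((x *ᶜ x̄) *ᶜ ȳ +ᶜ (y *ᶜ ȳ) *ᶜ x̄) +ᶜ (x *ᶜ x̄) *ᶜ (y *ᶜ ȳ) *ᶜ (x +ᶜ y)
      ≈⟨ ℂR.+-cong (ℂR.*-congˡ (ℂR.+-cong (ℂR.*-congʳ xx̄) (ℂR.*-congʳ yȳ))) (ℂR.*-congʳ (ℂR.*-cong xx̄ yȳ)) ⟩
    (1ᶜ +ᶜ x +ᶜ y) *ᶜ (1ᶜ *ᶜ ȳ +ᶜ 1ᶜ *ᶜ x̄) +ᶜ 1ᶜ *ᶜ 1ᶜ *ᶜ (x +ᶜ y)
      ≈⟨ solveᶜ 6 (λ x y z a b c → (:1ᶜ :+ᶜ x :+ᶜ y) :*ᶜ (:1ᶜ :*ᶜ b :+ᶜ :1ᶜ :*ᶜ a) :+ᶜ :1ᶜ :*ᶜ :1ᶜ :*ᶜ (x :+ᶜ y) :=ᶜ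
           (:1ᶜ :+ᶜ a :+ᶜ b) :*ᶜ (:1ᶜ :+ᶜ x :+ᶜ y :+ᶜ z) :-ᶜ z :*ᶜ (:1ᶜ :+ᶜ a :+ᶜ b :+ᶜ c) :+ᶜ (z :*ᶜ c :-ᶜ :1ᶜ)) reflᶜ x y z x̄ ȳ z̄ ⟩
    (1ᶜ +ᶜ x̄ +ᶜ ȳ) *ᶜ denominator x y z -ᶜ z *ᶜ denominator x̄ ȳ z̄ +ᶜ (z *ᶜ z̄ -ᶜ 1ᶜ)
      ≈⟨ ℂR.+-congˡ (transᶜ (ℂR.+-congʳ zz̄) (ℂR.-‿inverseʳ 1ᶜ)) ⟩
    (1ᶜ +ᶜ x̄ +ᶜ ȳ) *ᶜ denominator x y z -ᶜ z *ᶜ denominator x̄ ȳ z̄ +ᶜ 0ᶜ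
      ≈⟨ ℂR.+-identityʳ _ ⟩
    (1ᶜ +ᶜ x̄ +ᶜ ȳ) *ᶜ denominator x y z -ᶜ z *ᶜ denominator x̄ ȳ z̄ ∎
    where open ≈ᶜ-Reasoning

  Unit : ℂ → Set
  Unit z = z *ᶜ conj z ≈ᶜ 1ᶜ

  unit-∥∥² : ∀ {z} → Unit z → ∥ z ∥² ≈ 1#
  unit-∥∥² {z} zz̄ = proj₁ (transᶜ (symᶜ (conj-inverse z)) zz̄)

  unit-⊑ : ∀ {z} → Unit z → z ⊑ 1#
  unit-⊑ zz̄ = bounded 0≤1 (≤-reflexive (trans (unit-∥∥² zz̄) (sym (*-identityˡ 1#))))

  conj-denominator : ∀ x y z → conj (denominator x y z) ≈ᶜ denominator (conj x) (conj y) (conj z)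
  conj-denominator x y z = refl ,
    solve 3 (λ a b c → :- (:0 :+ a :+ b :+ c) := :0 :+ :- a :+ :- b :+ :- c) refl (im x) (im y) (im z)

  -- As |1 + x̄ + ȳ| ≤ 3 and |z| = 1, the right side of `factorisation` has modulus at most 3 r + r;
  -- 16 is the square of 4.
  factors-⊑ : ∀ {x y z r} → Unit x → Unit y → Unit z → denominator x y z ⊑ r →
    ∥ 1ᶜ +ᶜ x ∥² * ∥ 1ᶜ +ᶜ y ∥² * ∥ x +ᶜ y ∥² ≤ num 16 * (r * r)
  factors-⊑ {x} {y} {z} {r} ux uy uz P⊑r = begin
    ∥ 1ᶜ +ᶜ x ∥² * ∥ 1ᶜ +ᶜ y ∥² * ∥ x +ᶜ y ∥²
      ≈⟨ trans (*-congʳ (sym (∥∥²-* (1ᶜ +ᶜ x) (1ᶜ +ᶜ y)))) (sym (∥∥²-* ((1ᶜ +ᶜ x) *ᶜ (1ᶜ +ᶜ y)) (x +ᶜ y))) ⟩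
    ∥ f ∥²  ≈⟨ *-identityʳ _ ⟨
    ∥ f ∥² * 1#  ≈⟨ *-congˡ (trans (∥∥²-* (conj x) (conj y)) (trans (*-cong (trans (∥∥²-conj x) (unit-∥∥² ux)) (trans (∥∥²-conj y) (unit-∥∥² uy))) (*-identityˡ 1#))) ⟨
    ∥ f ∥² * ∥ conj x *ᶜ conj y ∥²  ≈⟨ ∥∥²-* f (conj x *ᶜ conj y) ⟨
    ∥ f *ᶜ (conj x *ᶜ conj y) ∥²  ≈⟨ ∥∥²-cong (factorisation {z = z} ux uy uz) ⟩
    ∥ (1ᶜ +ᶜ conj x +ᶜ conj y) *ᶜ denominator x y z -ᶜ z *ᶜ denominator (conj x) (conj y) (conj z) ∥²
      ≤⟨ ∥∥²-≤ (⊑-- (⊑-* (⊑-+ (⊑-+ (⊑-fromℝ 0≤1) (⊑-conj (unit-⊑ ux))) (⊑-conj (unit-⊑ uy))) P⊑r)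
                    (⊑-* (unit-⊑ uz) (⊑-cong (conj-denominator x y z) refl (⊑-conj P⊑r)))) ⟩
    ((1# + 1# + 1#) * r + 1# * r) * ((1# + 1# + 1#) * r + 1# * r)
      ≈⟨ solve 1 (λ r → ((:1 :+ :1 :+ :1) :* r :+ :1 :* r) :* ((:1 :+ :1 :+ :1) :* r :+ :1 :* r) := con (+ 16) :* (r :* r)) refl r ⟩
    num 16 * (r * r) ∎
    where
    open ≤-Reasoning
    f = (1ᶜ +ᶜ x) *ᶜ (1ᶜ +ᶜ y) *ᶜ (x +ᶜ y)

  -- The level-m grid has mesh ½^ (scale m), and z/(1+x+y+z) is truncated where |1+x+y+z| < ½^ (depth m).
  scale depth : ℕ → ℕ
  scale zero    = 16
  scale (suc m) = 7 ℕ.+ scale m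
  depth zero    = 3
  depth (suc m) = 3 ℕ.+ depth m

  -- δ = τ³/8 for τ = ½^ m; the cube matches the product of three factors in `factors-⊑`.
  ½^-depth : ∀ m → ½^ (depth m) ≈ ½^ 3 * (½^ m * ½^ m * ½^ m)
  ½^-depth zero    = solve 1 (λ x → x := x :* (:1 :* :1 :* :1)) refl _
  ½^-depth (suc m) = trans (*-congˡ (*-congˡ (*-congˡ (½^-depth m))))
    (solve 3 (λ h c x → h :* (h :* (h :* (c :* (x :* x :* x)))) := c :* (h :* x :* (h :* x) :* (h :* x))) refl ½ (½^ 3) (½^ m))

  -- Of this mesh, δ² pays for the two denominators in the quotient rule and ½^ m for summability.
  -- The constant 2¹⁰ = 16 · 8 · 8 absorbs the Lipschitz constant 16 of `e`, the 7 of `÷-lipschitz`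
  -- and the ratio 8 of successive δ.
  ½^-scale : ∀ m → ½^ (scale m) ≈ ½^ 10 * ½^ m * (½^ (depth m) * ½^ (depth m))
  ½^-scale zero    = trans (½^-+ 10 6) (*-cong (sym (*-identityʳ _)) (½^-+ 3 3))
  ½^-scale (suc m) = trans (trans (½^-+ 7 (scale m)) (*-cong (½^-+ 1 6) (½^-scale m)))
    (trans (solve 4 (λ a b x d → a :* b :* (x :* d) := (x :* a) :* (b :* d)) refl (½^ 1) (½^ 6) (½^ 10 * ½^ m) (½^ (depth m) * ½^ (depth m)))
      (*-cong (trans (solve 3 (λ t x h → t :* x :* (h :* :1) := t :* (h :* x)) refl (½^ 10) (½^ m) ½) refl)
        (solve 2 (λ h d → h :* (h :* (h :* (h :* (h :* (h :* :1))))) :* (d :* d) := h :* (h :* (h :* d)) :* (h :* (h :* (h :* d)))) refl ½ (½^ (depth m)))))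

  m<scale : ∀ m → suc m ℕ.≤ scale m
  m<scale zero    = ℕ.s≤s ℕ.z≤n
  m<scale (suc m) = ℕ.s≤s (ℕ.≤-trans (m<scale m) (ℕ.m≤n+m (scale m) 6))

  depth≤scale : ∀ m → 7 ℕ.+ depth m ℕ.≤ scale m
  depth≤scale zero    = ℕ.m≤m+n 10 6
  depth≤scale (suc m) = ℕ.+-mono-≤ (ℕ.m≤m+n 3 4) (depth≤scale m)

  depth<scale : ∀ m → suc (depth m) ℕ.≤ scale m
  depth<scale m = ℕ.≤-trans (ℕ.s≤s (ℕ.m≤n+m (depth m) 6)) (depth≤scale m)

  threshold : ℕ → ℝ
  threshold m = ½^ (depth m) * ½^ (depth m)

  threshold-pos : ∀ m → 0# < threshold m
  threshold-pos m = *-pos (½^-pos (depth m)) (½^-pos (depth m))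

  -- If no factor were small, the product of the squared moduli would be at least τ⁶, whereas
  -- `factors-⊑` bounds it by 16 δ² = τ⁶/4.
  small-factor : ∀ m {x y z} → Unit x → Unit y → Unit z → ∥ denominator x y z ∥² < threshold m →
    ∥ 1ᶜ +ᶜ x ∥² < ½^ m * ½^ m ⊎ ∥ 1ᶜ +ᶜ y ∥² < ½^ m * ½^ m ⊎ ∥ x +ᶜ y ∥² < ½^ m * ½^ m
  small-factor m {x} {y} {z} ux uy uz small = decide (<-or-≥ ∥ 1ᶜ +ᶜ x ∥² τ²) (<-or-≥ ∥ 1ᶜ +ᶜ y ∥² τ²) (<-or-≥ ∥ x +ᶜ y ∥² τ²)
    where
    τ² = ½^ m * ½^ m
    0≤τ² = square-nonneg (½^ m)
    decide : _ ⊎ _ → _ ⊎ _ → _ ⊎ _ → _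
    decide (inj₁ p) _ _ = inj₁ p
    decide (inj₂ _) (inj₁ q) _ = inj₂ (inj₁ q)
    decide (inj₂ _) (inj₂ _) (inj₁ r) = inj₂ (inj₂ r)
    decide (inj₂ p) (inj₂ q) (inj₂ r) = ⊥-elim (<⇒≱ strict (≤-trans
      (*-mono-≤ (*-nonneg 0≤τ² 0≤τ²) 0≤τ² (*-mono-≤ 0≤τ² 0≤τ² p q) r)
      (factors-⊑ ux uy uz (bounded (½^-nonneg (depth m)) (<⇒≤ small)))))
      where
      τ⁶ = τ² * τ² * τ²
      strict : num 16 * threshold m < τ⁶
      strict = begin-strict
        num 16 * threshold m  ≈⟨ *-congˡ (*-cong (½^-depth m) (½^-depth m)) ⟩
        num 16 * (½^ 3 * (½^ m * ½^ m * ½^ m) * (½^ 3 * (½^ m * ½^ m * ½^ m)))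
          ≈⟨ solve 3 (λ n c x → n :* (c :* (x :* x :* x) :* (c :* (x :* x :* x))) := n :* (c :* c) :* (x :* x :* (x :* x) :* (x :* x))) refl (num 16) (½^ 3) (½^ m) ⟩
        num 16 * (½^ 3 * ½^ 3) * τ⁶  ≈⟨ *-congʳ (*-congˡ (trans (sym (½^-+ 3 3)) (½^-+ 4 2))) ⟩
        num 16 * (½^ 4 * ½^ 2) * τ⁶  ≈⟨ *-congʳ (trans (sym (*-assoc _ _ _)) (trans (*-congʳ (num2^*½^ 4)) (*-identityˡ _))) ⟩
        ½^ 2 * τ⁶  ≈⟨ *-comm _ _ ⟩
        τ⁶ * ½^ 2  <⟨ *-monoˡ-< 0<τ⁶ ¼<1 ⟩
        τ⁶ * 1#  ≈⟨ *-identityʳ _ ⟩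
        τ⁶  ∎
        where
        open ≤-Reasoning
        0<τ² = *-pos (½^-pos m) (½^-pos m)
        0<τ⁶ = *-pos (*-pos 0<τ² 0<τ²) 0<τ²
        ¼<1 : ½^ 2 < 1#
        ¼<1 = <-≤-trans (by-pos (½^-pos 2) (sym (½^-double 1))) (½^-≤1 1)

  module Grid (m : ℕ) where
    open Roots (scale m) public

    small : ℕ → ℕ → ℕ → ℝ
    small i j k = [ ∥ denominator (ζ i) (ζ j) (ζ k) ∥² < threshold m ]

    small-nonneg : ∀ i j k → 0# ≤ small i j k
    small-nonneg i j k = [<]-nonneg _ _

    private
      -- A union bound for `small-factor`: at least 1 whenever some `k` makes the cell small. It
      -- does not depend on `k`, so the sum over `k` can be estimated first.
      weight : ℕ → ℕ → ℝ
      weight i j = near 1ᶜ m i + near 1ᶜ m j + near (ζ i) m j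

      near-nonneg : ∀ c a k → 0# ≤ near c a k
      near-nonneg c a k = [<]-nonneg _ _

      0≤weight : ∀ i j → 0# ≤ weight i j
      0≤weight i j = +-nonneg (+-nonneg (near-nonneg 1ᶜ m i) (near-nonneg 1ᶜ m j)) (near-nonneg (ζ i) m j)

      small≤weight : ∀ i j k → small i j k ≤ weight i j * small i j k
      small≤weight i j k = decide (<-or-≥ ∥ denominator (ζ i) (ζ j) (ζ k) ∥² (threshold m))
        where
        a = near 1ᶜ m i
        b = near 1ᶜ m j
        c = near (ζ i) m j
        0≤a = near-nonneg 1ᶜ m i
        0≤b = near-nonneg 1ᶜ m j
        0≤c = near-nonneg (ζ i) m j
        1≤weight : _ ⊎ _ ⊎ _ → 1# ≤ weight i j
        1≤weight (inj₁ p)        = by-nonneg (+-nonneg 0≤b 0≤c) (trans (+-assoc a b c) (+-congʳ ([<]-true p)))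
        1≤weight (inj₂ (inj₁ p)) = by-nonneg (+-nonneg 0≤a 0≤c) (trans (solve 3 (λ a b c → a :+ b :+ c := b :+ (a :+ c)) refl a b c) (+-congʳ ([<]-true p)))
        1≤weight (inj₂ (inj₂ p)) = by-nonneg (+-nonneg 0≤a 0≤b) (trans (+-comm _ _) (+-congʳ ([<]-true p)))
        decide : _ ⊎ _ → small i j k ≤ weight i j * small i j k
        decide (inj₁ p) = ≤-resp (*-identityˡ _) refl (*-monoʳ-≤ (small-nonneg i j k)
          (1≤weight (small-factor m (ζ-conj i) (ζ-conj j) (ζ-conj k) p)))
        decide (inj₂ p) = ≤-resp (sym ([<]-false λ q → <⇒≱ q p)) refl (*-nonneg (0≤weight i j) (small-nonneg i j k))

      X = num N
      Y = num N * ½^ m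
      Z = num N * ½^ (depth m)
      0≤Z = *-nonneg (num-nonneg N) (½^-nonneg (depth m))

      column : ∀ i j → Σ< N (small i j) ≤ weight i j * Z
      column i j = ≤-trans (Σ<-mono N {small i j} {λ k → weight i j * small i j k} (small≤weight i j))
        (≤-trans (≤-reflexive (sym (*-distribˡ-sum {N} (weight i j) (small i j ∘ toℕ))))
          (*-monoˡ-≤ (0≤weight i j) (near-count (1ᶜ +ᶜ ζ i +ᶜ ζ j) (depth m) (depth<scale m))))

      row : ∀ i → Σ< N (λ j → Σ< N (small i j)) ≤ (X * near 1ᶜ m i + Y + Y) * Z
      row i = begin
        Σ< N (λ j → Σ< N (small i j))  ≤⟨ Σ<-mono N {λ j → Σ< N (small i j)} {λ j → weight i j * Z} (column i) ⟩
        Σ< N (λ j → weight i j * Z)  ≈⟨ *-distribʳ-sum {N} Z (weight i ∘ toℕ) ⟨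
        Σ< N (weight i) * Z  ≈⟨ *-congʳ (trans (Σ<-+ N (λ j → near 1ᶜ m i + near 1ᶜ m j) (near (ζ i) m)) (+-congʳ (trans (Σ<-+ N (λ _ → near 1ᶜ m i) (near 1ᶜ m)) (+-congʳ (sum-const N (near 1ᶜ m i)))))) ⟩
        (X * near 1ᶜ m i + Σ< N (near 1ᶜ m) + Σ< N (near (ζ i) m)) * Z
                                                       ≤⟨ *-monoʳ-≤ 0≤Z (+-mono-≤ (+-monoʳ-≤ _ (near-count 1ᶜ m (m<scale m))) (near-count (ζ i) m (m<scale m))) ⟩
        (X * near 1ᶜ m i + Y + Y) * Z  ∎
        where open ≤-Reasoning

    -- Each of the three conditions in `weight` holds for at most X Y pairs (i, j); for a given
    -- pair, `z` lies in a disc of radius δ about -(1 + x + y), which leaves at most Z values of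
    -- `k`.
    small-count : Σ³ N small ≤ num 3 * (X * Y) * Z
    small-count = begin
      Σ³ N small  ≤⟨ Σ<-mono N {λ i → Σ< N (λ j → Σ< N (small i j))} {λ i → (X * near 1ᶜ m i + Y + Y) * Z} row ⟩
      Σ< N (λ i → (X * near 1ᶜ m i + Y + Y) * Z)  ≈⟨ *-distribʳ-sum {N} Z (λ i → X * near 1ᶜ m (toℕ i) + Y + Y) ⟨
      Σ< N (λ i → X * near 1ᶜ m i + Y + Y) * Z  ≈⟨ *-congʳ (trans (Σ<-+ N (λ i → X * near 1ᶜ m i + Y) (λ _ → Y)) (+-cong (trans (Σ<-+ N (λ i → X * near 1ᶜ m i) (λ _ → Y)) (+-cong (sym (*-distribˡ-sum {N} X (near 1ᶜ m ∘ toℕ))) (sum-const N Y))) (sum-const N Y))) ⟩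
      (X * Σ< N (near 1ᶜ m) + X * Y + X * Y) * Z  ≤⟨ *-monoʳ-≤ 0≤Z (+-monoˡ-≤ _ (+-monoˡ-≤ _ (*-monoˡ-≤ (num-nonneg N) (near-count 1ᶜ m (m<scale m))))) ⟩
      (X * Y + X * Y + X * Y) * Z  ≈⟨ *-congʳ (solve 1 (λ x → x :+ x :+ x := con (+ 3) :* x) refl (X * Y)) ⟩
      num 3 * (X * Y) * Z  ∎
      where open ≤-Reasoning

-- How the truncated quotient changes under refinement.

module StepBounds (em : ExcludedMiddle 0ℓ) (𝓡 : CompleteOrderedField) where
  open Analysis 𝓡
  open OrderedField em 𝓡
  open Complex em 𝓡
  open Circle em 𝓡
  open Truncation em 𝓡
  open Estimates em 𝓡

  -- 16 is the Lipschitz constant of e.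
  mesh : ℕ → ℝ
  mesh m = num 16 * ½^ (scale m)

  mesh≈ : ∀ m → mesh m ≈ ½^ 6 * ½^ m * threshold m
  mesh≈ m = trans (*-congˡ (trans (½^-scale m) (*-congʳ (*-congʳ (½^-+ 4 6)))))
    (trans (solve 5 (λ n a b x t → n :* (a :* b :* x :* t) := n :* a :* (b :* x :* t)) refl (num 16) (½^ 4) (½^ 6) (½^ m) (threshold m))
      (trans (*-congʳ (num2^*½^ 4)) (*-identityˡ _)))

  mesh≤depth : ∀ m → mesh m ≤ ½^ (depth (suc m))
  mesh≤depth m = begin
    mesh m  ≈⟨ mesh≈ m ⟩
    ½^ 6 * ½^ m * (δ * δ)  ≤⟨ *-mono-≤ (*-nonneg (½^-nonneg 6) (½^-nonneg m)) (*-nonneg 0≤δ 0≤δ)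
                                                     (*-mono-≤ (½^-nonneg 6) (½^-nonneg m) (½^-antitone {3} {6} (ℕ.m≤m+n 3 3)) (½^-≤1 m))
                                                     (*-monoˡ-≤ 0≤δ (½^-≤1 (depth m))) ⟩
    ½^ 3 * 1# * (δ * 1#)  ≈⟨ solve 2 (λ h d → h :* (h :* (h :* :1)) :* :1 :* (d :* :1) := h :* (h :* (h :* d))) refl ½ δ ⟩
    ½^ (depth (suc m))  ∎
    where
    open ≤-Reasoning
    δ = ½^ (depth m)
    0≤δ = ½^-nonneg (depth m)

  mesh≤½^ : ∀ m → mesh m ≤ ½^ m
  mesh≤½^ m = ≤-trans (≤-reflexive (mesh≈ m)) (≤-resp refl (solve 1 (λ x → :1 :* x :* (:1 :* :1) := x) refl (½^ m))
    (*-mono-≤ (*-nonneg (½^-nonneg 6) (½^-nonneg m)) (<⇒≤ (threshold-pos m))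
      (*-monoʳ-≤ (½^-nonneg m) (½^-≤1 6))
      (*-mono-≤ (½^-nonneg (depth m)) (½^-nonneg (depth m)) (½^-≤1 (depth m)) (½^-≤1 (depth m)))))

  denominator-⊑ : ∀ {x y z r s t} → x ⊑ r → y ⊑ s → z ⊑ t → denominator x y z ⊑ 1# + r + s + t
  denominator-⊑ x⊑ y⊑ z⊑ = ⊑-+ (⊑-+ (⊑-+ (⊑-fromℝ 0≤1) x⊑) y⊑) z⊑

  denominator-⊑4 : ∀ {x y z} → Unit x → Unit y → Unit z → denominator x y z ⊑ num 4
  denominator-⊑4 ux uy uz = ⊑-cong reflᶜ (solve 0 (:1 :+ :1 :+ :1 :+ :1 := con (+ 4)) refl)
    (denominator-⊑ (unit-⊑ ux) (unit-⊑ uy) (unit-⊑ uz))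

  denominator-lipschitz : ∀ {x y z x′ y′ z′ η} → x′ -ᶜ x ⊑ η → y′ -ᶜ y ⊑ η → z′ -ᶜ z ⊑ η →
                          denominator x′ y′ z′ -ᶜ denominator x y z ⊑ num 3 * η
  denominator-lipschitz {x} {y} {z} {x′} {y′} {z′} {η} Δx Δy Δz = ⊑-cong
    (solveᶜ 6 (λ x y z a b c → (a :-ᶜ x) :+ᶜ (b :-ᶜ y) :+ᶜ (c :-ᶜ z) :=ᶜ (:1ᶜ :+ᶜ a :+ᶜ b :+ᶜ c) :-ᶜ (:1ᶜ :+ᶜ x :+ᶜ y :+ᶜ z)) reflᶜ x y z x′ y′ z′)
    (solve 1 (λ η → η :+ η :+ η := con (+ 3) :* η) refl η)
    (⊑-+ (⊑-+ Δx Δy) Δz)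

  -- The triangle inequality by contraposition: a `p′` inside radius ρ′ would put `p` inside radius
  -- ρ′ + η < ρ.
  stays-large : ∀ {p p′ ρ ρ′ η} → 0# ≤ ρ′ → p′ -ᶜ p ⊑ η → ρ′ + η < ρ → ρ * ρ ≤ ∥ p ∥² → ρ′ * ρ′ ≤ ∥ p′ ∥²
  stays-large {p} {p′} {ρ} {ρ′} {η} 0≤ρ′ Δp lt ρ≤p = ≮⇒≥ λ p′<ρ′ → <⇒≱
    (≤-<-trans (∥∥²-≤ (⊑-cong (solveᶜ 2 (λ p q → q :-ᶜ (q :-ᶜ p) :=ᶜ p) reflᶜ p p′) refl (⊑-- (bounded 0≤ρ′ (<⇒≤ p′<ρ′)) Δp)))
      (square-mono-< (+-nonneg 0≤ρ′ (radius-nonneg Δp)) lt))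
    ρ≤p

  -- Applied to the corners of a parent cell and of a child, and to a point and the corner of the
  -- cell containing it.
  record Close (η : ℝ) (x y z x′ y′ z′ : ℂ) : Set where
    field
      unit-x  : Unit x
      unit-y  : Unit y
      unit-z  : Unit z
      unit-x′ : Unit x′
      unit-y′ : Unit y′
      unit-z′ : Unit z′
      Δx      : x′ -ᶜ x ⊑ η
      Δy      : y′ -ᶜ y ⊑ η
      Δz      : z′ -ᶜ z ⊑ η

  ÷-close : ∀ {η x y z x′ y′ z′ ρ ρ′} → Close η x y z x′ y′ z′ →
            0# < ρ → ρ * ρ ≤ ∥ denominator x y z ∥² → 0# < ρ′ → ρ′ * ρ′ ≤ ∥ denominator x′ y′ z′ ∥² →
            z′ ÷ denominator x′ y′ z′ -ᶜ z ÷ denominator x y z ⊑ num 7 * η * inv ρ * inv ρ′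
  ÷-close {x = x} {y} {z} {x′} {y′} {z′} c 0<ρ ρ≤ 0<ρ′ ρ′≤ = ÷-lipschitz 0<ρ′ ρ′≤ 0<ρ ρ≤
      (unit-⊑ unit-z′) (denominator-⊑4 unit-x′ unit-y′ unit-z′) Δz
      (⊑-cong (solveᶜ 2 (λ p q → :-ᶜ (q :-ᶜ p) :=ᶜ p :-ᶜ q) reflᶜ (denominator x y z) (denominator x′ y′ z′)) refl (⊑-neg (denominator-lipschitz Δx Δy Δz)))
    where open Close c

  module _ (P : Part) where
    open Part P

    part-- : ∀ z w → part (z -ᶜ w) ≈ part z - part w
    part-- z w = trans (part-+ z (-ᶜ w)) (+-congˡ (part-neg w))

    part-close : ∀ {z w r} → z -ᶜ w ⊑ r → ∣ part z - part w ∣ ≤ r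
    part-close {z} {w} Δ = ≤-resp (∣∣-cong (part-- z w)) refl (part-≤ Δ)

    T : ℕ → ℂ → ℂ → ℂ → ℂ
    T m x y z = truncate (threshold m) z (denominator x y z)

    -- Where `p` is small, both values are merely bounded, by 1/δ′ + 1/δ ≤ 2 · 2^(3 + depth).
    -- Elsewhere `p′` stays above the next threshold, so neither value is truncated and the quotient
    -- rule gives 7 · mesh/(δ δ′) ≤ ½^ m.
    step-bound : ∀ m {x y z x′ y′ z′} → Close (mesh m) x y z x′ y′ z′ →
      ∣ part (T (suc m) x′ y′ z′) - part (T m x y z) ∣ ≤
      ½^ m + [ ∥ denominator x y z ∥² < threshold m ] * num (2 ℕ.^ (4 ℕ.+ depth m))
    step-bound m {x} {y} {z} {x′} {y′} {z′} c = [ small-case , large-case ]′ (<-or-≥ ∥ p ∥² (threshold m))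
      where
      open Close c
      p p′ : ℂ
      p = denominator x y z
      p′ = denominator x′ y′ z′
      δ δ′ B : ℝ
      δ = ½^ (depth m)
      δ′ = ½^ (depth (suc m))
      B = num (2 ℕ.^ (4 ℕ.+ depth m))
      small-case : ∥ p ∥² < threshold m → ∣ part (T (suc m) x′ y′ z′) - part (T m x y z) ∣ ≤ ½^ m + [ ∥ p ∥² < threshold m ] * B
      small-case p< = begin
        ∣ part (T (suc m) x′ y′ z′) - part (T m x y z) ∣
          ≤⟨ part-close (⊑-- (truncate-⊑ {p = p′} refl (½^-pos (depth (suc m))) (½^-≤1 (depth (suc m))) (unit-⊑ unit-z′))
                             (truncate-⊑ {p = p} refl (½^-pos (depth m)) (½^-≤1 (depth m)) (unit-⊑ unit-z))) ⟩
        inv δ′ + inv δ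
          ≤⟨ +-mono-≤ (≤-reflexive (inv-½^ (depth (suc m))))
               (≤-trans (≤-reflexive (inv-½^ (depth m))) (num-mono-≤ (ℕ.^-monoʳ-≤ 2 {depth m} {3 ℕ.+ depth m} (ℕ.m≤n+m (depth m) 3)))) ⟩
        num (2 ℕ.^ (3 ℕ.+ depth m)) + num (2 ℕ.^ (3 ℕ.+ depth m))
          ≈⟨ trans (num-* 2 (2 ℕ.^ (3 ℕ.+ depth m))) (solve 1 (λ x → :2 :* x := x :+ x) refl _) ⟨
        B
          ≈⟨ trans (*-congʳ ([<]-true p<)) (*-identityˡ B) ⟨
        [ ∥ p ∥² < threshold m ] * B
          ≤⟨ by-nonneg (½^-nonneg m) (+-comm _ _) ⟩
        ½^ m + [ ∥ p ∥² < threshold m ] * B ∎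
        where open ≤-Reasoning
      large-case : threshold m ≤ ∥ p ∥² → ∣ part (T (suc m) x′ y′ z′) - part (T m x y z) ∣ ≤ ½^ m + [ ∥ p ∥² < threshold m ] * B
      large-case ≤p = begin
        ∣ part (T (suc m) x′ y′ z′) - part (T m x y z) ∣
          ≈⟨ ∣∣-cong (+-cong (part-cong (truncate-large z′ ≤p′)) (-‿cong (part-cong (truncate-large z ≤p)))) ⟩
        ∣ part (z′ ÷ p′) - part (z ÷ p) ∣
          ≤⟨ part-close (÷-close c (½^-pos (depth m)) ≤p (½^-pos (depth (suc m))) ≤p′) ⟩
        num 7 * mesh m * inv δ * inv δ′
          ≈⟨ *-congʳ (*-congʳ (*-congˡ (mesh≈ m))) ⟩
        num 7 * (½^ 6 * ½^ m * (δ * δ)) * inv δ * inv δ′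
          ≈⟨ solve 6 (λ n h x d i j → n :* (h :* (h :* (h :* (h :* (h :* (h :* :1))))) :* x :* (d :* d)) :* i :* j :=
               n :* (h :* (h :* (h :* :1)) :* x) :* (d :* i) :* ((h :* (h :* (h :* d))) :* j)) refl (num 7) ½ (½^ m) δ (inv δ) (inv δ′) ⟩
        num 7 * (½^ 3 * ½^ m) * (δ * inv δ) * (δ′ * inv δ′)
          ≈⟨ trans (*-cong (trans (*-congˡ (inv-inverseʳ (>0⇒≉0 (½^-pos (depth m))))) (*-identityʳ _)) (inv-inverseʳ (>0⇒≉0 (½^-pos (depth (suc m)))))) (*-identityʳ _) ⟩
        num 7 * (½^ 3 * ½^ m)
          ≤⟨ *-monoʳ-≤ (*-nonneg (½^-nonneg 3) (½^-nonneg m)) (num-mono-≤ {7} {8} (ℕ.n≤1+n 7)) ⟩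
        num 8 * (½^ 3 * ½^ m)
          ≈⟨ trans (sym (*-assoc _ _ _)) (trans (*-congʳ (num2^*½^ 3)) (*-identityˡ _)) ⟩
        ½^ m
          ≤⟨ by-nonneg (*-nonneg ([<]-nonneg _ _) (num-nonneg (2 ℕ.^ (4 ℕ.+ depth m)))) refl ⟩
        ½^ m + [ ∥ p ∥² < threshold m ] * B ∎
        where
        open ≤-Reasoning
        -- Here δ′ = δ/8, so that 4 δ′ = δ/2.
        4δ′<δ : δ′ + num 3 * mesh m < δ
        4δ′<δ = begin-strict
          δ′ + num 3 * mesh m  ≤⟨ +-monoʳ-≤ δ′ (*-monoˡ-≤ (num-nonneg 3) (mesh≤depth m)) ⟩
          δ′ + num 3 * δ′  ≈⟨ solve 2 (λ h d → h :* (h :* (h :* d)) :+ con (+ 3) :* (h :* (h :* (h :* d))) := (h :+ h) :* ((h :+ h) :* (h :* d))) refl ½ δ ⟩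
          (½ + ½) * ((½ + ½) * (½ * δ))  ≈⟨ trans (*-cong ½+½≈1 (*-congʳ ½+½≈1)) (trans (*-identityˡ _) (*-identityˡ _)) ⟩
          ½ * δ  <⟨ by-pos (*-pos ½-pos (½^-pos (depth m))) (sym (½^-double (depth m))) ⟩
          δ  ∎
        ≤p′ : threshold (suc m) ≤ ∥ p′ ∥²
        ≤p′ = stays-large (½^-nonneg (depth (suc m))) (denominator-lipschitz Δx Δy Δz) 4δ′<δ ≤p

    -- Once ½^ m ≤ ρ, both δ and the mesh are at most ρ/8. Then |p′| ≥ ρ/2, because ½ + ⅜ < 1, so
    -- the value at level `m` is not truncated and converges at the rate of the mesh.
    limit-bound : ∀ m {ρ x y z x′ y′ z′} → 0# < ρ → ρ * ρ ≤ ∥ denominator x y z ∥² → ½^ m ≤ ρ →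
      Close (mesh m) x y z x′ y′ z′ →
      ∣ part (T m x′ y′ z′) - part (z ÷ denominator x y z) ∣ ≤ num 7 * inv ρ * inv (½ * ρ) * ½^ m
    limit-bound m {ρ} {x} {y} {z} {x′} {y′} {z′} 0<ρ ρ≤p small c = begin
      ∣ part (T m x′ y′ z′) - part (z ÷ p) ∣
        ≈⟨ ∣∣-cong (+-congʳ (part-cong (truncate-large z′ (≤-trans (square-mono-≤ (½^-nonneg (depth m)) δ≤½ρ) ≤p′)))) ⟩
      ∣ part (z′ ÷ p′) - part (z ÷ p) ∣
        ≤⟨ part-close (÷-close c 0<ρ ρ≤p 0<½ρ ≤p′) ⟩
      num 7 * mesh m * inv ρ * inv (½ * ρ)
        ≈⟨ solve 4 (λ n e i j → n :* e :* i :* j := n :* i :* j :* e) refl (num 7) (mesh m) (inv ρ) (inv (½ * ρ)) ⟩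
      num 7 * inv ρ * inv (½ * ρ) * mesh m
        ≤⟨ *-monoˡ-≤ (*-nonneg (*-nonneg (num-nonneg 7) (<⇒≤ (inv-pos 0<ρ))) (<⇒≤ (inv-pos 0<½ρ))) (mesh≤½^ m) ⟩
      num 7 * inv ρ * inv (½ * ρ) * ½^ m ∎
      where
      open ≤-Reasoning
      open Close c
      p p′ : ℂ
      p = denominator x y z
      p′ = denominator x′ y′ z′
      0<½ρ : 0# < ½ * ρ
      0<½ρ = *-pos ½-pos 0<ρ
      depth-small : ½^ (depth m) ≤ ½^ 3 * ρ
      depth-small = ≤-trans (≤-reflexive (½^-depth m)) (*-monoˡ-≤ (½^-nonneg 3) (≤-trans
        (≤-resp refl (solve 1 (λ x → :1 :* :1 :* x := x) refl (½^ m))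
          (*-monoʳ-≤ (½^-nonneg m) (*-mono-≤ (½^-nonneg m) (½^-nonneg m) (½^-≤1 m) (½^-≤1 m)))) small))
      ½^3≤½ : ½^ 3 ≤ ½
      ½^3≤½ = ≤-resp refl (*-identityʳ ½) (½^-antitone {1} {3} (ℕ.s≤s ℕ.z≤n))
      δ≤½ρ : ½^ (depth m) ≤ ½ * ρ
      δ≤½ρ = ≤-trans depth-small (*-monoʳ-≤ (<⇒≤ 0<ρ) ½^3≤½)
      mesh-small : mesh m ≤ ½^ 3 * ρ
      mesh-small = ≤-trans (mesh≤depth m) (≤-trans (½^-antitone {depth m} {3 ℕ.+ depth m} (ℕ.m≤n+m (depth m) 3)) depth-small)
      budget : ½ * ρ + num 3 * mesh m < ρ
      budget = begin-strict
        ½ * ρ + num 3 * mesh m  ≤⟨ +-monoʳ-≤ _ (*-monoˡ-≤ (num-nonneg 3) mesh-small) ⟩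
        ½ * ρ + num 3 * (½^ 3 * ρ)  <⟨ by-pos (*-pos (½^-pos 3) 0<ρ) (solve 2 (λ r x → r :+ con (+ 4) :* x := r :+ con (+ 3) :* x :+ x) refl (½ * ρ) (½^ 3 * ρ)) ⟩
        ½ * ρ + num 4 * (½^ 3 * ρ)  ≈⟨ solve 2 (λ h r → h :* r :+ con (+ 4) :* (h :* (h :* (h :* :1)) :* r) := h :* r :+ (h :+ h) :* ((h :+ h) :* (h :* r))) refl ½ ρ ⟩
        ½ * ρ + (½ + ½) * ((½ + ½) * (½ * ρ))  ≈⟨ +-congˡ (trans (*-cong ½+½≈1 (*-congʳ ½+½≈1)) (trans (*-identityˡ _) (*-identityˡ _))) ⟩
        ½ * ρ + ½ * ρ  ≈⟨ trans (sym (distribʳ ρ ½ ½)) (trans (*-congʳ ½+½≈1) (*-identityˡ ρ)) ⟩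
        ρ  ∎
      ≤p′ : ½ * ρ * (½ * ρ) ≤ ∥ p′ ∥²
      ≤p′ = stays-large (<⇒≤ 0<½ρ) (denominator-lipschitz Δx Δy Δz) budget ρ≤p

-- Series arranged in finite blocks.

module Blocks (em : ExcludedMiddle 0ℓ) (𝓡 : CompleteOrderedField) {X : Set} where
  open Analysis 𝓡
  open OrderedField em 𝓡
  open Series em 𝓡

  -- Nonempty, so that `concatenate` has an element at every index and the first `n` indices lie
  -- within the first `n` blocks.
  Block : Set
  Block = X × List X

  private
    go : X → List X → (ℕ → Block) → ℕ → X
    go x xs       L zero    = x
    go x []       L (suc n) = go (proj₁ (L 0)) (proj₂ (L 0)) (L ∘ suc) n
    go x (y ∷ ys) L (suc n) = go y ys L n

  concatenate : (ℕ → Block) → ℕ → X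
  concatenate L = go (proj₁ (L 0)) (proj₂ (L 0)) (L ∘ suc)

  sumᴸ : (X → ℝ) → List X → ℝ
  sumᴸ φ []       = 0#
  sumᴸ φ (x ∷ xs) = φ x + sumᴸ φ xs

  sumᴮ : (X → ℝ) → Block → ℝ
  sumᴮ φ (x , xs) = φ x + sumᴸ φ xs

  private
    end : (ℕ → Block) → ℕ → ℕ
    end L zero    = 0
    end L (suc M) = suc (length (proj₂ (L 0))) ℕ.+ end (L ∘ suc) M

    M≤end : ∀ L M → M ℕ.≤ end L M
    M≤end L zero    = ℕ.z≤n
    M≤end L (suc M) = ℕ.s≤s (ℕ.≤-trans (M≤end (L ∘ suc) M) (ℕ.m≤n+m _ (length (proj₂ (L 0)))))

    go-sum : ∀ φ x xs L k → Σ< (suc (length xs) ℕ.+ k) (φ ∘ go x xs L) ≈ φ x + sumᴸ φ xs + Σ< k (φ ∘ concatenate L)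
    go-sum φ x []       L k = +-congʳ (sym (+-identityʳ _))
    go-sum φ x (y ∷ ys) L k = trans (+-congˡ (go-sum φ y ys L k)) (sym (+-assoc _ _ _))

    end-sum : ∀ φ L M → Σ< (end L M) (φ ∘ concatenate L) ≈ Σ< M (sumᴮ φ ∘ L)
    end-sum φ L zero    = refl
    end-sum φ L (suc M) = trans (go-sum φ (proj₁ (L 0)) (proj₂ (L 0)) (L ∘ suc) (end (L ∘ suc) M))
      (+-congˡ (end-sum φ (L ∘ suc) M))

  bounded-blocks⇒absolutelySummable : ∀ φ L b → (∀ M → Σ< M (λ m → sumᴮ (λ x → ∣ φ x ∣) (L m)) ≤ b) →
                                      AbsolutelySummable (φ ∘ concatenate L)
  bounded-blocks⇒absolutelySummable φ L b bound = bounded⇒absolutelySummable {φ ∘ concatenate L} b λ n →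
    ≤-trans (Σ<-monoˡ {n} {end L n} {λ i → ∣ φ (concatenate L i) ∣} (λ i → ∣∣-nonneg _) (M≤end L n))
      (≤-trans (≤-reflexive (end-sum (λ x → ∣ φ x ∣) L n)) (bound n))

  absolutelySummable⇒bounded-blocks : ∀ φ L → AbsolutelySummable (φ ∘ concatenate L) →
    ∃[ b ] (∀ M → Σ< M (λ m → sumᴮ (λ x → ∣ φ x ∣) (L m)) ≤ b)
  absolutelySummable⇒bounded-blocks φ L (s , →s) = s , λ M →
    ≤-trans (≤-reflexive (sym (end-sum (λ x → ∣ φ x ∣) L M)))
      (partial≤sum {λ i → ∣ φ (concatenate L i) ∣} (λ i → ∣∣-nonneg _) →s (end L M))

  -- The block sums run through a subsequence of the partial sums. Absolute summability provides a
  -- limit, and this lemma serves to identify it.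
  hasSum⇒hasSum-blocks : ∀ φ L {v} → HasSum (φ ∘ concatenate L) v → HasSum (sumᴮ φ ∘ L) v
  hasSum⇒hasSum-blocks φ L →v = lim-cong (end-sum φ L) refl
    (lim-sub {λ n → Σ< n (φ ∘ concatenate L)} (end L) (M≤end L) →v)

  tabulateᴸ : ∀ n → (Fin n → List X) → List X
  tabulateᴸ zero    f = []
  tabulateᴸ (suc n) f = f Fin.zero ++ tabulateᴸ n (f ∘ Fin.suc)

  sumᴸ-++ : ∀ φ xs ys → sumᴸ φ (xs ++ ys) ≈ sumᴸ φ xs + sumᴸ φ ys
  sumᴸ-++ φ []       ys = sym (+-identityˡ _)
  sumᴸ-++ φ (x ∷ xs) ys = trans (+-congˡ (sumᴸ-++ φ xs ys)) (sym (+-assoc _ _ _))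

  sumᴸ-tabulate : ∀ φ n f → sumᴸ φ (tabulateᴸ n f) ≈ sum {n} (λ i → sumᴸ φ (f i))
  sumᴸ-tabulate φ zero    f = refl
  sumᴸ-tabulate φ (suc n) f = trans (sumᴸ-++ φ (f Fin.zero) _) (+-congˡ (sumᴸ-tabulate φ n (f ∘ Fin.suc)))

  sumᴸ-nonneg : ∀ {φ} → (∀ x → 0# ≤ φ x) → ∀ xs → 0# ≤ sumᴸ φ xs
  sumᴸ-nonneg 0≤φ []       = ≤-refl
  sumᴸ-nonneg 0≤φ (x ∷ xs) = +-nonneg (0≤φ x) (sumᴸ-nonneg 0≤φ xs)

-- Finite sums over product index sets, and boxes.

module Boxes (em : ExcludedMiddle 0ℓ) (𝓡 : CompleteOrderedField) where
  open Analysis 𝓡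
  open OrderedField em 𝓡
  open Series em 𝓡

  sum-++ : ∀ m n (f : Fin (m ℕ.+ n) → ℝ) → sum f ≈ sum {m} (λ i → f (i Fin.↑ˡ n)) + sum {n} (λ i → f (m Fin.↑ʳ i))
  sum-++ zero    n f = sym (+-identityˡ _)
  sum-++ (suc m) n f = trans (+-congˡ (sum-++ m n (f ∘ Fin.suc))) (sym (+-assoc _ _ _))

  sum-combine : ∀ m n (f : Fin (m ℕ.* n) → ℝ) → sum f ≈ sum {m} λ i → sum {n} λ r → f (Fin.combine i r)
  sum-combine zero    n f = refl
  sum-combine (suc m) n f = trans (sum-++ n (m ℕ.* n) f) (+-congˡ (sum-combine m n (λ i → f (n Fin.↑ʳ i))))

  sum-quotient : ∀ m n (f : Fin m → ℝ) → sum {m ℕ.* n} (λ i → f (Fin.quotient n i)) ≈ num n * sum f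
  sum-quotient m n f = trans (sum-combine m n (λ i → f (Fin.quotient n i)))
    (trans (sum-cong {m} {λ i → sum {n} λ r → f (Fin.quotient n (Fin.combine i r))} {λ i → num n * f i} λ i →
        trans (sum-cong {n} {λ r → f (Fin.quotient n (Fin.combine i r))} {λ _ → f i}
          λ r → reflexive (≡.cong (f ∘ proj₁) (Fin.remQuot-combine i r)))
          (sum-const n (f i)))
      (sym (*-distribˡ-sum {m} (num n) f)))

  term≤sum : ∀ n {f : Fin n → ℝ} → (∀ i → 0# ≤ f i) → ∀ i → f i ≤ sum f
  term≤sum (suc n) 0≤f Fin.zero    = by-nonneg (sum-nonneg n (λ i → 0≤f (Fin.suc i))) refl
  term≤sum (suc n) 0≤f (Fin.suc i) = ≤-trans (term≤sum n (λ i → 0≤f (Fin.suc i)) i) (by-nonneg (0≤f Fin.zero) (+-comm _ _))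

  record Interval : Set where
    field
      lo hi : ℝ
      0≤lo  : 0# ≤ lo
      lo≤hi : lo ≤ hi
      hi≤1  : hi ≤ 1#
  open Interval public

  unitInterval : Interval
  unitInterval = record { lo = 0# ; hi = 1# ; 0≤lo = ≤-refl ; lo≤hi = 0≤1 ; hi≤1 = ≤-refl }

  box : ∀ {k} → (Fin k → Interval) → Box k
  box I = record
    { lower = λ i → lo (I i)
    ; upper = λ i → hi (I i)
    ; lower≤upper = λ i → lo≤hi (I i)
    ; lower-cube  = λ i → 0≤lo (I i) , ≤-trans (lo≤hi (I i)) (hi≤1 (I i))
    ; upper-cube  = λ i → ≤-trans (0≤lo (I i)) (lo≤hi (I i)) , hi≤1 (I i)
    }

  triple : ∀ {A : Set} → A → A → A → Fin 3 → A
  triple x y z 0F = x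
  triple x y z 1F = y
  triple x y z 2F = z

  product-nonneg : ∀ k {f : Fin k → ℝ} → (∀ i → 0# ≤ f i) → 0# ≤ product f
  product-nonneg zero    0≤f = 0≤1
  product-nonneg (suc k) 0≤f = *-nonneg (0≤f Fin.zero) (product-nonneg k (λ i → 0≤f (Fin.suc i)))

  volume-nonneg : ∀ {k} (B : Box k) → 0# ≤ volume B
  volume-nonneg {k} B = product-nonneg k (λ i → gap-nonneg (Box.lower≤upper B i))

  private
    if-yes : ∀ {A : Set} (d : Dec A) → A → (if does d then 1# else 0#) ≈ 1#
    if-yes (yes _) a = refl
    if-yes (no ¬a) a = ⊥-elim (¬a a)

    if-no : ∀ {A : Set} (d : Dec A) → ¬ A → (if does d then 1# else 0#) ≈ 0#
    if-no (yes a) ¬a = ⊥-elim (¬a a)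
    if-no (no _)  ¬a = refl

  indicator-inside : ∀ {k} (B : Box k) t → Box._∋_ B t → indicator B t ≈ 1#
  indicator-inside B t = if-yes (Box._∋?_ B t)

  indicator-outside : ∀ {k} (B : Box k) t → ¬ (Box._∋_ B t) → indicator B t ≈ 0#
  indicator-outside B t = if-no (Box._∋?_ B t)

-- Nested grids, and the integrals of the increments.

module GridSeries (em : ExcludedMiddle 0ℓ) (𝓡 : CompleteOrderedField) where
  open Analysis 𝓡
  open OrderedField em 𝓡
  open Series em 𝓡
  open Complex em 𝓡
  open Circle em 𝓡
  open Truncation em 𝓡
  open Estimates em 𝓡
  open StepBounds em 𝓡
  open Boxes em 𝓡

  -- `R` is the refinement ratio and `N₀` the initial number of cells per axis, as prescribed by
  -- `scale`. They are opaque so that `Fin (size m)` is never evaluated at these numbers.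
  abstract
    R N₀ : ℕ
    R  = 2 ℕ.^ 7
    N₀ = 2 ℕ.^ 16

    R≡ : R ≡ 2 ℕ.^ 7
    R≡ = ≡.refl

    N₀≡ : N₀ ≡ 2 ℕ.^ 16
    N₀≡ = ≡.refl

  -- 2 ^ scale m, in the form for which the cell of level m containing a cell of level m + 1 is Fin.quotient.
  size : ℕ → ℕ
  size zero    = N₀
  size (suc m) = size m ℕ.* R

  size≡ : ∀ m → size m ≡ 2 ℕ.^ scale m
  size≡ zero    = N₀≡
  size≡ (suc m) = ≡.trans (≡.cong₂ ℕ._*_ (size≡ m) R≡)
    (≡.trans (ℕ.*-comm (2 ℕ.^ scale m) (2 ℕ.^ 7)) (≡.sym (ℕ.^-distribˡ-+-* 2 7 (scale m))))

  width : ℕ → ℝ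
  width m = ½^ (scale m)

  width-nonneg : ∀ m → 0# ≤ width m
  width-nonneg m = ½^-nonneg (scale m)

  size*width : ∀ m → num (size m) * width m ≈ 1#
  size*width m = trans (*-congʳ (reflexive (≡.cong num (size≡ m)))) (num2^*½^ (scale m))

  R*width : ∀ m → num R * width (suc m) ≈ width m
  R*width m = trans (*-cong (reflexive (≡.cong num R≡)) (½^-+ 7 (scale m)))
    (trans (sym (*-assoc _ _ _)) (trans (*-congʳ (num2^*½^ 7)) (*-identityˡ _)))

  grid : ℕ → ℕ → ℝ
  grid m i = num i * width m

  grid-≤1 : ∀ m {i} → i ℕ.≤ size m → grid m i ≤ 1#
  grid-≤1 m i≤ = ≤-trans (*-monoʳ-≤ (width-nonneg m) (num-mono-≤ i≤)) (≤-reflexive (size*width m))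

  grid-nonneg : ∀ m i → 0# ≤ grid m i
  grid-nonneg m i = *-nonneg (num-nonneg i) (width-nonneg m)

  grid-suc : ∀ m i → grid m (suc i) ≈ grid m i + width m
  grid-suc m i = trans (*-congʳ (num-suc i)) (solve 2 (λ n w → (:1 :+ n) :* w := n :* w :+ w) refl (num i) (width m))

  cell : ∀ m → Fin (size m) → Interval
  cell m i = record
    { lo = grid m (toℕ i) ; hi = grid m (suc (toℕ i))
    ; 0≤lo = grid-nonneg m (toℕ i)
    ; lo≤hi = by-nonneg (width-nonneg m) (grid-suc m (toℕ i))
    ; hi≤1 = grid-≤1 m (Fin.toℕ<n i)
    }

  cell-length : ∀ m i → hi (cell m i) - lo (cell m i) ≈ width m
  cell-length m i = trans (+-congʳ (grid-suc m (toℕ i))) (solve 2 (λ x w → x :+ w :- x := w) refl _ (width m))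

  face : ∀ m → Fin (suc (size m)) → Interval
  face m j = record
    { lo = grid m (toℕ j) ; hi = grid m (toℕ j)
    ; 0≤lo = grid-nonneg m (toℕ j) ; lo≤hi = ≤-refl ; hi≤1 = grid-≤1 m (ℕ.≤-pred (Fin.toℕ<n j))
    }

  cellBox : ∀ m → (i j k : Fin (size m)) → Box 3
  cellBox m i j k = box (triple (cell m i) (cell m j) (cell m k))

  cellVolume : ℕ → ℝ
  cellVolume m = width m * (width m * (width m * 1#))

  volume-cellBox : ∀ m i j k → volume (cellBox m i j k) ≈ cellVolume m
  volume-cellBox m i j k = *-cong (cell-length m i) (*-cong (cell-length m j) (*-congʳ (cell-length m k)))

  cellVolume-nonneg : ∀ m → 0# ≤ cellVolume m
  cellVolume-nonneg m = *-nonneg (width-nonneg m) (*-nonneg (width-nonneg m) (*-nonneg (width-nonneg m) 0≤1))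

  -- Takes the decision as an argument, so that lemmas about `faceBox` can match on it.
  slab : ∀ {k} {a : Fin k} → Interval → ∀ {b} → Dec (a ≡ b) → Interval
  slab I (yes _) = I
  slab I (no _)  = unitInterval

  faceBox : ∀ m → Fin 3 → Fin (suc (size m)) → Box 3
  faceBox m a j = box λ b → slab (face m j) (a Fin.≟ b)

  volume-faceBox : ∀ m a j → volume (faceBox m a j) ≈ 0#
  volume-faceBox m a j = product-zero 3 {λ b → Box.upper (faceBox m a j) b - Box.lower (faceBox m a j) b} a (flat (a Fin.≟ a))
    where
    product-zero : ∀ k {f : Fin k → ℝ} a → f a ≈ 0# → product f ≈ 0#
    product-zero (suc k) Fin.zero    f0≈0 = trans (*-congʳ f0≈0) (zeroˡ _)
    product-zero (suc k) (Fin.suc a) fa≈0 = trans (*-congˡ (product-zero k a fa≈0)) (zeroʳ _)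
    flat : (d : Dec (a ≡ a)) → hi (slab (face m j) d) - lo (slab (face m j) d) ≈ 0#
    flat (yes _) = -‿inverseʳ _
    flat (no ¬p) = ⊥-elim (¬p ≡.refl)

  faceBox-inside : ∀ m a j t → UnitCube t → t a ≈ grid m (toℕ j) → Box._∋_ (faceBox m a j) t
  faceBox-inside m a j t t∈cube ta≈ b = inside (a Fin.≟ b)
    where
    inside : (d : Dec (a ≡ b)) → lo (slab (face m j) d) ≤ t b × t b ≤ hi (slab (face m j) d)
    inside (yes ≡.refl) = ≤-reflexive (sym ta≈) , ≤-reflexive ta≈
    inside (no _)       = t∈cube b

  sum³ : ∀ n → (Fin n → Fin n → Fin n → ℝ) → ℝ
  sum³ n f = sum {n} λ i → sum {n} λ j → sum {n} λ k → f i j k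

  sum³-mono : ∀ n {f g} → (∀ i j k → f i j k ≤ g i j k) → sum³ n f ≤ sum³ n g
  sum³-mono n {f} {g} f≤g =
    sum-mono n {λ i → sum {n} λ j → sum {n} (f i j)} {λ i → sum {n} λ j → sum {n} (g i j)} λ i →
    sum-mono n {λ j → sum {n} (f i j)} {λ j → sum {n} (g i j)} λ j →
    sum-mono n {f i j} {g i j} (f≤g i j)

  sum³-cong : ∀ n {f g} → (∀ i j k → f i j k ≈ g i j k) → sum³ n f ≈ sum³ n g
  sum³-cong n {f} {g} f≈g =
    sum-cong {n} {λ i → sum {n} λ j → sum {n} (f i j)} {λ i → sum {n} λ j → sum {n} (g i j)} λ i →
    sum-cong {n} {λ j → sum {n} (f i j)} {λ j → sum {n} (g i j)} λ j →
    sum-cong {n} {f i j} {g i j} (f≈g i j)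

  sum³-+ : ∀ n f g → sum³ n (λ i j k → f i j k + g i j k) ≈ sum³ n f + sum³ n g
  sum³-+ n f g = trans
    (sum-cong {n} {λ i → sum {n} λ j → sum {n} λ k → f i j k + g i j k} {λ i → sum {n} (λ j → sum {n} (f i j)) + sum {n} (λ j → sum {n} (g i j))} λ i → trans
      (sum-cong {n} {λ j → sum {n} λ k → f i j k + g i j k} {λ j → sum {n} (f i j) + sum {n} (g i j)} λ j → sum-+ {n} (f i j) (g i j))
      (sum-+ {n} (λ j → sum {n} (f i j)) (λ j → sum {n} (g i j))))
    (sum-+ {n} (λ i → sum {n} λ j → sum {n} (f i j)) (λ i → sum {n} λ j → sum {n} (g i j)))

  sum³-*ʳ : ∀ n f c → sum³ n (λ i j k → f i j k * c) ≈ sum³ n f * c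
  sum³-*ʳ n f c = sym (trans
    (*-distribʳ-sum {n} c (λ i → sum {n} λ j → sum {n} (f i j)))
    (sum-cong {n} {λ i → sum {n} (λ j → sum {n} (f i j)) * c} {λ i → sum {n} λ j → sum {n} λ k → f i j k * c} λ i → trans
      (*-distribʳ-sum {n} c (λ j → sum {n} (f i j)))
      (sum-cong {n} {λ j → sum {n} (f i j) * c} {λ j → sum {n} λ k → f i j k * c} λ j → *-distribʳ-sum {n} c (f i j))))

  sum³-const : ∀ n c → sum³ n (λ _ _ _ → c) ≈ num n * (num n * (num n * c))
  sum³-const n c = trans (sum-const n _) (*-congˡ (trans (sum-const n _) (*-congˡ (sum-const n c))))

  parent : ∀ {m} → Fin (size (suc m)) → Fin (size m)
  parent = Fin.quotient R

  sum³-parent : ∀ m f → sum³ (size (suc m)) (λ i j k → f (parent {m} i) (parent {m} j) (parent {m} k)) ≈ num R * num R * num R * sum³ (size m) f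
  sum³-parent m f = begin
    sum³ (n ℕ.* R) (λ i j k → f (q i) (q j) (q k))
      ≈⟨ sum-cong {n ℕ.* R} {λ i → sum {n ℕ.* R} λ j → sum {n ℕ.* R} λ k → f (q i) (q j) (q k)} {λ i → r * (r * g (q i))} (λ i → trans
           (sum-cong {n ℕ.* R} {λ j → sum {n ℕ.* R} λ k → f (q i) (q j) (q k)} {λ j → r * sum {n} (f (q i) (q j))} λ j → sum-quotient n R (f (q i) (q j)))
           (trans (sym (*-distribˡ-sum {n ℕ.* R} r (λ j → sum {n} (f (q i) (q j))))) (*-congˡ (sum-quotient n R (λ j → sum {n} (f (q i) j)))))) ⟩
    sum {n ℕ.* R} (λ i → r * (r * g (q i)))
      ≈⟨ sum-quotient n R (λ i → r * (r * g i)) ⟩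
    r * sum {n} (λ i → r * (r * g i))
      ≈⟨ *-congˡ (trans (*-congˡ (*-distribˡ-sum {n} r g)) (*-distribˡ-sum {n} r (λ i → r * g i))) ⟨
    r * (r * (r * sum {n} g))
      ≈⟨ solve 2 (λ r x → r :* (r :* (r :* x)) := r :* r :* r :* x) refl r (sum {n} g) ⟩
    r * r * r * sum³ n f ∎
    where
    open ≈-Reasoning
    n = size m
    r = num R
    q : Fin (n ℕ.* R) → Fin n
    q = parent {m}
    g : Fin n → ℝ
    g i = sum {n} λ j → sum {n} (f i j)

  -- Writes the child's index as R q + r with parent `q`; s = 0 gives the lower end of the child and
  -- s = 1 the upper end.
  parent-offset : ∀ m (i : Fin (size (suc m))) → ∃[ r ] suc r ℕ.≤ R × (∀ s → grid (suc m) (s ℕ.+ toℕ i) ≈ grid m (toℕ (parent {m} i)) + num (s ℕ.+ r) * width (suc m))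
  parent-offset m i = toℕ r , Fin.toℕ<n r , λ s → begin
    num (s ℕ.+ toℕ i) * w  ≡⟨ ≡.cong (λ x → num (s ℕ.+ x) * w) toℕ-i ⟩
    num (s ℕ.+ (R ℕ.* toℕ q ℕ.+ toℕ r)) * w  ≈⟨ *-congʳ (trans (num-+ s _) (+-congˡ (trans (num-+ (R ℕ.* toℕ q) (toℕ r)) (+-congʳ (num-* R (toℕ q)))))) ⟩
    (num s + (num R * num (toℕ q) + num (toℕ r))) * w  ≈⟨ solve 5 (λ s r q o w → (s :+ (r :* q :+ o)) :* w := q :* (r :* w) :+ (s :+ o) :* w) refl (num s) (num R) (num (toℕ q)) (num (toℕ r)) w ⟩
    num (toℕ q) * (num R * w) + (num s + num (toℕ r)) * w  ≈⟨ +-cong (*-congˡ (R*width m)) (*-congʳ (sym (num-+ s (toℕ r)))) ⟩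
    grid m (toℕ q) + num (s ℕ.+ toℕ r) * w  ∎
    where
    open ≈-Reasoning
    w = width (suc m)
    q = parent {m} i
    r = Fin.remainder {size m} R i
    toℕ-i : toℕ i ≡ R ℕ.* toℕ q ℕ.+ toℕ r
    toℕ-i = ≡.trans (≡.cong toℕ (≡.sym (Fin.combine-remQuot {size m} R i))) (Fin.toℕ-combine q r)

  offset-≤ : ∀ m {r} → r ℕ.≤ R → num r * width (suc m) ≤ width m
  offset-≤ m r≤R = ≤-trans (*-monoʳ-≤ (width-nonneg (suc m)) (num-mono-≤ r≤R)) (≤-reflexive (R*width m))

  parent-lo : ∀ m i → lo (cell m (parent {m} i)) ≤ lo (cell (suc m) i)
  parent-lo m i = let r , _ , eq = parent-offset m i in
    by-nonneg (*-nonneg (num-nonneg r) (width-nonneg (suc m))) (eq 0)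

  parent-hi : ∀ m i → hi (cell (suc m) i) ≤ hi (cell m (parent {m} i))
  parent-hi m i = let r , r<R , eq = parent-offset m i in begin
    grid (suc m) (suc (toℕ i))  ≈⟨ eq 1 ⟩
    grid m (toℕ (parent {m} i)) + num (suc r) * width (suc m)  ≤⟨ +-monoʳ-≤ _ (offset-≤ m r<R) ⟩
    grid m (toℕ (parent {m} i)) + width m  ≈⟨ grid-suc m (toℕ (parent {m} i)) ⟨
    grid m (suc (toℕ (parent {m} i)))  ∎
    where open ≤-Reasoning

  ζ : ∀ m → Fin (size m) → ℂ
  ζ m i = e (grid m (toℕ i))

  e-mesh : ∀ m {s t} → s ≤ t → t ≤ s + width m → e t -ᶜ e s ⊑ mesh m
  e-mesh m {s} {t} s≤t t≤ = ⊑-weaken (*-monoˡ-≤ (num-nonneg 16) (begin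
      ∣ t - s ∣  ≈⟨ ∣∣-nonneg-≈ (gap-nonneg s≤t) ⟩
      t - s  ≤⟨ +-monoˡ-≤ (- s) t≤ ⟩
      s + width m - s  ≈⟨ solve 2 (λ s w → s :+ w :- s := w) refl s (width m) ⟩
      width m  ∎)) (e-lipschitz t s)
    where open ≤-Reasoning

  ζ-parent : ∀ m i → ζ (suc m) i -ᶜ ζ m (parent {m} i) ⊑ mesh m
  ζ-parent m i = e-mesh m (parent-lo m i) (≤-trans (lo≤hi (cell (suc m) i)) (≤-trans (parent-hi m i) (≤-reflexive (grid-suc m (toℕ (parent {m} i))))))

  module _ (P : Part) where
    open Part P

    value : ∀ m → (i j k : Fin (size m)) → ℝ
    value m i j k = part (T P m (ζ m i) (ζ m j) (ζ m k))

    -- The series telescopes: its partial sums are the step functions with the given values.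
    coefficients : ∀ m → (i j k : Fin (size m)) → ℝ
    coefficients zero    i j k = value 0 i j k
    coefficients (suc m) i j k = value (suc m) i j k - value m (parent {m} i) (parent {m} j) (parent {m} k)

    ∫ : ∀ m → ((i j k : Fin (size m)) → ℝ) → ℝ
    ∫ m f = sum³ (size m) (λ i j k → f i j k * volume (cellBox m i j k))

    ∫≈ : ∀ m f → ∫ m f ≈ sum³ (size m) f * cellVolume m
    ∫≈ m f = trans (sum³-cong (size m) λ i j k → *-congˡ (volume-cellBox m i j k)) (sum³-*ʳ (size m) f (cellVolume m))

    private
      cube*volume : ∀ m c → num (size m) * (num (size m) * (num (size m) * c)) * cellVolume m ≈ c
      cube*volume m c = trans (solve 3 (λ n w c → n :* (n :* (n :* c)) :* (w :* (w :* (w :* :1))) := (n :* w) :* (n :* w) :* (n :* w) :* c) refl (num (size m)) (width m) c)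
        (trans (*-congʳ (*-cong (*-cong (size*width m) (size*width m)) (size*width m))) (solve 1 (λ c → :1 :* :1 :* :1 :* c := c) refl c))

      R³volume : ∀ m → num R * num R * num R * cellVolume (suc m) ≈ cellVolume m
      R³volume m = trans (solve 2 (λ r w → r :* r :* r :* (w :* (w :* (w :* :1))) := (r :* w) :* ((r :* w) :* ((r :* w) :* :1))) refl (num R) (width (suc m)))
        (*-cong (R*width m) (*-cong (R*width m) (*-congʳ (R*width m))))

      ∫-parent : ∀ m f → ∫ (suc m) (λ i j k → f (parent {m} i) (parent {m} j) (parent {m} k)) ≈ sum³ (size m) f * cellVolume m
      ∫-parent m f = trans (∫≈ (suc m) _) (trans (*-congʳ (sum³-parent m f))
        (trans (solve 3 (λ r s v → r :* s :* v := s :* (r :* v)) refl (num R * num R * num R) (sum³ (size m) f) (cellVolume (suc m))) (*-congˡ (R³volume m))))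

    I : ℝ
    I = part (fromℝ ¼)

    ∫-value : ∀ m → sum³ (size m) (value m) * cellVolume m ≈ I
    ∫-value m = trans (*-congʳ (trans (convert (size≡ m)) (trans (Mean.truncate-mean P (scale m) (threshold-pos m)) (sym back)))) (cube*volume m I)
      where
      f : ℕ → ℕ → ℕ → ℝ
      f i j k = part (T P m (e (grid m i)) (e (grid m j)) (e (grid m k)))
      convert : ∀ {N} → size m ≡ N → Σ³ (size m) f ≈ Σ³ N f
      convert eq = reflexive (≡.cong (λ N → Σ³ N f) eq)
      back : num (size m) * (num (size m) * (num (size m) * I)) ≈ num (2 ℕ.^ scale m) * (num (2 ℕ.^ scale m) * (num (2 ℕ.^ scale m) * I))
      back = reflexive (≡.cong (λ N → num N * (num N * (num N * I))) (size≡ m))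

    ∫-coefficients₀ : ∫ 0 (coefficients 0) ≈ I
    ∫-coefficients₀ = trans (∫≈ 0 (value 0)) (∫-value 0)

    ∫-coefficients₊ : ∀ m → ∫ (suc m) (coefficients (suc m)) ≈ 0#
    ∫-coefficients₊ m = begin
      ∫ (suc m) (coefficients (suc m))
        ≈⟨ sum³-cong (size (suc m)) (λ i j k → solve 3 (λ a b v → (a :- b) :* v := a :* v :+ b :* v :* (:- :1)) refl (value (suc m) i j k) (old i j k) (volume (cellBox (suc m) i j k))) ⟩
      sum³ (size (suc m)) (λ i j k → value (suc m) i j k * volume (cellBox (suc m) i j k) + old i j k * volume (cellBox (suc m) i j k) * - 1#)
        ≈⟨ sum³-+ (size (suc m)) (λ i j k → value (suc m) i j k * volume (cellBox (suc m) i j k)) (λ i j k → old i j k * volume (cellBox (suc m) i j k) * - 1#) ⟩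
      ∫ (suc m) (value (suc m)) + sum³ (size (suc m)) (λ i j k → old i j k * volume (cellBox (suc m) i j k) * - 1#)
        ≈⟨ +-cong (trans (∫≈ (suc m) (value (suc m))) (∫-value (suc m)))
             (trans (sum³-*ʳ (size (suc m)) (λ i j k → old i j k * volume (cellBox (suc m) i j k)) (- 1#)) (*-congʳ (trans (∫-parent m (value m)) (∫-value m)))) ⟩
      I + I * - 1#
        ≈⟨ solve 1 (λ x → x :+ x :* (:- :1) := :0) refl I ⟩
      0# ∎
      where
      open ≈-Reasoning
      old : (i j k : Fin (size (suc m))) → ℝ
      old i j k = value m (parent {m} i) (parent {m} j) (parent {m} k)

    private
      B : ℕ → ℝ
      B m = num (2 ℕ.^ (4 ℕ.+ depth m))

      isSmall : ∀ m → (i j k : Fin (size m)) → ℝ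
      isSmall m i j k = [ ∥ denominator (ζ m i) (ζ m j) (ζ m k) ∥² < threshold m ]

      coefficient-bound : ∀ m i j k →
        ∣ coefficients (suc m) i j k ∣ ≤ ½^ m + isSmall m (parent {m} i) (parent {m} j) (parent {m} k) * B m
      coefficient-bound m i j k = step-bound P m record
        { unit-x = e-conj _ ; unit-y = e-conj _ ; unit-z = e-conj _
        ; unit-x′ = e-conj _ ; unit-y′ = e-conj _ ; unit-z′ = e-conj _
        ; Δx = ζ-parent m i ; Δy = ζ-parent m j ; Δz = ζ-parent m k
        }

      small-volume : ∀ m → sum³ (size m) (isSmall m) * cellVolume m ≤ num 3 * (½^ m * ½^ (depth m))
      small-volume m = begin
        sum³ (size m) (isSmall m) * cellVolume m
          ≤⟨ *-monoʳ-≤ (cellVolume-nonneg m) (≤-trans (≤-reflexive (reflexive (≡.cong (λ N → Σ³ N (Grid.small m)) (size≡ m)))) (≤-trans (Grid.small-count m)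
               (≤-reflexive (reflexive (≡.cong (λ N → num 3 * (num N * (num N * ½^ m)) * (num N * ½^ (depth m))) (≡.sym (size≡ m))))))) ⟩
        num 3 * (n * (n * ½^ m)) * (n * ½^ (depth m)) * cellVolume m
          ≈⟨ *-congʳ (solve 4 (λ t n x d → t :* (n :* (n :* x)) :* (n :* d) := n :* (n :* (n :* (t :* (x :* d))))) refl (num 3) n (½^ m) (½^ (depth m))) ⟩
        n * (n * (n * (num 3 * (½^ m * ½^ (depth m))))) * cellVolume m
          ≈⟨ cube*volume m _ ⟩
        num 3 * (½^ m * ½^ (depth m)) ∎
        where
        open ≤-Reasoning
        n = num (size m)

    -- The term ½^ m comes from the Lipschitz estimate. The small cells have height 16/δ and total
    -- volume at most 3 δ ½^ m, which contributes 48; the δ cancels.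
    ∫-∣coefficients∣ : ∀ m → ∫ (suc m) (λ i j k → ∣ coefficients (suc m) i j k ∣) ≤ num 49 * ½^ m
    ∫-∣coefficients∣ m = begin
      ∫ (suc m) (λ i j k → ∣ coefficients (suc m) i j k ∣)
        ≤⟨ sum³-mono (size (suc m)) (λ i j k → ≤-trans (*-monoʳ-≤ (volume-nonneg (cellBox (suc m) i j k)) (coefficient-bound m i j k)) (≤-reflexive (distribʳ _ _ _))) ⟩
      sum³ (size (suc m)) (λ i j k → ½^ m * volume (cellBox (suc m) i j k) + s i j k * B m * volume (cellBox (suc m) i j k))
        ≈⟨ sum³-+ (size (suc m)) (λ i j k → ½^ m * volume (cellBox (suc m) i j k)) (λ i j k → s i j k * B m * volume (cellBox (suc m) i j k)) ⟩
      ∫ (suc m) (λ _ _ _ → ½^ m) + ∫ (suc m) (λ i j k → s i j k * B m)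
        ≈⟨ +-cong (trans (∫≈ (suc m) (λ _ _ _ → ½^ m)) (trans (*-congʳ (sum³-const (size (suc m)) (½^ m))) (cube*volume (suc m) (½^ m))))
             (trans (∫-parent m (λ i j k → isSmall m i j k * B m)) (trans (*-congʳ (sum³-*ʳ (size m) (isSmall m) (B m)))
               (solve 3 (λ s b v → s :* b :* v := b :* (s :* v)) refl _ (B m) (cellVolume m)))) ⟩
      ½^ m + B m * (sum³ (size m) (isSmall m) * cellVolume m)
        ≤⟨ +-monoʳ-≤ _ (*-monoˡ-≤ (num-nonneg (2 ℕ.^ (4 ℕ.+ depth m))) (small-volume m)) ⟩
      ½^ m + B m * (num 3 * (½^ m * ½^ (depth m)))
        ≈⟨ +-congˡ (trans (*-congʳ B≈) (solve 3 (λ b x d → con (+ 16) :* b :* (con (+ 3) :* (x :* d)) := con (+ 48) :* ((b :* d) :* x)) refl (num (2 ℕ.^ depth m)) (½^ m) (½^ (depth m)))) ⟩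
      ½^ m + num 48 * ((num (2 ℕ.^ depth m) * ½^ (depth m)) * ½^ m)
        ≈⟨ +-congˡ (*-congˡ (trans (*-congʳ (num2^*½^ (depth m))) (*-identityˡ _))) ⟩
      ½^ m + num 48 * ½^ m
        ≈⟨ solve 1 (λ x → x :+ con (+ 48) :* x := con (+ 49) :* x) refl (½^ m) ⟩
      num 49 * ½^ m ∎
      where
      open ≤-Reasoning
      s : (i j k : Fin (size (suc m))) → ℝ
      s i j k = isSmall m (parent {m} i) (parent {m} j) (parent {m} k)
      B≈ : B m ≈ num 16 * num (2 ℕ.^ depth m)
      B≈ = trans (reflexive (≡.cong num (ℕ.^-distribˡ-+-* 2 4 (depth m)))) (num-* 16 (2 ℕ.^ depth m))

-- The series of boxes and its integral.

module Integral (em : ExcludedMiddle 0ℓ) (𝓡 : CompleteOrderedField) where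
  open Analysis 𝓡
  open OrderedField em 𝓡
  open Series em 𝓡
  open Complex em 𝓡
  open Circle em 𝓡
  open Truncation em 𝓡
  open Estimates em 𝓡
  open StepBounds em 𝓡
  open Boxes em 𝓡
  open GridSeries em 𝓡

  Item : Set
  Item = ℝ × Box 3

  open Blocks em 𝓡 {Item}

  term : (Box 3 → ℝ) → Item → ℝ
  term w (a , B) = a * w B

  OnFace : ℕ → ℝ → Set
  OnFace m t = ∃[ j ] j ℕ.≤ size m × t ≈ grid m j

  -- The grids are nested, so a point on one face meets a face in every later block.
  onFace-suc : ∀ m {t} → OnFace m t → OnFace (suc m) t
  onFace-suc m (j , j≤ , t≈) = j ℕ.* R , ℕ.*-monoˡ-≤ R j≤ , trans t≈ (begin
    num j * width m  ≈⟨ *-congˡ (R*width m) ⟨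
    num j * (num R * width (suc m))  ≈⟨ *-assoc _ _ _ ⟨
    num j * num R * width (suc m)  ≈⟨ *-congʳ (num-* j R) ⟨
    num (j ℕ.* R) * width (suc m)  ∎)
    where open ≈-Reasoning

  module _ (P : Part) where
    open Part P

    faceItems : ∀ m → Fin 3 → Fin (suc (size m)) → List Item
    faceItems m a j = (1# , faceBox m a j) ∷ (- 1# , faceBox m a j) ∷ []

    cells faces : ∀ m → List Item
    cells m = tabulateᴸ (size m) λ i → tabulateᴸ (size m) λ j → tabulateᴸ (size m) λ k →
      (coefficients P m i j k , cellBox m i j k) ∷ []
    faces m = tabulateᴸ 3 λ a → tabulateᴸ (suc (size m)) (faceItems m a)

    -- Carries the zero term that heads each block, since a `Block` has to be nonempty.
    wholeCube : Box 3
    wholeCube = box λ _ → unitInterval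

    -- The terms ±1 on the faces have volume 0 but make the series diverge on all faces.
    block : ℕ → Block
    block m = (0# , wholeCube) , cells m ++ faces m

    sum-cells : ∀ ψ m → sumᴸ ψ (cells m) ≈ sum³ (size m) (λ i j k → ψ (coefficients P m i j k , cellBox m i j k))
    sum-cells ψ m = trans
      (sumᴸ-tabulate ψ n λ i → tabulateᴸ n λ j → tabulateᴸ n (item i j))
      (sum-cong {n} {λ i → sumᴸ ψ (tabulateᴸ n λ j → tabulateᴸ n (item i j))} {λ i → sum {n} λ j → sum {n} λ k → f i j k} λ i → trans
        (sumᴸ-tabulate ψ n λ j → tabulateᴸ n (item i j))
        (sum-cong {n} {λ j → sumᴸ ψ (tabulateᴸ n (item i j))} {λ j → sum {n} λ k → f i j k} λ j → trans
          (sumᴸ-tabulate ψ n (item i j))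
          (sum-cong {n} {λ k → sumᴸ ψ (item i j k)} {f i j} λ k → +-identityʳ _)))
      where
      n = size m
      f : (i j k : Fin n) → ℝ
      f i j k = ψ (coefficients P m i j k , cellBox m i j k)
      item : (i j k : Fin n) → List Item
      item i j k = (coefficients P m i j k , cellBox m i j k) ∷ []

    sum-faces : ∀ ψ m → sumᴸ ψ (faces m) ≈ sum {3} (λ a → sum {suc (size m)} λ j → sumᴸ ψ (faceItems m a j))
    sum-faces ψ m = trans
      (sumᴸ-tabulate ψ 3 λ a → tabulateᴸ (suc (size m)) (faceItems m a))
      (sum-cong {3} {λ a → sumᴸ ψ (tabulateᴸ (suc (size m)) (faceItems m a))} {λ a → sum {suc (size m)} λ j → sumᴸ ψ (faceItems m a j)}
        λ a → sumᴸ-tabulate ψ (suc (size m)) (faceItems m a))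

    sum-block : ∀ ψ m → ψ (0# , wholeCube) ≈ 0# → (∀ a j → sumᴸ ψ (faceItems m a j) ≈ 0#) →
      sumᴮ ψ (block m) ≈ sum³ (size m) (λ i j k → ψ (coefficients P m i j k , cellBox m i j k))
    sum-block ψ m dummy≈0 faces≈0 = begin
      ψ (0# , wholeCube) + sumᴸ ψ (cells m ++ faces m)  ≈⟨ +-cong dummy≈0 (sumᴸ-++ ψ (cells m) (faces m)) ⟩
      0# + (sumᴸ ψ (cells m) + sumᴸ ψ (faces m))  ≈⟨ +-identityˡ _ ⟩
      sumᴸ ψ (cells m) + sumᴸ ψ (faces m)  ≈⟨ +-cong (sum-cells ψ m) (trans (sum-faces ψ m)
                                                             (sum-zero 3 {λ a → sum {suc (size m)} λ j → sumᴸ ψ (faceItems m a j)} λ a → sum-zero (suc (size m)) (faces≈0 a))) ⟩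
      sum³ (size m) _ + 0#  ≈⟨ +-identityʳ _ ⟩
      sum³ (size m) _  ∎
      where open ≈-Reasoning

    -- Used with volumes and with indicators: the terms +1 and -1 on a face cancel under any weight.
    sum-block-term : ∀ w m → sumᴮ (term w) (block m) ≈ sum³ (size m) (λ i j k → coefficients P m i j k * w (cellBox m i j k))
    sum-block-term w m = sum-block (term w) m (zeroˡ _)
      λ a j → solve 1 (λ x → :1 :* x :+ ((:- :1) :* x :+ :0) := :0) refl (w (faceBox m a j))

    private
      ∣0∣ : ∀ {x} → x ≈ 0# → ∣ x ∣ ≈ 0#
      ∣0∣ x≈0 = trans (∣∣-cong x≈0) (∣∣-nonneg-≈ ≤-refl)

    -- With absolute values the two terms on a face no longer cancel, but the face has volume 0.
    sum-block-∣volume∣ : ∀ m → sumᴮ (λ x → ∣ term volume x ∣) (block m) ≈ ∫ P m (λ i j k → ∣ coefficients P m i j k ∣)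
    sum-block-∣volume∣ m = trans
      (sum-block (λ x → ∣ term volume x ∣) m (∣0∣ (zeroˡ _)) λ a j →
        trans (+-cong (flat a j 1#) (trans (+-congʳ (flat a j (- 1#))) (+-identityʳ 0#))) (+-identityʳ 0#))
      (sum³-cong (size m) λ i j k → ∣x*y∣≈∣x∣*y (coefficients P m i j k) (volume-nonneg (cellBox m i j k)))
      where
      flat : ∀ a j c → ∣ c * volume (faceBox m a j) ∣ ≈ 0#
      flat a j c = ∣0∣ (trans (*-congˡ (volume-faceBox m a j)) (zeroʳ c))

    integral-absolutelySummable : AbsolutelySummable (term volume ∘ concatenate block)
    integral-absolutelySummable = bounded-blocks⇒absolutelySummable (term volume) block (b₀ + num 49 * (1# + 1#)) bound
      where
      β : ℕ → ℝ
      β m = sumᴮ (λ x → ∣ term volume x ∣) (block m)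
      b₀ = β 0
      0≤β : ∀ m → 0# ≤ β m
      0≤β m = +-nonneg (∣∣-nonneg (term volume (0# , wholeCube))) (sumᴸ-nonneg (λ x → ∣∣-nonneg _) (cells m ++ faces m))
      bound : ∀ M → Σ< M β ≤ b₀ + num 49 * (1# + 1#)
      -- Block 0 is no increment and is kept apart as `b₀`; the others are dominated by 49 times a
      -- geometric series with sum at most 2.
      bound M = ≤-trans (Σ<-monoˡ {M} {suc M} 0≤β (ℕ.n≤1+n M)) (+-monoʳ-≤ b₀ (≤-trans
        (Σ<-mono M {β ∘ suc} {λ m → num 49 * ½^ m} λ m → ≤-trans (≤-reflexive (sum-block-∣volume∣ (suc m))) (∫-∣coefficients∣ P m))
        (≤-trans (≤-reflexive (sym (*-distribˡ-sum {M} (num 49) (λ i → ½^ (toℕ i))))) (*-monoˡ-≤ (num-nonneg 49) (Σ<-½^-≤2 M)))))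

    -- After each nonempty run of whole blocks the sum is exactly `I P`, so the limit, which exists
    -- by absolute summability, is `I P`.
    integral-hasSum : HasSum (term volume ∘ concatenate block) (I P)
    integral-hasSum = let v , →v = absolutelySummable⇒summable {term volume ∘ concatenate block} integral-absolutelySummable in
      lim-cong (λ _ → refl)
        (lim-unique (lim-sub {λ M → Σ< M (sumᴮ (term volume) ∘ block)} suc ℕ.n≤1+n (hasSum⇒hasSum-blocks (term volume) block →v))
          (lim-cong (λ M → sym (partial M)) refl (lim-const (I P))))
        →v
      where
      partial : ∀ M → Σ< (suc M) (sumᴮ (term volume) ∘ block) ≈ I P
      partial M = trans (+-cong (trans (sum-block-term volume 0) (∫-coefficients₀ P))
          (sum-zero M λ i → trans (sum-block-term volume (suc (toℕ i))) (∫-coefficients₊ P (toℕ i))))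
        (+-identityʳ _)

    -- The sum of the series at a point of absolute convergence.

    module Pointwise (t : Fin 3 → ℝ) (t∈cube : UnitCube t)
      (summable : AbsolutelySummable (term (λ B → indicator B t) ∘ concatenate block)) where

      private
        w : Box 3 → ℝ
        w B = indicator B t

        ψ : Item → ℝ
        ψ x = ∣ term w x ∣

        0≤ψ : ∀ x → 0# ≤ ψ x
        0≤ψ x = ∣∣-nonneg _

        1≤block-on-face : ∀ m a → OnFace m (t a) → 1# ≤ sumᴮ ψ (block m)
        1≤block-on-face m a (j , j≤ , ta≈) = begin
          1#  ≤⟨ by-nonneg (+-nonneg (0≤ψ (- 1# , faceBox m a j′)) ≤-refl) (+-congʳ one-at-face) ⟩
          sumᴸ ψ (faceItems m a j′)  ≤⟨ term≤sum (suc (size m)) {λ j → sumᴸ ψ (faceItems m a j)} (λ j → sumᴸ-nonneg 0≤ψ (faceItems m a j)) j′ ⟩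
          sum {suc (size m)} (λ j → sumᴸ ψ (faceItems m a j))  ≤⟨ term≤sum 3 {λ a → sum {suc (size m)} λ j → sumᴸ ψ (faceItems m a j)}
                                                                    (λ a → sum-nonneg (suc (size m)) λ j → sumᴸ-nonneg 0≤ψ (faceItems m a j)) a ⟩
          sum {3} (λ a → sum {suc (size m)} λ j → sumᴸ ψ (faceItems m a j))  ≈⟨ sum-faces ψ m ⟨
          sumᴸ ψ (faces m)  ≤⟨ by-nonneg (sumᴸ-nonneg 0≤ψ (cells m)) (trans (sumᴸ-++ ψ (cells m) (faces m)) (+-comm _ _)) ⟩
          sumᴸ ψ (cells m ++ faces m)  ≤⟨ by-nonneg (0≤ψ (0# , wholeCube)) (+-comm _ _) ⟩
          sumᴮ ψ (block m)  ∎
          where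
          open ≤-Reasoning
          j′ : Fin (suc (size m))
          j′ = Fin.fromℕ< (ℕ.s≤s j≤)
          one-at-face : ψ (1# , faceBox m a j′) ≈ 1#
          one-at-face = trans (∣∣-cong (trans (*-identityˡ _) (indicator-inside (faceBox m a j′) t
            (faceBox-inside m a j′ t t∈cube (trans ta≈ (reflexive (≡.cong (grid m) (≡.sym (Fin.toℕ-fromℕ< (ℕ.s≤s j≤))))))))))
            (∣∣-nonneg-≈ 0≤1)

      -- On a face of level `m` every block from `m` on would contribute at least 1 in absolute
      -- value, against the bound given by absolute summability.
      off-faces : ∀ m a → ¬ OnFace m (t a)
      off-faces m a onFace = let b , bound = absolutelySummable⇒bounded-blocks (term w) block summable
                                 n , b<n = archimedean b
        in <⇒≱ b<n (≤-trans (≤-trans (many n) (by-nonneg (sum-nonneg m λ i → 0≤block (toℕ i)) (trans (Σ<-split m n (sumᴮ ψ ∘ block)) (+-comm _ _)))) (bound (m ℕ.+ n)))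
        where
        0≤block : ∀ i → 0# ≤ sumᴮ ψ (block i)
        0≤block i = +-nonneg (0≤ψ (0# , wholeCube)) (sumᴸ-nonneg 0≤ψ (cells i ++ faces i))
        later : ∀ i → OnFace (m ℕ.+ i) (t a)
        later zero    = ≡.subst (λ k → OnFace k (t a)) (≡.sym (ℕ.+-identityʳ m)) onFace
        later (suc i) = ≡.subst (λ k → OnFace k (t a)) (≡.sym (ℕ.+-suc m i)) (onFace-suc (m ℕ.+ i) (later i))
        many : ∀ n → num n ≤ Σ< n (λ i → sumᴮ ψ (block (m ℕ.+ i)))
        many n = ≤-trans (≤-reflexive (sym (trans (sum-const n 1#) (*-identityʳ _))))
          (Σ<-mono n {λ _ → 1#} {λ i → sumᴮ ψ (block (m ℕ.+ i))} λ i → 1≤block-on-face (m ℕ.+ i) a (later i))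

      InCell : ∀ m → Fin 3 → Fin (size m) → Set
      InCell m a i = lo (cell m i) ≤ t a × t a ≤ hi (cell m i)

      private
        0<t : ∀ a → 0# < t a
        0<t a = decide (proj₁ (t∈cube a))
          where
          decide : 0# ≤ t a → 0# < t a
          decide (inj₁ 0<t) = 0<t
          decide (inj₂ 0≈t) = ⊥-elim (off-faces 0 a (0 , ℕ.z≤n , trans (sym 0≈t) (sym (zeroˡ _))))

        locate : ∀ m a N → t a ≤ grid m N → ∃[ i ] i ℕ.< N × grid m i ≤ t a × t a ≤ grid m (suc i)
        locate m a zero    t≤ = ⊥-elim (<⇒≱ (0<t a) (≤-trans t≤ (≤-reflexive (zeroˡ _))))
        locate m a (suc N) t≤ = [ (λ t<N → let i , i<N , t∈ = locate m a N (<⇒≤ t<N) in i , ℕ.m≤n⇒m≤1+n i<N , t∈)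
                                , (λ N≤t → N , ℕ.≤-refl , N≤t , t≤) ]′ (<-or-≥ (t a) (grid m N))

        found : ∀ m a → ∃[ i ] InCell m a i
        found m a = let i , i<N , lo≤ , ≤hi = locate m a (size m) (≤-trans (proj₂ (t∈cube a)) (≤-reflexive (sym (size*width m))))
                        eq = Fin.toℕ-fromℕ< i<N
          in Fin.fromℕ< i<N , ≤-trans (≤-reflexive (reflexive (≡.cong (grid m) eq))) lo≤
                            , ≤-trans ≤hi (≤-reflexive (reflexive (≡.cong (λ k → grid m (suc k)) (≡.sym eq))))

        not-below : ∀ m a {i j} → InCell m a i → InCell m a j → ¬ (toℕ i ℕ.< toℕ j)
        not-below m a {i} {j} (_ , t≤) (≤t , _) i<j = off-faces m a (suc (toℕ i) , Fin.toℕ<n i , ≤-antisym t≤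
          (≤-trans (*-monoʳ-≤ (width-nonneg m) (num-mono-≤ i<j)) ≤t))

      abstract
        index : ∀ m → Fin 3 → Fin (size m)
        index m a = proj₁ (found m a)

        inIndex : ∀ m a → InCell m a (index m a)
        inIndex m a = proj₂ (found m a)

      -- Closed cells overlap only in grid points, which `off-faces` excludes.
      inCell-unique : ∀ m a {i j} → InCell m a i → InCell m a j → i ≡ j
      inCell-unique m a {i} {j} p q = Fin.toℕ-injective (ℕ.≤-antisym
        (ℕ.≮⇒≥ (not-below m a {j} {i} q p)) (ℕ.≮⇒≥ (not-below m a {i} {j} p q)))

      parent-index : ∀ m a → parent {m} (index (suc m) a) ≡ index m a
      parent-index m a = inCell-unique m a
        ( ≤-trans (parent-lo m (index (suc m) a)) (proj₁ (inIndex (suc m) a))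
        , ≤-trans (proj₂ (inIndex (suc m) a)) (parent-hi m (index (suc m) a)) )
        (inIndex m a)

      private
        outside : ∀ m {i j k} a b → triple i j k a ≡ b → ¬ (b ≡ index m a) → w (cellBox m i j k) ≈ 0#
        outside m {i} {j} {k} a b eq b≢ = indicator-outside (cellBox m i j k) t λ inside → b≢ (inCell-unique m a (coordinate a b eq inside) (inIndex m a))
          where
          coordinate : ∀ a b → triple i j k a ≡ b → Box._∋_ (cellBox m i j k) t → InCell m a b
          coordinate 0F b ≡.refl inside = inside 0F
          coordinate 1F b ≡.refl inside = inside 1F
          coordinate 2F b ≡.refl inside = inside 2F

      sum-at-point : ∀ m (f : (i j k : Fin (size m)) → ℝ) → sum³ (size m) (λ i j k → f i j k * w (cellBox m i j k)) ≈ f (index m 0F) (index m 1F) (index m 2F)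
      sum-at-point m f = begin
        sum³ n g  ≈⟨ sum-single n {λ i → sum {n} λ j → sum {n} (g i j)} i₀ (λ i i≢ → sum-zero n λ j → sum-zero n λ k → null i j k (outside m {i} {j} {k} 0F i ≡.refl i≢)) ⟩
        sum {n} (λ j → sum {n} (g i₀ j))  ≈⟨ sum-single n {λ j → sum {n} (g i₀ j)} j₀ (λ j j≢ → sum-zero n λ k → null i₀ j k (outside m {i₀} {j} {k} 1F j ≡.refl j≢)) ⟩
        sum {n} (g i₀ j₀)  ≈⟨ sum-single n {g i₀ j₀} k₀ (λ k k≢ → null i₀ j₀ k (outside m {i₀} {j₀} {k} 2F k ≡.refl k≢)) ⟩
        f i₀ j₀ k₀ * w (cellBox m i₀ j₀ k₀)  ≈⟨ *-congˡ (indicator-inside (cellBox m i₀ j₀ k₀) t inside) ⟩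
        f i₀ j₀ k₀ * 1#  ≈⟨ *-identityʳ _ ⟩
        f i₀ j₀ k₀  ∎
        where
        open ≈-Reasoning
        n = size m
        i₀ = index m 0F
        j₀ = index m 1F
        k₀ = index m 2F
        g : (i j k : Fin n) → ℝ
        g i j k = f i j k * w (cellBox m i j k)
        null : ∀ i j k → w (cellBox m i j k) ≈ 0# → g i j k ≈ 0#
        null i j k w≈0 = trans (*-congˡ w≈0) (zeroʳ _)
        inside : Box._∋_ (cellBox m i₀ j₀ k₀) t
        inside 0F = inIndex m 0F
        inside 1F = inIndex m 1F
        inside 2F = inIndex m 2F

      valueAt : ℕ → ℝ
      valueAt m = value P m (index m 0F) (index m 1F) (index m 2F)

      private
        increment : ∀ m → sumᴮ (term w) (block (suc m)) ≈ valueAt (suc m) - valueAt m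
        increment m = trans (sum-block-term w (suc m)) (trans (sum-at-point (suc m) (coefficients P (suc m)))
          (+-congˡ (-‿cong (reflexive (≡.cong₂ (λ i (j , k) → value P m i j k) (parent-index m 0F)
            (≡.cong₂ _,_ (parent-index m 1F) (parent-index m 2F)))))))

      partial-sums : ∀ M → Σ< (suc M) (sumᴮ (term w) ∘ block) ≈ valueAt M
      partial-sums zero    = trans (+-identityʳ _) (trans (sum-block-term w 0) (sum-at-point 0 (coefficients P 0)))
      partial-sums (suc M) = trans (Σ<-snoc (suc M) (sumᴮ (term w) ∘ block)) (trans (+-cong (partial-sums M) (increment M))
        (solve 2 (λ x y → x :+ (y :- x) := y) refl (valueAt M) (valueAt (suc M))))

      x : Fin 3 → ℂ
      x a = e (t a)

      private
        near-point : ∀ m a → ζ m (index m a) -ᶜ x a ⊑ mesh m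
        near-point m a = ⊑-cong (solveᶜ 2 (λ p q → :-ᶜ (p :-ᶜ q) :=ᶜ q :-ᶜ p) reflᶜ (x a) (ζ m (index m a))) refl
          (⊑-neg (e-mesh m (proj₁ (inIndex m a)) (≤-trans (proj₂ (inIndex m a)) (≤-reflexive (grid-suc m (toℕ (index m a)))))))

        ≉-1 : ∀ a → ¬ (x a ≈ᶜ -ᶜ 1ᶜ)
        ≉-1 a x≈ = [ (λ t≈0 → off-faces 0 a (0 , ℕ.z≤n , trans t≈0 (sym (zeroˡ _))))
                   , [ (λ t≈½ → off-faces 0 a (2 ℕ.^ 15 , ≡.subst (2 ℕ.^ 15 ℕ.≤_) (≡.sym N₀≡) (ℕ.^-monoʳ-≤ 2 {15} {16} (ℕ.n≤1+n 15)) , trans t≈½ (sym half)))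
                     , (λ t≈1 → off-faces 0 a (size 0 , ℕ.≤-refl , trans t≈1 (sym (size*width 0)))) ]′ ]′
          (e≈-1 (proj₁ (t∈cube a)) (proj₂ (t∈cube a)) x≈)
          where
          half : num (2 ℕ.^ 15) * ½^ 16 ≈ ½
          half = trans (solve 3 (λ n h d → n :* (h :* d) := (n :* d) :* h) refl (num (2 ℕ.^ 15)) ½ (½^ 15)) (trans (*-congʳ (num2^*½^ 15)) (*-identityˡ ½))

        +≈0⇒≈- : ∀ {z w} → z +ᶜ w ≈ᶜ 0ᶜ → w ≈ᶜ -ᶜ z
        +≈0⇒≈- {z} {w} eq = transᶜ (solveᶜ 2 (λ z w → w :=ᶜ :-ᶜ z :+ᶜ (z :+ᶜ w)) reflᶜ z w) (transᶜ (ℂR.+-congˡ eq) (ℂR.+-identityʳ _))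

      p : ℂ
      p = denominator (x 0F) (x 1F) (x 2F)

      -- With radius 0, `factors-⊑` makes 1 + x, 1 + y or x + y vanish. In the last case p = 0 gives
      -- z = -1, so some coordinate is -1 in any case, contrary to `≉-1`.
      p≉0 : ¬ (p ≈ᶜ 0ᶜ)
      p≉0 p≈0 = [ (λ ab≈0 → [ (λ a≈0 → ≉-1 0F (+≈0⇒≈- (∥∥²-zero a≈0))) , (λ b≈0 → ≉-1 1F (+≈0⇒≈- (∥∥²-zero b≈0))) ]′ (*-zero-product ab≈0))
                , (λ c≈0 → ≉-1 2F (+≈0⇒≈- (transᶜ (transᶜ (symᶜ (ℂR.+-identityʳ _)) (transᶜ (ℂR.+-congˡ (symᶜ (∥∥²-zero c≈0)))
                    (solveᶜ 3 (λ a b c → :1ᶜ :+ᶜ c :+ᶜ (a :+ᶜ b) :=ᶜ :1ᶜ :+ᶜ a :+ᶜ b :+ᶜ c) reflᶜ (x 0F) (x 1F) (x 2F)))) p≈0))) ]′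
        (*-zero-product (≤-antisym
          (≤-trans (factors-⊑ {x 0F} {x 1F} {x 2F} (e-conj _) (e-conj _) (e-conj _) (⊑-cong (symᶜ p≈0) refl ⊑-0))
            (≤-reflexive (solve 1 (λ n → n :* (:0 :* :0) := :0) refl (num 16))))
          (*-nonneg (*-nonneg (∥∥²-nonneg _) (∥∥²-nonneg _)) (∥∥²-nonneg _))))

      0<∥p∥² : 0# < ∥ p ∥²
      0<∥p∥² = [ (λ lt → lt) , (λ ≤0 → ⊥-elim (p≉0 (∥∥²-zero (≤-antisym ≤0 (∥∥²-nonneg p))))) ]′ (<-or-≥ 0# ∥ p ∥²)

      valueAt-converges : ConvergesTo valueAt (part (x 2F ÷ p))
      -- The radius ρ = ½^ k is chosen below the squared modulus of `p`; then also ρ² ≤ ρ is below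
      -- it, and no square root is taken.
      valueAt-converges = let k , ρ<p = ½^-small 0<∥p∥² in
        lim-squeeze k (C*½^-null (num 7 * inv (½^ k) * inv (½ * ½^ k))) λ M k≤M →
          limit-bound P M (½^-pos k)
            (≤-trans (≤-trans (*-monoʳ-≤ (½^-nonneg k) (½^-≤1 k)) (≤-reflexive (*-identityˡ _))) (<⇒≤ ρ<p))
            (½^-antitone {k} {M} k≤M)
            record
              { unit-x = e-conj _ ; unit-y = e-conj _ ; unit-z = e-conj _
              ; unit-x′ = e-conj _ ; unit-y′ = e-conj _ ; unit-z′ = e-conj _
              ; Δx = near-point M 0F ; Δy = near-point M 1F ; Δz = near-point M 2F
              }

      hasSum-at-point : HasSum (term w ∘ concatenate block) (part (x 2F ÷ p))
      hasSum-at-point = let v , →v = absolutelySummable⇒summable {term w ∘ concatenate block} summable in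
        lim-cong (λ _ → refl)
          (lim-unique (lim-sub {λ M → Σ< M (sumᴮ (term w) ∘ block)} suc ℕ.n≤1+n (hasSum⇒hasSum-blocks (term w) block →v))
            (lim-cong (λ M → sym (partial-sums M)) refl valueAt-converges))
          →v

    hasIntegral : ∀ {f : (Fin 3 → ℝ) → ℝ → Set} →
      (∀ t → let y a = e (t a); p = denominator (y 0F) (y 1F) (y 2F) in
        0# < ∥ p ∥² → f t (part (y 2F ÷ p))) →
      HasIntegral f (I P)
    hasIntegral {f} graph = proj₁ ∘ concatenate block , proj₂ ∘ concatenate block ,
      integral-absolutelySummable , integral-hasSum , λ t t∈cube summable →
        let module At = Pointwise t t∈cube summable in _ , graph t At.0<∥p∥² , At.hasSum-at-point

-- The polynomial 1 + x + y + z and its measure.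

module Measure (em : ExcludedMiddle 0ℓ) (𝓡 : CompleteOrderedField) where
  open Analysis 𝓡
  open OrderedField em 𝓡
  open Complex em 𝓡
  open Exponential em 𝓡
  open Circle em 𝓡
  open Truncation em 𝓡
  open GridSeries em 𝓡 using (I)
  open Integral em 𝓡

  polynomial : Polynomial 3
  polynomial = one ⊕ var 0F ⊕ var 1F ⊕ var 2F

  coefficient-absent : ∀ {k} (Q : Polynomial k) {e} → All (λ (_ , e′) → ¬ (e ≡ e′)) Q → coefficient Q e ≈ᶜ 0ᶜ
  coefficient-absent [] [] = reflᶜ
  coefficient-absent ((a , e′) ∷ Q) {e} (e≢ ∷ absent) with ≡-dec ℕ._≟_ e e′
  ... | yes e≡ = ⊥-elim (e≢ e≡)
  ... | no _   = coefficient-absent Q absent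

  hasDegree : HasDegree 2F polynomial 1
  hasDegree = (0 ∷ 0 ∷ 1 ∷ [] , ≡.refl , λ (re≈0 , _) → >0⇒≉0 0<1 (trans (sym (+-identityʳ 1#)) re≈0)) , bound
    where
    bound : ∀ e → ¬ (coefficient polynomial e ≈ᶜ 0ᶜ) → Vec.lookup e 2F ℕ.≤ 1
    bound (a ∷ b ∷ 0 ∷ []) _ = ℕ.z≤n
    bound (a ∷ b ∷ 1 ∷ []) _ = ℕ.≤-refl
    bound (a ∷ b ∷ suc (suc c) ∷ []) present =
      ⊥-elim (present (coefficient-absent polynomial {a ∷ b ∷ suc (suc c) ∷ []} ((λ ()) ∷ (λ ()) ∷ (λ ()) ∷ (λ ()) ∷ [])))

  eval-polynomial : ∀ x → eval polynomial x ≈ᶜ denominator (x 0F) (x 1F) (x 2F)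
  -- The left side is `eval polynomial x` as it unfolds: for each monomial the coefficient, the
  -- three powers, where a first power is `x *ᶜ 1ᶜ`, and the closing `1ᶜ` of the product.
  eval-polynomial x = solveᶜ 3 (λ x y z → let o = :1ᶜ in
      o :*ᶜ (o :*ᶜ (o :*ᶜ (o :*ᶜ o))) :+ᶜ
      (o :*ᶜ ((x :*ᶜ o) :*ᶜ (o :*ᶜ (o :*ᶜ o))) :+ᶜ
      (o :*ᶜ (o :*ᶜ ((y :*ᶜ o) :*ᶜ (o :*ᶜ o))) :+ᶜ
      (o :*ᶜ (o :*ᶜ (o :*ᶜ ((z :*ᶜ o) :*ᶜ o))) :+ᶜ :0ᶜ))) :=ᶜ
      o :+ᶜ x :+ᶜ y :+ᶜ z) reflᶜ (x 0F) (x 1F) (x 2F)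

  eval-∂polynomial : ∀ x → eval (∂ 2F polynomial) x ≈ᶜ 1ᶜ
  -- Again the unfolded sum: differentiation turns the coefficients into the multiples 0, 0, 0 and 1
  -- of `1ᶜ`, the last of which unfolds to `1ᶜ +ᶜ 0ᶜ`.
  eval-∂polynomial x = solveᶜ 2 (λ x y → let o = :1ᶜ; n = :0ᶜ in
      n :*ᶜ (o :*ᶜ (o :*ᶜ (o :*ᶜ o))) :+ᶜ
      (n :*ᶜ ((x :*ᶜ o) :*ᶜ (o :*ᶜ (o :*ᶜ o))) :+ᶜ
      (n :*ᶜ (o :*ᶜ ((y :*ᶜ o) :*ᶜ (o :*ᶜ o))) :+ᶜ
      ((o :+ᶜ n) :*ᶜ (o :*ᶜ (o :*ᶜ (o :*ᶜ o))) :+ᶜ n))) :=ᶜ o) reflᶜ (x 0F) (x 1F)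

  integrand : ∀ t → let x a = e (t a); p = denominator (x 0F) (x 1F) (x 2F) in
    0# < ∥ p ∥² → Integrand 2F polynomial t (x 2F ÷ p)
  integrand t 0<p = x , (λ i → e-isUnitCircle (t i)) ,
    (λ p≈0 → >0⇒≉0 0<p (trans (∥∥²-cong (transᶜ (symᶜ (eval-polynomial x)) p≈0)) (solve 0 (:0 :* :0 :+ :0 :* :0 := :0) refl))) ,
    transᶜ (ℂR.*-congˡ (eval-polynomial x)) (transᶜ (÷-* (x 2F) 0<p)
      (symᶜ (transᶜ (ℂR.*-congʳ (eval-∂polynomial x)) (ℂR.*-identityˡ (x 2F)))))
    where
    x : Fin 3 → ℂ
    x a = e (t a)

  ¼≈1*¼ : fromℝ (1/suc 3) ≈ᶜ fromℝ (1/suc 0) *ᶜ fromℝ ¼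
  ¼≈1*¼ = symᶜ (transᶜ (ℂR.*-congʳ {fromℝ ¼} {fromℝ (1/suc 0)} {1ᶜ} (fromℝ-cong (trans (sym (*-identityˡ _)) (num*1/suc 0))))
    (ℂR.*-identityˡ (fromℝ ¼)))

  quotientAt : (Fin 3 → ℝ) → ℂ
  quotientAt t = e (t 2F) ÷ denominator (e (t 0F)) (e (t 1F)) (e (t 2F))

  hasIntegralℂ : HasIntegralℂ (Integrand 2F polynomial) (fromℝ ¼)
  hasIntegralℂ =
    hasIntegral rePart {λ t u → ∃[ w ] Integrand 2F polynomial t w × re w ≈ u} (λ t 0<p → quotientAt t , integrand t 0<p , refl) ,
    hasIntegral imPart {λ t u → ∃[ w ] Integrand 2F polynomial t w × im w ≈ u} (λ t 0<p → quotientAt t , integrand t 0<p , refl)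

  hasMeasure : HasMeasure {2} polynomial (fromℝ (1/suc 3))
  hasMeasure = 0 , hasDegree , fromℝ ¼ , hasIntegralℂ , ¼≈1*¼

theorem1p3 : ExcludedMiddle 0ℓ → (𝓡 : CompleteOrderedField) →
    let open Analysis 𝓡 in
    HasMeasure {2} (one ⊕ var 0F ⊕ var 1F ⊕ var 2F) (fromℝ (1/suc 3))
theorem1p3 em 𝓡 = Measure.hasMeasure em 𝓡
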